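{- Let $K$ be an imaginary quadratic field, and let $L_1=\mathbb{Z}+\mathbb{Z}\tau_1$ and $L_2=\mathbb{Z}+\mathbb{Z}\tau_2$ be lattices in $K$ (with $\tau_1,\tau_2\in K$) of conductors $f_1$ and $f_2$; put $E_i=\mathbb{C}/L_i$, $f=\mathrm{lcm}(f_1,f_2)$ and $\tilde E=\mathbb{C}/L_1L_2$. For $z\in\mathbb{C}$ let $S_z=\mathbb{C}^2/\Lambda_z$, where $\Lambda_z\subset\mathbb{C}^2$ is the $\mathbb{Z}$-span of the columns of \[\begin{pmatrix} \tau_{2} & 1 & z & 0\\ 0 & 0 & \tau_{1} & 1\end{pmatrix},\] so that $S_z$ is an extension $0\to E_2\to S_z\to E_1\to 0$ of complex tori. Suppose the image $P$ of $z$ in $\tilde E$ is a torsion point of order $n\ge1$. Then \[S_z \cong \mathbb{C}/\mathcal{O}_{nf} \oplus \tilde E/\langle P\rangle.\]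
   Context: $\mathcal{O}_m=\mathbb{Z}+m\mathcal{O}_K$; the conductor of a lattice $L\subset K$ is the $m$ with $\{\alpha\in K:\alpha L\subset L\}=\mathcal{O}_m$. $L_1L_2$ denotes the product lattice (the $\mathbb{Z}$-span of products). The map $z\mapsto S_z$ induces an isomorphism from $\tilde E$ onto the group of extension classes of $E_1$ by $E_2$ as complex tori. -}

module Defs where

open import Algebra.Bundles using (CommutativeMonoid)
open import Algebra.Bundles.Raw using (RawGroup)
import Algebra.Properties.CommutativeSemigroup as CommutativeSemigroupProperties
open import Algebra.Morphism.Structures using (module GroupMorphisms)
import Algebra.Definitions.RawMonoid as RawMonoidDefinitions
open import Data.Fin.Base using (zero)
open import Data.Integer.Base using (ℤ; +_)
open import Data.List.Base using (List)
open import Data.Nat.Base as ℕ using (ℕ; _⊔_)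
import Data.Nat.Properties as ℕ
open import Data.Product.Base using (Σ; ∃; ∃₂; _×_; _,_)
open import Data.Rational.Base as ℚ using (ℚ; 0ℚ; 1ℚ; ½)
import Data.Rational.Properties as ℚ
open import Data.Vec.Functional as Vector using (Vector)
open import Function.Definitions using (Inverseᵇ)
open import Level using (0ℓ)
open import Relation.Binary.Core using (Rel)
open import Relation.Binary.PropositionalEquality using (_≡_; sym; trans; cong; cong₂; subst; module ≡-Reasoning)
open import Relation.Nullary.Negation using (¬_)
open import Relation.Unary using (Pred; _∈_; _≐_; ｛_｝)

IsCauchy : (ℕ → ℚ) → Set
IsCauchy x = ∀ ε → 0ℚ ℚ.< ε →
  ∃ λ N → ∀ m n → N ℕ.≤ m → N ℕ.≤ n → ℚ.∣ x m ℚ.- x n ∣ ℚ.< ε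

record ℝ : Set where
  constructor mkℝ
  field
    seq    : ℕ → ℚ
    cauchy : IsCauchy seq
open ℝ public

infix 4 _≈ℝ_ _≤ℝ_ _<ℝ_

record _≈ℝ_ (x y : ℝ) : Set where
  constructor mk≈ℝ
  field
    close : ∀ ε → 0ℚ ℚ.< ε →
      ∃ λ N → ∀ n → N ℕ.≤ n → ℚ.∣ seq x n ℚ.- seq y n ∣ ℚ.< ε
open _≈ℝ_ public

_≤ℝ_ : Rel ℝ 0ℓ
x ≤ℝ y = ∀ ε → 0ℚ ℚ.< ε →
  ∃ λ N → ∀ n → N ℕ.≤ n → seq x n ℚ.≤ seq y n ℚ.+ ε

_<ℝ_ : Rel ℝ 0ℓ
x <ℝ y = ∃ λ ε → 0ℚ ℚ.< ε ×
  (∃ λ N → ∀ n → N ℕ.≤ n → seq x n ℚ.+ ε ℚ.≤ seq y n)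

private
  open CommutativeSemigroupProperties (CommutativeMonoid.commutativeSemigroup ℚ.+-0-commutativeMonoid) using (interchange)
  open CommutativeSemigroupProperties (CommutativeMonoid.commutativeSemigroup ℚ.*-1-commutativeMonoid) using (x∙yz≈y∙xz)
  open ≡-Reasoning

  [a-b]+b≡a : ∀ a b → (a ℚ.- b) ℚ.+ b ≡ a
  [a-b]+b≡a a b = trans (ℚ.+-assoc a (ℚ.- b) b)
    (trans (cong (a ℚ.+_) (ℚ.+-inverseˡ b)) (ℚ.+-identityʳ a))

  telescope : ∀ a b c → (a ℚ.- b) ℚ.+ (b ℚ.- c) ≡ a ℚ.- c
  telescope a b c = trans (sym (ℚ.+-assoc (a ℚ.- b) b (ℚ.- c)))
    (cong (ℚ._- c) ([a-b]+b≡a a b))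

  *-distribˡ-- : ∀ a b c → a ℚ.* (b ℚ.- c) ≡ a ℚ.* b ℚ.- a ℚ.* c
  *-distribˡ-- a b c = trans (ℚ.*-distribˡ-+ a b (ℚ.- c))
    (cong (a ℚ.* b ℚ.+_) (sym (ℚ.neg-distribʳ-* a c)))

  +-difference : ∀ a b c d → (a ℚ.- b) ℚ.+ (c ℚ.- d) ≡ (a ℚ.+ c) ℚ.- (b ℚ.+ d)
  +-difference a b c d = trans (interchange a (ℚ.- b) c (ℚ.- d))
    (cong (a ℚ.+ c ℚ.+_) (sym (ℚ.neg-distrib-+ b d)))

  *-difference : ∀ a b c d → a ℚ.* (c ℚ.- d) ℚ.+ d ℚ.* (a ℚ.- b) ≡ a ℚ.* c ℚ.- b ℚ.* d
  *-difference a b c d = begin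
    a ℚ.* (c ℚ.- d) ℚ.+ d ℚ.* (a ℚ.- b)                        ≡⟨ cong₂ ℚ._+_ (*-distribˡ-- a c d) (*-distribˡ-- d a b) ⟩
    (a ℚ.* c ℚ.- a ℚ.* d) ℚ.+ (d ℚ.* a ℚ.- d ℚ.* b)            ≡⟨ cong₂ (λ s t → (a ℚ.* c ℚ.- a ℚ.* d) ℚ.+ (s ℚ.- t)) (ℚ.*-comm d a) (ℚ.*-comm d b) ⟩
    (a ℚ.* c ℚ.- a ℚ.* d) ℚ.+ (a ℚ.* d ℚ.- b ℚ.* d)            ≡⟨ telescope (a ℚ.* c) (a ℚ.* d) (b ℚ.* d) ⟩
    a ℚ.* c ℚ.- b ℚ.* d                                        ∎

  half-pos : ∀ {ε} → 0ℚ ℚ.< ε → 0ℚ ℚ.< ε ℚ.* ½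
  half-pos {ε} ε>0 = ℚ.positive⁻¹ _ {{ℚ.pos*pos⇒pos ε {{ℚ.positive ε>0}} ½}}

  half+half : ∀ ε → ε ℚ.* ½ ℚ.+ ε ℚ.* ½ ≡ ε
  half+half ε = trans (sym (ℚ.*-distribˡ-+ ε ½ ½)) (ℚ.*-identityʳ ε)

  ∣+∣< : ∀ a b c d → ℚ.∣ a ∣ ℚ.< b → ℚ.∣ c ∣ ℚ.< d → ℚ.∣ a ℚ.+ c ∣ ℚ.< b ℚ.+ d
  ∣+∣< a b c d a<b c<d = ℚ.≤-<-trans (ℚ.∣p+q∣≤∣p∣+∣q∣ a c) (ℚ.+-mono-< a<b c<d)

  ∣*∣< : ∀ a b c d → ℚ.∣ a ∣ ℚ.< b → ℚ.∣ c ∣ ℚ.< d → ℚ.∣ a ℚ.* c ∣ ℚ.< b ℚ.* d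
  ∣*∣< a b c d a<b c<d = subst (ℚ._< b ℚ.* d) (sym (ℚ.∣p*q∣≡∣p∣*∣q∣ a c))
    (ℚ.≤-<-trans
      (ℚ.*-monoʳ-≤-nonNeg ℚ.∣ c ∣ {{ℚ.nonNegative (ℚ.0≤∣p∣ c)}} (ℚ.<⇒≤ a<b))
      (ℚ.*-monoʳ-<-pos b {{ℚ.positive (ℚ.≤-<-trans (ℚ.0≤∣p∣ a) a<b)}} c<d))

  scale : ∀ ε B → 0ℚ ℚ.< ε → 0ℚ ℚ.< B → ∃ λ δ → 0ℚ ℚ.< δ × B ℚ.* δ ≡ ε
  scale ε B ε>0 B>0 = ε ℚ.* B⁻¹
    , ℚ.positive⁻¹ _ {{ℚ.pos*pos⇒pos ε {{ℚ.positive ε>0}} B⁻¹ {{ℚ.1/pos⇒pos B}}}}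
    , trans (x∙yz≈y∙xz B ε B⁻¹)
        (trans (cong (ε ℚ.*_) (ℚ.*-inverseʳ B)) (ℚ.*-identityʳ ε))
    where
    instance
      B-pos : ℚ.Positive B
      B-pos = ℚ.positive B>0
      B-nonZero : ℚ.NonZero B
      B-nonZero = ℚ.pos⇒nonZero B
    B⁻¹ : ℚ
    B⁻¹ = ℚ.1/ B

  bounded : ∀ x →
    ∃₂ λ B N → 0ℚ ℚ.< B × (∀ n → N ℕ.≤ n → ℚ.∣ seq x n ∣ ℚ.< B)
  bounded x with cauchy x 1ℚ (ℚ.positive⁻¹ 1ℚ)
  ... | N , x-close = B , N , ℚ.≤-<-trans (ℚ.0≤∣p∣ (seq x N)) (bound N ℕ.≤-refl) , bound
    where
    B : ℚ
    B = 1ℚ ℚ.+ ℚ.∣ seq x N ∣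
    bound : ∀ n → N ℕ.≤ n → ℚ.∣ seq x n ∣ ℚ.< B
    bound n N≤n = ℚ.≤-<-trans
      (subst (λ t → ℚ.∣ t ∣ ℚ.≤ ℚ.∣ seq x n ℚ.- seq x N ∣ ℚ.+ ℚ.∣ seq x N ∣)
        ([a-b]+b≡a (seq x n) (seq x N))
        (ℚ.∣p+q∣≤∣p∣+∣q∣ (seq x n ℚ.- seq x N) (seq x N)))
      (ℚ.+-mono-<-≤ (x-close n N N≤n ℕ.≤-refl) ℚ.≤-refl)

-- Abstract because unfolding these moduli makes type checking prohibitively slow.
abstract
  const-cauchy : ∀ q → IsCauchy (λ _ → q)
  const-cauchy q ε ε>0 = 0 , λ _ _ _ _ →
    subst (λ t → ℚ.∣ t ∣ ℚ.< ε) (sym (ℚ.+-inverseʳ q)) ε>0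

  +-cauchy : ∀ x y → IsCauchy (λ n → seq x n ℚ.+ seq y n)
  +-cauchy x y ε ε>0 =
    let M , x-close = cauchy x (ε ℚ.* ½) (half-pos ε>0)
        N , y-close = cauchy y (ε ℚ.* ½) (half-pos ε>0)
    in M ⊔ N , λ m n m≥ n≥ →
    let Δx = seq x m ℚ.- seq x n
        Δy = seq y m ℚ.- seq y n
    in subst (λ t → ℚ.∣ t ∣ ℚ.< ε)
      (+-difference (seq x m) (seq x n) (seq y m) (seq y n))
      (subst (ℚ.∣ Δx ℚ.+ Δy ∣ ℚ.<_) (half+half ε)
        (∣+∣< Δx (ε ℚ.* ½) Δy (ε ℚ.* ½)
          (x-close m n (ℕ.m⊔n≤o⇒m≤o M N m≥) (ℕ.m⊔n≤o⇒m≤o M N n≥))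
          (y-close m n (ℕ.m⊔n≤o⇒n≤o M N m≥) (ℕ.m⊔n≤o⇒n≤o M N n≥))))

  neg-cauchy : ∀ x → IsCauchy (λ n → ℚ.- seq x n)
  neg-cauchy x ε ε>0 = let N , x-close = cauchy x ε ε>0 in N , λ m n m≥ n≥ →
    subst (ℚ._< ε)
      (trans (sym (ℚ.∣-p∣≡∣p∣ (seq x m ℚ.- seq x n)))
        (cong ℚ.∣_∣ (ℚ.neg-distrib-+ (seq x m) (ℚ.- seq x n))))
      (x-close m n m≥ n≥)

  *-cauchy : ∀ x y → IsCauchy (λ n → seq x n ℚ.* seq y n)
  *-cauchy x y ε ε>0 =
    let A , M₁ , A>0 , x<A = bounded x
        B , N₁ , B>0 , y<B = bounded y
        α , α>0 , Aα≡ε/2 = scale (ε ℚ.* ½) A (half-pos ε>0) A>0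
        β , β>0 , Bβ≡ε/2 = scale (ε ℚ.* ½) B (half-pos ε>0) B>0
        M₂ , x-close = cauchy x β β>0
        N₂ , y-close = cauchy y α α>0
        P = M₁ ⊔ N₁
        Q = M₂ ⊔ N₂
    in P ⊔ Q , λ m n m≥ n≥ →
    let Δx = seq x m ℚ.- seq x n
        Δy = seq y m ℚ.- seq y n
        m≥Q = ℕ.m⊔n≤o⇒n≤o P Q m≥
        n≥Q = ℕ.m⊔n≤o⇒n≤o P Q n≥
        m≥M₁ = ℕ.m⊔n≤o⇒m≤o M₁ N₁ (ℕ.m⊔n≤o⇒m≤o P Q m≥)
        n≥N₁ = ℕ.m⊔n≤o⇒n≤o M₁ N₁ (ℕ.m⊔n≤o⇒m≤o P Q n≥)
    in subst (λ t → ℚ.∣ t ∣ ℚ.< ε)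
      (*-difference (seq x m) (seq x n) (seq y m) (seq y n))
      (subst (ℚ.∣ seq x m ℚ.* Δy ℚ.+ seq y n ℚ.* Δx ∣ ℚ.<_)
        (trans (cong₂ ℚ._+_ Aα≡ε/2 Bβ≡ε/2) (half+half ε))
        (∣+∣< (seq x m ℚ.* Δy) (A ℚ.* α) (seq y n ℚ.* Δx) (B ℚ.* β)
          (∣*∣< (seq x m) A Δy α (x<A m m≥M₁)
            (y-close m n (ℕ.m⊔n≤o⇒n≤o M₂ N₂ m≥Q) (ℕ.m⊔n≤o⇒n≤o M₂ N₂ n≥Q)))
          (∣*∣< (seq y n) B Δx β (y<B n n≥N₁)
            (x-close m n (ℕ.m⊔n≤o⇒m≤o M₂ N₂ m≥Q) (ℕ.m⊔n≤o⇒m≤o M₂ N₂ n≥Q)))))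

infixl 6 _+ℝ_
infixl 7 _*ℝ_
infix  8 -ℝ_

ℚ→ℝ : ℚ → ℝ
ℚ→ℝ q = mkℝ (λ _ → q) (const-cauchy q)

0ℝ 1ℝ : ℝ
0ℝ = ℚ→ℝ 0ℚ
1ℝ = ℚ→ℝ 1ℚ

_+ℝ_ _*ℝ_ : ℝ → ℝ → ℝ
x +ℝ y = mkℝ (λ n → seq x n ℚ.+ seq y n) (+-cauchy x y)
x *ℝ y = mkℝ (λ n → seq x n ℚ.* seq y n) (*-cauchy x y)

-ℝ_ : ℝ → ℝ
-ℝ x = mkℝ (λ n → ℚ.- seq x n) (neg-cauchy x)

infix 4 _+i_

record ℂ : Set where
  constructor _+i_
  field
    re im : ℝ
open ℂ public

infix  4 _≈ℂ_
infixl 6 _+ℂ_ _-ℂ_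
infixl 7 _*ℂ_
infix  8 -ℂ_

_≈ℂ_ : Rel ℂ 0ℓ
x ≈ℂ y = re x ≈ℝ re y × im x ≈ℝ im y

-ℂ_ : ℂ → ℂ
-ℂ x = (-ℝ re x) +i (-ℝ im x)

_+ℂ_ _-ℂ_ _*ℂ_ : ℂ → ℂ → ℂ
x +ℂ y = (re x +ℝ re y) +i (im x +ℝ im y)
x -ℂ y = x +ℂ (-ℂ y)
x *ℂ y = (re x *ℝ re y +ℝ -ℝ (im x *ℝ im y)) +i (re x *ℝ im y +ℝ im x *ℝ re y)

ℝ→ℂ : ℝ → ℂ
ℝ→ℂ x = x +i 0ℝ

ℚ→ℂ : ℚ → ℂ
ℚ→ℂ q = ℝ→ℂ (ℚ→ℝ q)

ℤ→ℂ : ℤ → ℂ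
ℤ→ℂ a = ℚ→ℂ (a ℚ./ 1)

0ℂ 1ℂ : ℂ
0ℂ = ℚ→ℂ 0ℚ
1ℂ = ℚ→ℂ 1ℚ

∣_∣² : ℂ → ℝ
∣ x ∣² = re x *ℝ re x +ℝ im x *ℝ im x

module _ (G : RawGroup 0ℓ 0ℓ) where
  open RawGroup G
  open RawMonoidDefinitions rawMonoid using () renaming (_×_ to _·_)

  data Span (S : Pred Carrier 0ℓ) : Pred Carrier 0ℓ where
    gen  : ∀ {x} → x ∈ S → x ∈ Span S
    zero : ε ∈ Span S
    add  : ∀ {x y} → x ∈ Span S → y ∈ Span S → (x ∙ y) ∈ Span S
    neg  : ∀ {x} → x ∈ Span S → (x ⁻¹) ∈ Span S
    resp : ∀ {x y} → x ≈ y → x ∈ Span S → y ∈ Span S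

  HasOrder : Carrier → ℕ → Set
  HasOrder x n = 1 ℕ.≤ n × n · x ≈ ε × (∀ m → 1 ℕ.≤ m → m · x ≈ ε → n ℕ.≤ m)

ℂ-rawGroup : RawGroup 0ℓ 0ℓ
ℂ-rawGroup = record { _≈_ = _≈ℂ_ ; _∙_ = _+ℂ_ ; ε = 0ℂ ; _⁻¹ = -ℂ_ }

record ImaginaryQuadraticField : Set₁ where
  field
    elements  : Pred ℂ 0ℓ
    resp-≈    : ∀ {x y} → x ≈ℂ y → x ∈ elements → y ∈ elements
    1-closed  : 1ℂ ∈ elements
    +-closed  : ∀ {x y} → x ∈ elements → y ∈ elements → (x +ℂ y) ∈ elements
    neg-closed : ∀ {x} → x ∈ elements → (-ℂ x) ∈ elements
    *-closed  : ∀ {x y} → x ∈ elements → y ∈ elements → (x *ℂ y) ∈ elements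
    inverse   : ∀ {x} → x ∈ elements → ¬ (x ≈ℂ 0ℂ) →
                ∃ λ y → y ∈ elements × x *ℂ y ≈ℂ 1ℂ
    -- [K : ℚ] = 2
    b₁ b₂     : ℂ
    b₁∈       : b₁ ∈ elements
    b₂∈       : b₂ ∈ elements
    spanning  : ∀ {x} → x ∈ elements →
                ∃₂ λ p q → x ≈ℂ ℚ→ℂ p *ℂ b₁ +ℂ ℚ→ℂ q *ℂ b₂
    independent : ∀ p q → ℚ→ℂ p *ℂ b₁ +ℂ ℚ→ℂ q *ℂ b₂ ≈ℂ 0ℂ → p ≡ 0ℚ × q ≡ 0ℚ
    -- K ⊄ ℝ
    imaginary : ∃ λ x → x ∈ elements × ¬ (im x ≈ℝ 0ℝ)
open ImaginaryQuadraticField public using (elements)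

module _ where
  open List using ([]; _∷_)

  -- The list c₀ ∷ c₁ ∷ … ∷ cₙ₋₁ ∷ [] stands for c₀ + c₁X + … + cₙ₋₁Xⁿ⁻¹ + Xⁿ.
  evalMonic : List ℤ → ℂ → ℂ
  evalMonic []       x = 1ℂ
  evalMonic (c ∷ cs) x = ℤ→ℂ c +ℂ x *ℂ evalMonic cs x

IntegralOverℤ : Pred ℂ 0ℓ
IntegralOverℤ x = ∃ λ cs → evalMonic cs x ≈ℂ 0ℂ

𝒪 : ImaginaryQuadraticField → Pred ℂ 0ℓ
𝒪 K x = x ∈ elements K × IntegralOverℤ x

𝒪[_] : ℕ → ImaginaryQuadraticField → Pred ℂ 0ℓ
𝒪[ m ] K x = ∃₂ λ a β → β ∈ 𝒪 K × x ≈ℂ ℤ→ℂ a +ℂ ℤ→ℂ (+ m) *ℂ β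

ℤ_+ℤ_ : ℂ → ℂ → Pred ℂ 0ℓ
(ℤ ω₁ +ℤ ω₂) x = ∃₂ λ a b → x ≈ℂ ℤ→ℂ a *ℂ ω₁ +ℂ ℤ→ℂ b *ℂ ω₂

IsLattice : Pred ℂ 0ℓ → Set
IsLattice L = ∃₂ λ ω₁ ω₂ →
  (∀ r s → ℝ→ℂ r *ℂ ω₁ +ℂ ℝ→ℂ s *ℂ ω₂ ≈ℂ 0ℂ → r ≈ℝ 0ℝ × s ≈ℝ 0ℝ) ×
  L ≐ (ℤ ω₁ +ℤ ω₂)

Multipliers : ImaginaryQuadraticField → Pred ℂ 0ℓ → Pred ℂ 0ℓ
Multipliers K L α = α ∈ elements K × (∀ {x} → x ∈ L → (α *ℂ x) ∈ L)

HasConductor : ImaginaryQuadraticField → Pred ℂ 0ℓ → ℕ → Set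
HasConductor K L m = 1 ℕ.≤ m × Multipliers K L ≐ 𝒪[ m ] K

infixl 7 _·ᴸ_

_·ᴸ_ : Pred ℂ 0ℓ → Pred ℂ 0ℓ → Pred ℂ 0ℓ
L₁ ·ᴸ L₂ = Span ℂ-rawGroup (λ w → ∃₂ λ x y → x ∈ L₁ × y ∈ L₂ × w ≈ℂ x *ℂ y)

ℂ^_ : ℕ → Set
ℂ^ g = Vector ℂ g

ℂ^-rawGroup : ℕ → RawGroup 0ℓ 0ℓ
ℂ^-rawGroup g = record
  { Carrier = ℂ^ g
  ; _≈_     = λ v w → ∀ i → v i ≈ℂ w i
  ; _∙_     = λ v w i → v i +ℂ w i
  ; ε       = λ _ → 0ℂ
  ; _⁻¹     = λ v i → -ℂ v i
  }

infixl 6 _-ᵛ_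

_-ᵛ_ : ∀ {g} → ℂ^ g → ℂ^ g → ℂ^ g
(v -ᵛ w) i = v i -ℂ w i

‖_‖² : ∀ {g} → ℂ^ g → ℝ
‖ v ‖² = Vector.foldr (λ x s → ∣ x ∣² +ℝ s) 0ℝ v

-- The torus ℂᵍ/Λ is represented by Λ alone, without a proof that Λ is a lattice.
-- A point of the torus is given by a representative in ℂᵍ, and equality of
-- points is congruence modulo Λ.
record Torus (g : ℕ) : Set₁ where
  constructor ℂ^/_
  field
    Λ : Pred (ℂ^ g) 0ℓ
open Torus public

torusGroup : ∀ {g} → Torus g → RawGroup 0ℓ 0ℓ
torusGroup {g} T = record (ℂ^-rawGroup g) { _≈_ = λ v w → (v -ᵛ w) ∈ Λ T }

Linear : ℕ → ℕ → Set
Linear g h = Vector (ℂ^ g) h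

apply : ∀ {g h} → Linear g h → ℂ^ g → ℂ^ h
apply D v i = Vector.foldr _+ℂ_ 0ℂ (Vector.zipWith _*ℂ_ (D i) v)

Ball : ∀ {g} → ℂ^ g → ℚ → Pred (ℂ^ g) 0ℓ
Ball p r q = ‖ q -ᵛ p ‖² <ℝ ℚ→ℝ (r ℚ.* r)

-- Fréchet differentiability over ℂ:
-- ‖F q − F p − D(q − p)‖ ≤ ε ‖q − p‖ for q near p, with both sides squared.
ℂ-DifferentiableAt : ∀ {g h} → (ℂ^ g → ℂ^ h) → ℂ^ g → Set
ℂ-DifferentiableAt {g} {h} F p = Σ (Linear g h) λ D →
  ∀ ε → 0ℚ ℚ.< ε → ∃ λ δ → 0ℚ ℚ.< δ ×
  (∀ q → q ∈ Ball p δ →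
    ‖ (F q -ᵛ F p) -ᵛ apply D (q -ᵛ p) ‖² ≤ℝ ℚ→ℝ (ε ℚ.* ε) *ℝ ‖ q -ᵛ p ‖²)

-- A map of tori is holomorphic when around every point it lifts to a
-- holomorphic map between the covering vector spaces.
Holomorphic : ∀ {g h} → Torus g → Torus h → (ℂ^ g → ℂ^ h) → Set
Holomorphic {g} {h} T T′ φ = ∀ p → ∃ λ r → 0ℚ ℚ.< r ×
  Σ (ℂ^ g → ℂ^ h) λ F → ∀ q → q ∈ Ball p r →
    F q ≈′ φ q × ℂ-DifferentiableAt F q
  where open RawGroup (torusGroup T′) renaming (_≈_ to _≈′_)

infix 4 _≅_

record _≅_ {g h} (T : Torus g) (T′ : Torus h) : Set where
  open RawGroup (torusGroup T) using (_≈_)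
  open RawGroup (torusGroup T′) using () renaming (_≈_ to _≈′_)
  open GroupMorphisms (torusGroup T) (torusGroup T′) using (IsGroupHomomorphism)
  field
    to               : ℂ^ g → ℂ^ h
    from             : ℂ^ h → ℂ^ g
    from-cong        : ∀ {v w} → v ≈′ w → from v ≈ from w
    to-homomorphism  : IsGroupHomomorphism to
    inverse          : Inverseᵇ _≈_ _≈′_ to from
    to-holomorphic   : Holomorphic T T′ to
    from-holomorphic : Holomorphic T′ T from

infixr 5 _⊕_

_⊕_ : ∀ {g h} → Torus g → Torus h → Torus (g ℕ.+ h)
Λ (_⊕_ {g} T T′) v = Vector.take g v ∈ Λ T × Vector.drop g v ∈ Λ T′

-- The quotient of T = ℂᵍ/Λ by the cyclic subgroup generated by P is ℂᵍ/Λ′ with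
-- Λ′ the preimage of ⟨P⟩ ⊆ T in ℂᵍ; the span below is taken in the group T.
_/⟨_⟩ : ∀ {g} → Torus g → ℂ^ g → Torus g
T /⟨ P ⟩ = ℂ^/ Span (torusGroup T) ｛ P ｝

ℂ/_ : Pred ℂ 0ℓ → Torus 1
Λ (ℂ/ L) v = v zero ∈ L

point : ℂ → ℂ^ 1
point z _ = z

columnSpan : ∀ {g n} → Vector (Vector ℂ n) g → Pred (ℂ^ g) 0ℓ
columnSpan {g} Π = Span (ℂ^-rawGroup g) (λ v → ∃ λ j → v ≡ Vector.transpose Π j)

module _ where
  open Vector using ([]; _∷_)

  periodMatrix : (τ₁ τ₂ z : ℂ) → Vector (Vector ℂ 4) 2
  periodMatrix τ₁ τ₂ z =
    (τ₂ ∷ 1ℂ ∷ z  ∷ 0ℂ ∷ []) ∷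
    (0ℂ ∷ 0ℂ ∷ τ₁ ∷ 1ℂ ∷ []) ∷ []

S : (τ₁ τ₂ z : ℂ) → Torus 2
S τ₁ τ₂ z = ℂ^/ columnSpan (periodMatrix τ₁ τ₂ z)

{-# OPTIONS --safe #-}
module Submission where

-- Let Aᵢτᵢ² + Bᵢτᵢ + Cᵢ = 0 be primitive, so that ℤ + ℤAᵢτᵢ is the multiplier ring 𝒪_{fᵢ} of Lᵢ, and let
-- fᵢ = g hᵢ with h₁, h₂ coprime.  After a choice of sign, η = h₂A₁τ₁ = h₁A₂τ₂ + r with r ∈ ℤ, and 𝒪_{nf} = ℤ[ω]
-- for ω = nη.  Since nz ∈ L₁L₂, ω acts on Λ_z ≅ ℤ⁴ by an integer matrix W.  If v ∈ ℤ⁴ is such that no prime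
-- divides all 2×2 minors of (v , Wv), there is an integer functional ψ with ψ(v) = 0 and ψ(Wv) = 1.  Then
-- φ(u) = ψ(Wu) + (T + ω)ψ(u), where ω² + Tω + N = 0, is ℤ[ω]-linear with φ(v) = 1, hence is the restriction of a
-- linear form (x , y) ↦ px + qy on ℂ², and (x , y) ↦ (px + qy , v₀y - v₁x) maps Λ_z onto 𝒪_{nf} ⊕ (L₁L₂ + ℤz).
--
-- The vector v = (a , b , c , d) comes from the Chinese remainder theorem: first the tail (c , d) for the primes
-- dividing n h₁, then (a , b) for those dividing n h₂ q₁(c , d), where q₁ is the quadratic form of τ₁.  At a prime
-- p ∣ n this works because W ≢ 0 mod p: otherwise (η + h₂B₁)nz and h₂A₁nz lie in p L₂, which forces nz ∈ p L₁L₂,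
-- against the minimality of n.

open import Defs
open import Algebra.Bundles using (CommutativeRing)
open import Algebra.Bundles.Raw using (RawGroup; RawRing)
import Algebra.Consequences.Setoid as Consequences
open import Algebra.Core using (Op₁; Op₂)
import Algebra.Definitions as Definitions
import Algebra.Definitions.RawMonoid as RawMonoidDefinitions
open import Algebra.Morphism.Structures using (module RingMorphisms)
import Algebra.Properties.AbelianGroup as AbelianGroupProperties
import Algebra.Properties.CommutativeSemigroup as CommutativeSemigroupProperties
import Algebra.Properties.Ring as RingProperties
import Algebra.Solver.Ring as RingSolver
open import Algebra.Solver.Ring.AlmostCommutativeRing using (fromCommutativeRing; _-Raw-AlmostCommutative⟶_)
open import Algebra.Structures using (IsCommutativeRing)
open import Data.Fin.Base using (zero; suc)
open import Data.Integer.Base as ℤ using (ℤ; +_; -[1+_]; 0ℤ; 1ℤ)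
open import Data.Integer.Divisibility.Signed
import Data.Integer.Properties as ℤ
open import Data.List.Base using (List; []; _∷_; length)
open import Data.Maybe.Base using (Maybe; just; nothing)
open import Data.Nat.Base as ℕ using (ℕ; zero; suc; _⊔_; z≤n; s≤s)
import Data.Nat.Divisibility as ℕ
open import Data.Nat.GCD using (gcd; gcd[m,n]∣m; gcd[m,n]∣n; gcd-greatest)
open import Data.Nat.LCM using (lcm; gcd*lcm)
open import Data.Nat.Primality using (Prime; prime⇒nonTrivial)
import Data.Nat.Properties as ℕ
open import Data.Product.Base using (∃; ∃₂; _×_; _,_; proj₁; proj₂)
open import Data.Rational.Base as ℚ using (ℚ; 0ℚ; 1ℚ; ½; mkℚ)
import Data.Rational.Properties as ℚ
open import Data.Rational.Solver using () renaming (module +-*-Solver to ℚ-Solver)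
open import Data.Rational.Unnormalised.Base as ℚᵘ using (mkℚᵘ; *≡*)
import Data.Rational.Unnormalised.Properties as ℚᵘ
open import Data.Sum.Base as Sum using (_⊎_; inj₁; inj₂; [_,_]′)
open import Data.Vec.Base as Vec using (Vec; []; _∷_)
open import Data.Vec.Functional as Vector using ()
open import Data.Vec.N-ary using (N-ary; _$ⁿ_; Eq; curryⁿ; curryⁿ-cong)
import Data.Vec.Properties as Vec
open import Data.Vec.Relation.Unary.All as All using (All; []; _∷_)
open import Function.Base using (_∘_)
open import Level using (0ℓ)
open import Relation.Binary.Bundles using (Setoid)
open import Relation.Binary.Core using (Rel)
open import Relation.Binary.PropositionalEquality as ≡ using (_≡_; _≢_; refl)
open import Relation.Binary.Structures using (IsEquivalence)
open import Relation.Nullary using (¬_; Dec; yes; no; contradiction; _×-dec_)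
open import Relation.Unary using (Pred; _∈_)

-- The obstacle is that ℤ[ω] need not be a Dedekind domain, so a free summand has to be produced by
-- hand. It comes from a v for which ℤ[ω]v is pure in Λ_z. Modulo p such a v exists exactly when W
-- is not scalar mod p, whence the analysis prime by prime. The formula for φ is the identification
-- of Hom(Λ_z , ℤ) with the ℤ[ω]-linear maps Λ_z → ℤ[ω], valid for every quadratic order. A single
-- vector must serve infinitely many primes. The two-stage choice works because the last minor of (v
-- , Wv), which is -n h₂ q₁(c , d), does not involve (a , b): once q₁(c , d) is nonzero, only
-- finitely many primes are left for (a , b). The second factor is a determinant: the 2×2 minors of
-- the period matrix are 0, τ₁τ₂, τ₂, τ₁, 1 and z, which span L₁L₂ + ℤz. The inverse map sends (α ,
-- det(x , y)) to αv + φ(x)y - φ(y)x, which lies in Λ_z. Equality in ℂ cannot be decided, so every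
-- case distinction is made on integers; equations in ℂ are turned into integer equations by the
-- independence of τᵢ and 1.

module Arithmetic where
  open import Data.Integer.Base using (_+_; _*_; -_; _-_)
  open import Data.Integer.Solver using () renaming (module +-*-Solver to ℤ-Solver)
  open import Data.Integer.Tactic.RingSolver using (solve-∀)
  open import Data.List.Membership.DecPropositional ℕ._≟_ using (_∈?_)
  open import Data.List.Membership.Propositional as List using ()
  open import Data.List.Relation.Unary.All as ListAll using ([]; _∷_)
  open import Data.List.Relation.Unary.Any using (here; there)
  open import Data.Nat.GCD using (gcd-GCD; module Bézout)
  open import Data.Nat.ListAction using (product)
  import Data.Nat.ListAction.Properties as ℕ
  open import Data.Nat.Primality
    using (euclidsLemma; ¬prime[0]; ¬prime[1]; prime[2]; prime⇒irreducible)
  open import Data.Nat.Primality.Factorisation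
    using (PrimeFactorisation; factorise; factorisationHasAllPrimeFactors)
  open import Relation.Binary.PropositionalEquality
    using (sym; trans; cong; cong₂; subst; module ≡-Reasoning)
  open ℤ-Solver using (solve; _:+_; _:*_; :-_; _:-_; con; _:=_)

  -- Congruences, Bézout relations and common prime divisors.

  infix 4 _≡_[mod_]
  -- A record rather than a synonym for divisibility of `a - b`, so that `a`, `b` and `p` can be
  -- inferred from the type.
  record _≡_[mod_] (a b : ℤ) (p : ℕ) : Set where
    constructor mod
    field p∣a-b : + p ∣ a - b

  prime-∣-* : ∀ {p} a b → Prime p → + p ∣ a * b → + p ∣ a ⊎ + p ∣ b
  prime-∣-* {p} a b p-prime p∣ab = Sum.map ∣ᵤ⇒∣ ∣ᵤ⇒∣
    (euclidsLemma ℤ.∣ a ∣ ℤ.∣ b ∣ p-prime (subst (p ℕ.∣_) (ℤ.abs-* a b) (∣⇒∣ᵤ p∣ab)))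

  prime-∤-* : ∀ {p} a b → Prime p → ¬ + p ∣ a → ¬ + p ∣ b → ¬ + p ∣ a * b
  prime-∤-* a b p-prime p∤a p∤b p∣ab = [ p∤a , p∤b ]′ (prime-∣-* a b p-prime p∣ab)

  prime-∤-1 : ∀ {p} → Prime p → ¬ + p ∣ 1ℤ
  prime-∤-1 p-prime p∣1 = contradiction
    (subst Prime (ℕ.∣1⇒≡1 (∣⇒∣ᵤ p∣1)) p-prime) ¬prime[1]

  prime-∣-prime : ∀ {p q} → Prime p → Prime q → + p ∣ + q → p ≡ q
  prime-∣-prime p-prime q-prime p∣q with prime⇒irreducible q-prime (∣⇒∣ᵤ p∣q)
  ... | inj₁ refl = contradiction p-prime ¬prime[1]
  ... | inj₂ p≡q  = p≡q

  dot : ∀ {n} → Vec ℤ n → Vec ℤ n → ℤ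
  dot []       []       = 0ℤ
  dot (u ∷ us) (x ∷ xs) = u * x + dot us xs

  dot-scale : ∀ {n} k (us xs : Vec ℤ n) → dot (Vec.map (k *_) us) xs ≡ k * dot us xs
  dot-scale k []       []       = sym (ℤ.*-zeroʳ k)
  dot-scale k (u ∷ us) (x ∷ xs) = begin
    k * u * x + dot (Vec.map (k *_) us) xs ≡⟨ cong₂ _+_ (ℤ.*-assoc k u x) (dot-scale k us xs) ⟩
    k * (u * x) + k * dot us xs            ≡⟨ ℤ.*-distribˡ-+ k _ _ ⟨
    k * (u * x + dot us xs)                ∎
    where open ≡-Reasoning

  abs-bézout : ∀ {d} x y m n → d ℕ.+ y ℕ.* n ≡ x ℕ.* m → + x * + m + - + y * + n ≡ + d
  abs-bézout {d} x y m n eq = begin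
    + x * + m + - + y * + n       ≡⟨ cong (_+ - + y * + n) (ℤ.pos-* x m) ⟨
    + (x ℕ.* m) + - + y * + n     ≡⟨ cong (λ t → + t + - + y * + n) eq ⟨
    + d + + (y ℕ.* n) + - + y * + n ≡⟨ cong (λ t → + d + t + - + y * + n) (ℤ.pos-* y n) ⟩
    + d + + y * + n + - + y * + n ≡⟨ identity (+ d) (+ y) (+ n) ⟩
    + d                           ∎
    where
    open ≡-Reasoning
    identity : ∀ d y n → d + y * n + - y * n ≡ d
    identity = solve-∀

  bézout₂ : ∀ a b → ∃ λ g → g ∣ a × g ∣ b × ∃₂ λ u v → u * a + v * b ≡ g
  bézout₂ a b = + gcd ℤ.∣ a ∣ ℤ.∣ b ∣
    , ∣ᵤ⇒∣ (gcd[m,n]∣m ℤ.∣ a ∣ ℤ.∣ b ∣) , ∣ᵤ⇒∣ (gcd[m,n]∣n ℤ.∣ a ∣ ℤ.∣ b ∣)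
    , signed (unsigned (Bézout.identity (gcd-GCD ℤ.∣ a ∣ ℤ.∣ b ∣)))
    where
    unsigned : ∀ {d m n} → Bézout.Identity d m n → ∃₂ λ u v → u * + m + v * + n ≡ + d
    unsigned {_} {m} {n} (Bézout.+- x y eq) = + x , - + y , abs-bézout x y m n eq
    unsigned {_} {m} {n} (Bézout.-+ x y eq) =
      - + x , + y , trans (ℤ.+-comm (- + x * + m) (+ y * + n)) (abs-bézout y x n m eq)
    signed : ∀ {g} → (∃₂ λ u v → u * + ℤ.∣ a ∣ + v * + ℤ.∣ b ∣ ≡ g) → ∃₂ λ u v → u * a + v * b ≡ g
    signed (u , v , eq) with m∣∣m∣ {a} | m∣∣m∣ {b}
    ... | divides s ∣a∣≡sa | divides t ∣b∣≡tb = u * s , v * t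
      , trans (cong₂ _+_ (trans (ℤ.*-assoc u s a) (cong (u *_) (sym ∣a∣≡sa)))
                         (trans (ℤ.*-assoc v t b) (cong (v *_) (sym ∣b∣≡tb)))) eq

  bézout : ∀ {n} (xs : Vec ℤ n) → ∃ λ g → All (g ∣_) xs × ∃ λ us → dot us xs ≡ g
  bézout []       = 0ℤ , [] , [] , refl
  bézout (x ∷ xs) =
    let g  , g∣xs , us , us∙xs≡g    = bézout xs
        g′ , g′∣x , g′∣g , u , v , eq = bézout₂ x g
    in g′ , g′∣x ∷ All.map (∣-trans g′∣g) g∣xs , u ∷ Vec.map (v *_) us
     , trans (cong (λ t → u * x + t) (trans (dot-scale v us xs) (cong (v *_) us∙xs≡g))) eq

  primeDivisor : ∀ m → m ≢ 1 → ∃ λ p → Prime p × p ℕ.∣ m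
  -- The value 0 occurs as the gcd of a vector of zeros; any prime divides it, and 2 is taken.
  primeDivisor zero    _   = 2 , prime[2] , 2 ℕ.∣0
  primeDivisor (suc m) m≢1 with factorise (suc m)
  ... | record { factors = [] ; isFactorisation = eq } = contradiction eq m≢1
  ... | record { factors = p ∷ ps ; isFactorisation = eq ; factorsPrime = p-prime ∷ _ } =
    p , p-prime , subst (p ℕ.∣_) (sym eq) (ℕ.m∣m*n (product ps))

  -- Unimodularity of a vector, in the form in which it is checked: one prime at a time.
  NoCommonPrime : ∀ {n} → Vec ℤ n → Set
  NoCommonPrime xs = ∀ p → Prime p → ¬ All (+ p ∣_) xs

  noCommonPrime⇒unimodular : ∀ {n} (xs : Vec ℤ n) → NoCommonPrime xs → ∃ λ us → dot us xs ≡ 1ℤ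
  noCommonPrime⇒unimodular xs noPrime with bézout xs
  ... | g , g∣xs , us , us∙xs≡g with ℤ.∣ g ∣ ℕ.≟ 1
  ...   | no ∣g∣≢1 = let p , p-prime , p∣g = primeDivisor ℤ.∣ g ∣ ∣g∣≢1 in
    contradiction (All.map (∣-trans (∣ᵤ⇒∣ p∣g)) g∣xs) (noPrime p p-prime)
  ...   | yes ∣g∣≡1 with m∣∣m∣ {g}
  -- Here g = ±1 and s is its sign, which corrects a combination equal to g to one equal to 1.
  ...     | divides s ∣g∣≡sg = Vec.map (s *_) us
    , trans (dot-scale s us xs) (trans (cong (s *_) us∙xs≡g) (trans (sym ∣g∣≡sg) (cong +_ ∣g∣≡1)))

  inverse-mod : ∀ {p} a → Prime p → ¬ + p ∣ a → ∃₂ λ u w → u * a + w * + p ≡ 1ℤ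
  inverse-mod {p} a p-prime p∤a = unpack (noCommonPrime⇒unimodular (a ∷ + p ∷ []) coprime)
    where
    coprime : NoCommonPrime (a ∷ + p ∷ [])
    coprime q q-prime (q∣a ∷ q∣p ∷ []) =
      p∤a (subst (λ t → + t ∣ a) (prime-∣-prime q-prime p-prime q∣p) q∣a)
    unpack : (∃ λ us → dot us (a ∷ + p ∷ []) ≡ 1ℤ) → ∃₂ λ u w → u * a + w * + p ≡ 1ℤ
    unpack (u ∷ w ∷ [] , eq) = u , w , trans (cong (λ t → u * a + t) (sym (ℤ.+-identityʳ (w * + p)))) eq

  ∣-of-primes : ∀ {q} ps → q List.∈ ps → + q ∣ + product ps
  ∣-of-primes {q} ps q∈ps = ∣ᵤ⇒∣ (ℕ.∈⇒∣product q∈ps)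

  -- Chinese remainder theorem for a local condition on pairs of integers.

  module Approximation
    (Good : ℕ → ℤ → ℤ → Set)
    (Good-resp : ∀ {p a b a′ b′} → a ≡ a′ [mod p ] → b ≡ b′ [mod p ] → Good p a b → Good p a′ b′)
    (Good-local : ∀ p → Prime p → ∃₂ (Good p))
    where

    approximate-primes : ∀ ps → ListAll.All Prime ps → ∃₂ λ a b → ∀ q → q List.∈ ps → Good q a b
    approximate-primes []       []                  = 0ℤ , 0ℤ , λ _ ()
    approximate-primes (p ∷ ps) (p-prime ∷ ps-prime) with approximate-primes ps ps-prime | p ∈? ps
    -- A factorisation may repeat a prime; the repetition imposes nothing new.
    ... | a , b , good | yes p∈ps = a , b , λ where
      q (here refl)   → good q p∈ps
      q (there q∈ps) → good q q∈ps
    ... | a , b , good | no p∉ps =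
      let a′ , b′ , good′ = Good-local p p-prime
          u , w , uN+wp≡1 = inverse-mod (+ product ps) p-prime
            (p∉ps ∘ λ p∣N → factorisationHasAllPrimeFactors p-prime (∣⇒∣ᵤ p∣N) ps-prime)
          N = + product ps
          -- As u N ≡ 1 mod p, adding u (x′ - x) N moves x to x′ mod p, and it changes nothing
          -- modulo the primes of `ps`, whose product is N.
          lift : ℤ → ℤ → ℤ
          lift x x′ = x + u * (x′ - x) * N
          lift-N : ∀ {q} → q List.∈ ps → ∀ x x′ → x ≡ lift x x′ [mod q ]
          lift-N q∈ps x x′ = mod (∣-trans (∣-of-primes ps q∈ps) (divides (- (u * (x′ - x))) (identity₁ x (u * (x′ - x)) N)))
          lift-p : ∀ x x′ → x′ ≡ lift x x′ [mod p ]
          lift-p x x′ = mod (divides ((x′ - x) * w) (begin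
            x′ - lift x x′                          ≡⟨ identity₂ x x′ u N w (+ p) ⟩
            (x′ - x) * (1ℤ - (u * N + w * + p)) + (x′ - x) * w * + p ≡⟨ cong (λ t → (x′ - x) * (1ℤ - t) + (x′ - x) * w * + p) uN+wp≡1 ⟩
            (x′ - x) * (1ℤ - 1ℤ) + (x′ - x) * w * + p ≡⟨ identity₃ (x′ - x) (w) (+ p) ⟩
            (x′ - x) * w * + p                      ∎))
      in lift a a′ , lift b b′ , λ where
        q (here refl)  → Good-resp (lift-p a a′) (lift-p b b′) good′
        q (there q∈ps) → Good-resp (lift-N q∈ps a a′) (lift-N q∈ps b b′) (good q q∈ps)
      where
      open ≡-Reasoning
      identity₁ : ∀ x t N → x - (x + t * N) ≡ - t * N
      identity₁ = solve-∀
      identity₂ : ∀ x x′ u N w p → x′ - (x + u * (x′ - x) * N) ≡ (x′ - x) * (1ℤ - (u * N + w * p)) + (x′ - x) * w * p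
      identity₂ = solve-∀
      identity₃ : ∀ y w p → y * (1ℤ - 1ℤ) + y * w * p ≡ y * w * p
      identity₃ = solve-∀

    -- A nonzero N has only finitely many prime divisors. This is why each modulus used for the
    -- cyclic vector has to be shown nonzero.
    approximate : ∀ N → N ≢ 0ℤ → ∃₂ λ a b → ∀ q → Prime q → + q ∣ N → Good q a b
    approximate N N≢0 =
      let a , b , good = approximate-primes factors factorsPrime in
      a , b , λ q q-prime q∣N → good q
        (factorisationHasAllPrimeFactors q-prime (subst (q ℕ.∣_) isFactorisation (∣⇒∣ᵤ q∣N)) factorsPrime)
      where
      instance
        ∣N∣-nonZero : ℕ.NonZero ℤ.∣ N ∣
        ∣N∣-nonZero = ℕ.≢-nonZero (N≢0 ∘ ℤ.∣i∣≡0⇒i≡0)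
      open PrimeFactorisation (factorise ℤ.∣ N ∣)

  mod-refl : ∀ {p} a → a ≡ a [mod p ]
  mod-refl a = mod (divides 0ℤ (ℤ.+-inverseʳ a))

  infixl 6 _⊞_
  _⊞_ : ∀ {p a a′ b b′} → a ≡ a′ [mod p ] → b ≡ b′ [mod p ] → a + b ≡ a′ + b′ [mod p ]
  _⊞_ {p} {a} {a′} {b} {b′} (mod a≡a′) (mod b≡b′) = mod (subst (+ p ∣_) (identity a a′ b b′) (∣m∣n⇒∣m+n a≡a′ b≡b′))
    where
    identity : ∀ a a′ b b′ → (a - a′) + (b - b′) ≡ (a + b) - (a′ + b′)
    identity = solve-∀

  mod-neg : ∀ {p a a′} → a ≡ a′ [mod p ] → - a ≡ - a′ [mod p ]
  mod-neg {p} {a} {a′} (mod a≡a′) = mod (subst (+ p ∣_) (identity a a′) (∣m⇒∣-m a≡a′))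
    where
    identity : ∀ a a′ → - (a - a′) ≡ - a - - a′
    identity = solve-∀

  mod-* : ∀ {p a a′ b b′} → a ≡ a′ [mod p ] → b ≡ b′ [mod p ] → a * b ≡ a′ * b′ [mod p ]
  mod-* {p} {a} {a′} {b} {b′} (mod a≡a′) (mod b≡b′) = mod (subst (+ p ∣_) (identity a a′ b b′)
    (∣m∣n⇒∣m+n (∣m⇒∣m*n b a≡a′) (∣n⇒∣m*n a′ b≡b′)))
    where
    identity : ∀ a a′ b b′ → (a - a′) * b + a′ * (b - b′) ≡ a * b - a′ * b′
    identity = solve-∀

  mod-∣ : ∀ {p a a′} → a ≡ a′ [mod p ] → + p ∣ a′ → + p ∣ a
  mod-∣ {p} {a} {a′} (mod a≡a′) p∣a′ = subst (+ p ∣_) (identity a a′) (∣m∣n⇒∣m+n a≡a′ p∣a′)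
    where
    identity : ∀ a a′ → (a - a′) + a′ ≡ a
    identity = solve-∀

  ∣-combine₂ : ∀ {k a b} u v {x} → u * a + v * b ≡ x → k ∣ a → k ∣ b → k ∣ x
  ∣-combine₂ {k} u v eq k∣a k∣b = subst (k ∣_) eq (∣m∣n⇒∣m+n (∣n⇒∣m*n u k∣a) (∣n⇒∣m*n v k∣b))

  ∣-combine₃ : ∀ {k a b c} u v w {x} → u * a + v * b + w * c ≡ x → k ∣ a → k ∣ b → k ∣ c → k ∣ x
  ∣-combine₃ {k} u v w eq k∣a k∣b k∣c =
    subst (k ∣_) eq (∣m∣n⇒∣m+n (∣m∣n⇒∣m+n (∣n⇒∣m*n u k∣a) (∣n⇒∣m*n v k∣b)) (∣n⇒∣m*n w k∣c))

  *-≢0 : ∀ {a b} → a ≢ 0ℤ → b ≢ 0ℤ → a * b ≢ 0ℤ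
  *-≢0 {a} a≢0 b≢0 ab≡0 = [ a≢0 , b≢0 ]′ (ℤ.i*j≡0⇒i≡0∨j≡0 a ab≡0)

  mod-minor : ∀ {p a a′ b b′ c c′ d d′} → a ≡ a′ [mod p ] → b ≡ b′ [mod p ] → c ≡ c′ [mod p ] → d ≡ d′ [mod p ] →
    a * b - c * d ≡ a′ * b′ - c′ * d′ [mod p ]
  mod-minor a≡ b≡ c≡ d≡ = mod-* a≡ b≡ ⊞ mod-neg (mod-* c≡ d≡)

  ∣-dot : ∀ {n k} (us : Vec ℤ n) {xs : Vec ℤ n} → All (k ∣_) xs → k ∣ dot us xs
  ∣-dot []       []           = divides 0ℤ refl
  ∣-dot (u ∷ us) (k∣x ∷ k∣xs) = ∣m∣n⇒∣m+n (∣n⇒∣m*n u k∣x) (∣-dot us k∣xs)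

  -- Trace-zero 2×2 matrices modulo p.

  -- The matrix is that of η = hAτ + r acting on ℤτ + ℤ in the basis (τ , 1), where Aτ² + Bτ + C =
  -- 0. Its trace is -q, hence 0 mod p.
  module NilpotentModP
    {p : ℕ} (p-prime : Prime p) (h A B C r q : ℤ)
    (p∤h : ¬ + p ∣ h) (content : NoCommonPrime (A ∷ B ∷ C ∷ []))
    (trace≡0 : r + r - h * B + q ≡ 0ℤ) (p∣q : + p ∣ q)
    where

    -- An identity proved by a ring solver is written once, as the argument of the solver.
    private
      p∣trace : + p ∣ r + r - h * B + q
      p∣trace = divides 0ℤ trace≡0

      p∣defect : ∀ u w x → u * x + w * + p ≡ 1ℤ → + p ∣ 1ℤ - (u * x + w * + p)
      p∣defect u w x eq = divides 0ℤ (trans (cong (λ t → 1ℤ - t) eq) refl)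

      by : ∀ {n} (us : Vec ℤ n) {xs : Vec ℤ n} {x} → All (+ p ∣_) xs → dot us xs ≡ x → + p ∣ x
      by us p∣xs eq = subst (+ p ∣_) eq (∣-dot us p∣xs)

      A₀ = solve 8 (λ p h A B r u w a →
        a :* (con 1ℤ :- (u :* (h :* A) :+ w :* p)) :+ (a :* w :* p :+ con 0ℤ)
        := a :- ((r :- h :* B) :* con 0ℤ :+ h :* A :* (u :* a))) refl

      A₁ = solve 11 (λ p h A B C r q u w a b →
        b :* (con 1ℤ :- (u :* (h :* A) :+ w :* p)) :+ (b :* w :* p :+ (u :* ((r :- h :* B) :* a :+ h :* A :* b)
          :+ (:- (u :* a) :* (r :+ r :- h :* B :+ q) :+ (u :* a :* q :+ con 0ℤ))))
        := b :- (r :* (u :* a) :- h :* C :* con 0ℤ)) refl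

      C₀ = solve 11 (λ p h A B C r q u w a b →
        a :* (con 1ℤ :- (u :* (h :* C) :+ w :* p)) :+ (a :* w :* p :+ (:- u :* (r :* b :- h :* C :* a)
          :+ (u :* b :* (r :+ r :- h :* B :+ q) :+ (:- (u :* b) :* q :+ con 0ℤ))))
        := a :- ((r :- h :* B) :* (:- (u :* b)) :+ h :* A :* con 0ℤ)) refl

      C₁ = solve 7 (λ p h C r u w b →
        b :* (con 1ℤ :- (u :* (h :* C) :+ w :* p)) :+ (b :* w :* p :+ con 0ℤ)
        := b :- (r :* con 0ℤ :- h :* C :* (:- (u :* b)))) refl

      rb-identity : ∀ h C r a b → 1ℤ * (r * b - h * C * a) + (h * a * C + 0ℤ) ≡ r * b
      rb-identity = solve 5 (λ h C r a b → con 1ℤ :* (r :* b :- h :* C :* a) :+ (h :* a :* C :+ con 0ℤ) := r :* b) refl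

      ra-identity = solve 7 (λ h A B r q a b →
        :- con 1ℤ :* ((r :- h :* B) :* a :+ h :* A :* b) :+ (h :* b :* A :+ (a :* (r :+ r :- h :* B :+ q) :+ (:- a :* q :+ con 0ℤ)))
        := r :* a) refl

      hB-identity : ∀ h B r q → (1ℤ + 1ℤ) * r + (1ℤ * q + (- 1ℤ * (r + r - h * B + q) + 0ℤ)) ≡ h * B
      hB-identity = solve 4 (λ h B r q →
        (con 1ℤ :+ con 1ℤ) :* r :+ (con 1ℤ :* q :+ (:- con 1ℤ :* (r :+ r :- h :* B :+ q) :+ con 0ℤ))
        := h :* B) refl

      -- When p divides A and C, the matrix is diag(-r , r) mod p; if r vanished as well, so would
      -- hB, and p would divide A, B and C.
      p∤r : + p ∣ A → + p ∣ C → ¬ + p ∣ r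
      p∤r p∣A p∣C p∣r = [ p∤h , (λ p∣B → content p p-prime (p∣A ∷ p∣B ∷ p∣C ∷ [])) ]′
        (prime-∣-* h B p-prime (by (1ℤ + 1ℤ ∷ 1ℤ ∷ - 1ℤ ∷ []) (p∣r ∷ p∣q ∷ p∣trace ∷ []) (hB-identity h B r q)))

      cancel-r : ∀ {x} → ¬ + p ∣ r → + p ∣ r * x → + p ∣ x
      cancel-r {x} p∤r p∣rx with prime-∣-* r x p-prime p∣rx
      ... | inj₁ p∣r = contradiction p∣r p∤r
      ... | inj₂ p∣x = p∣x

    -- A nonzero nilpotent 2×2 matrix over a field has its kernel equal to its image.
    kernel⊆image : ∀ a b → + p ∣ (r - h * B) * a + h * A * b → + p ∣ r * b - h * C * a →
      ∃₂ λ m₀ m₁ → + p ∣ a - ((r - h * B) * m₀ + h * A * m₁) × + p ∣ b - (r * m₁ - h * C * m₀)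
    kernel⊆image a b p∣k₀ p∣k₁ with + p ∣? A | + p ∣? C
    ... | no p∤A | _ =
      let u , w , eq = inverse-mod (h * A) p-prime (prime-∤-* h A p-prime p∤h p∤A)
          p∣E = p∣defect u w (h * A) eq
      -- The image of (0 , m₁) is (hA m₁ , r m₁). The first coordinate dictates m₁ = a / (hA); the
      -- kernel equation and the vanishing trace then give the second.
      in 0ℤ , u * a
       , by (a ∷ a * w ∷ []) (p∣E ∷ ∣-refl ∷ []) (A₀ (+ p) h A B r u w a)
       , by (b ∷ b * w ∷ u ∷ - (u * a) ∷ u * a ∷ []) (p∣E ∷ ∣-refl ∷ p∣k₀ ∷ p∣trace ∷ p∣q ∷ []) (A₁ (+ p) h A B C r q u w a b)
    ... | yes _ | no p∤C =
      let u , w , eq = inverse-mod (h * C) p-prime (prime-∤-* h C p-prime p∤h p∤C)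
          p∣E = p∣defect u w (h * C) eq
      in - (u * b) , 0ℤ
       , by (a ∷ a * w ∷ - u ∷ u * b ∷ - (u * b) ∷ []) (p∣E ∷ ∣-refl ∷ p∣k₁ ∷ p∣trace ∷ p∣q ∷ []) (C₀ (+ p) h A B C r q u w a b)
       , by (b ∷ b * w ∷ []) (p∣E ∷ ∣-refl ∷ []) (C₁ (+ p) h C r u w b)
    ... | yes p∣A | yes p∣C =
      let p∣b = cancel-r (p∤r p∣A p∣C) (by (1ℤ ∷ h * a ∷ []) (p∣k₁ ∷ p∣C ∷ []) (rb-identity h C r a b))
          p∣a = cancel-r (p∤r p∣A p∣C)
            (by (- 1ℤ ∷ h * b ∷ a ∷ - a ∷ []) (p∣k₀ ∷ p∣A ∷ p∣trace ∷ p∣q ∷ []) (ra-identity h A B r q a b))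
      -- The matrix is invertible mod p in this case, so (a , b) is itself 0 mod p.
      in 0ℤ , 0ℤ , subst (+ p ∣_) (a-identity a (r - h * B) (h * A)) p∣a , subst (+ p ∣_) (b-identity b r (h * C)) p∣b
      where
      a-identity : ∀ a x y → a ≡ a - (x * 0ℤ + y * 0ℤ)
      a-identity = solve-∀
      b-identity : ∀ b x y → b ≡ b - (x * 0ℤ - y * 0ℤ)
      b-identity = solve-∀

  minor-swap : ∀ a b c d → d * c - b * a ≡ - (a * b - c * d)
  minor-swap = solve-∀

  unit-content : ∀ g A B C us → g ≢ 0ℤ → dot us (A * g ∷ B * g ∷ C * g ∷ []) ≡ g → NoCommonPrime (A ∷ B ∷ C ∷ [])
  unit-content g A B C us@(u ∷ v ∷ w ∷ []) g≢0 eq p p-prime p∣ABC = prime-∤-1 p-prime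
    (subst (+ p ∣_) (ℤ.*-cancelʳ-≡ (dot us (A ∷ B ∷ C ∷ [])) 1ℤ g {{ℤ.≢-nonZero g≢0}}
      (trans (identity u A v B w C g) (trans eq (sym (ℤ.*-identityˡ g))))) (∣-dot us p∣ABC))
    where
    identity = solve 7 (λ u A v B w C g →
      (u :* A :+ (v :* B :+ (w :* C :+ con 0ℤ))) :* g
      := u :* (A :* g) :+ (v :* (B :* g) :+ (w :* (C :* g) :+ con 0ℤ))) refl

  -- The last two hypotheses make aB and aC multiples of A, and therefore also a = a (uA + vB + wC).
  multiplier-identity : ∀ a A B C b c d u v w → u * A + (v * B + (w * C + 0ℤ)) ≡ 1ℤ →
    A * (b - c) - a * B ≡ 0ℤ → - (A * d) - a * C ≡ 0ℤ → a ≡ (a * u + v * (b - c) - w * d) * A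
  multiplier-identity a A B C b c d u v w eq₁ eq₂ eq₃ = begin
    a                                            ≡⟨ ℤ.*-identityʳ a ⟨
    a * 1ℤ                                       ≡⟨ cong (a *_) eq₁ ⟨
    a * (u * A + (v * B + (w * C + 0ℤ)))         ≡⟨ identity a A B C b c d u v w ⟩
    (a * u + v * (b - c) - w * d) * A - (v * (A * (b - c) - a * B) + w * (- (A * d) - a * C))
      ≡⟨ cong₂ (λ x y → (a * u + v * (b - c) - w * d) * A - (v * x + w * y)) eq₂ eq₃ ⟩
    (a * u + v * (b - c) - w * d) * A - (v * 0ℤ + w * 0ℤ) ≡⟨ drop-zeros ((a * u + v * (b - c) - w * d) * A) v w ⟩
    (a * u + v * (b - c) - w * d) * A            ∎
    where
    open ≡-Reasoning
    identity = solve 10 (λ a A B C b c d u v w →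
      a :* (u :* A :+ (v :* B :+ (w :* C :+ con 0ℤ)))
      := (a :* u :+ v :* (b :- c) :- w :* d) :* A :- (v :* (A :* (b :- c) :- a :* B) :+ w :* (:- (A :* d) :- a :* C))) refl
    drop-zeros : ∀ x v w → x - (v * 0ℤ + w * 0ℤ) ≡ x
    drop-zeros = solve-∀

  prime-not-dividing : ∀ n → n ≢ 0ℤ → ∃ λ ℓ → Prime ℓ × ¬ + ℓ ∣ n
  prime-not-dividing n n≢0 =
    let ℓ , ℓ-prime , ℓ∣1+∣n∣ = primeDivisor (suc ℤ.∣ n ∣) (n≢0 ∘ ℤ.∣i∣≡0⇒i≡0 ∘ ℕ.suc-injective)
    in ℓ , ℓ-prime , λ ℓ∣n → prime-∤-1 ℓ-prime (∣m+n∣n⇒∣m {+ ℓ} {1ℤ} {+ ℤ.∣ n ∣} (∣ᵤ⇒∣ ℓ∣1+∣n∣) (∣-trans ℓ∣n m∣∣m∣))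

  dot-vanishes : ∀ {n} (us : Vec ℤ n) {xs : Vec ℤ n} → All (_≡ 0ℤ) xs → dot us xs ≡ 0ℤ
  dot-vanishes []       []           = refl
  dot-vanishes (u ∷ us) (refl ∷ xs≡0) = cong₂ _+_ (ℤ.*-zeroʳ u) (dot-vanishes us xs≡0)

  -- Cramer's rule. By the first three equations the product of (a b ; c d) and (α β ; γ δ) is
  -- unitriangular, so (ad - bc)(αδ - βγ) = 1; the last two say that the row (t , s) is killed by
  -- the second matrix.
  invertible-kernel : ∀ a b c d α β γ δ s t →
    a * α + b * γ - 1ℤ ≡ 0ℤ → a * β + b * δ ≡ 0ℤ → c * β + d * δ - 1ℤ ≡ 0ℤ →
    s * γ + t * α ≡ 0ℤ → s * δ + t * β ≡ 0ℤ → s ≡ 0ℤ × t ≡ 0ℤ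
  invertible-kernel a b c d α β γ δ s t e₁ e₂ e₄ e₅ e₆ =
      trans (s-identity a b c d α β γ δ s t) (dot-vanishes
        (- (s * (c * β + d * δ)) ∷ s * (c * α + d * γ) ∷ - s ∷ - (a * d - b * c) * β ∷ (a * d - b * c) * α ∷ [])
        (e₁ ∷ e₂ ∷ e₄ ∷ e₅ ∷ e₆ ∷ []))
    , trans (t-identity a b c d α β γ δ s t) (dot-vanishes
        (- (t * (c * β + d * δ)) ∷ t * (c * α + d * γ) ∷ - t ∷ (a * d - b * c) * δ ∷ - (a * d - b * c) * γ ∷ [])
        (e₁ ∷ e₂ ∷ e₄ ∷ e₅ ∷ e₆ ∷ []))
    where
    s-identity = solve 10 (λ a b c d α β γ δ s t →
      s
      := :- (s :* (c :* β :+ d :* δ)) :* (a :* α :+ b :* γ :- con 1ℤ) :+ (s :* (c :* α :+ d :* γ) :* (a :* β :+ b :* δ)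
      :+ (:- s :* (c :* β :+ d :* δ :- con 1ℤ) :+ (:- (a :* d :- b :* c) :* β :* (s :* γ :+ t :* α) :+ ((a :* d :- b :* c) :* α :* (s :* δ :+ t :* β) :+ con 0ℤ))))) refl
    t-identity = solve 10 (λ a b c d α β γ δ s t →
      t
      := :- (t :* (c :* β :+ d :* δ)) :* (a :* α :+ b :* γ :- con 1ℤ) :+ (t :* (c :* α :+ d :* γ) :* (a :* β :+ b :* δ)
      :+ (:- t :* (c :* β :+ d :* δ :- con 1ℤ) :+ ((a :* d :- b :* c) :* δ :* (s :* γ :+ t :* α) :+ (:- (a :* d :- b :* c) :* γ :* (s :* δ :+ t :* β) :+ con 0ℤ))))) refl

  -- Plücker coordinates and dual functionals in ℤ⁴.

  record ℤ⁴ : Set where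
    constructor ⟨_,_,_,_⟩
    field x₀ x₁ x₂ x₃ : ℤ

  infix 7 _∙_
  _∙_ : ℤ⁴ → ℤ⁴ → ℤ
  ⟨ a , b , c , d ⟩ ∙ ⟨ a′ , b′ , c′ , d′ ⟩ = a * a′ + b * b′ + c * c′ + d * d′

  minors : ℤ⁴ → ℤ⁴ → Vec ℤ 6
  minors ⟨ a , b , c , d ⟩ ⟨ a′ , b′ , c′ , d′ ⟩ =
    (a * b′ - b * a′) ∷ (a * c′ - c * a′) ∷ (a * d′ - d * a′) ∷
    (b * c′ - c * b′) ∷ (b * d′ - d * b′) ∷ (c * d′ - d * c′) ∷ []

  dual-annihilates = solve 10 (λ u₀ u₁ u₂ u₃ u₄ u₅ a b c d →
    :- (u₀ :* b :+ u₁ :* c :+ u₂ :* d) :* a :+ (u₀ :* a :- u₃ :* c :- u₄ :* d) :* b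
      :+ (u₁ :* a :+ u₃ :* b :- u₅ :* d) :* c :+ (u₂ :* a :+ u₄ :* b :+ u₅ :* c) :* d
    := con 0ℤ) refl

  dual-expands = solve 14 (λ u₀ u₁ u₂ u₃ u₄ u₅ a b c d a′ b′ c′ d′ →
    :- (u₀ :* b :+ u₁ :* c :+ u₂ :* d) :* a′ :+ (u₀ :* a :- u₃ :* c :- u₄ :* d) :* b′
      :+ (u₁ :* a :+ u₃ :* b :- u₅ :* d) :* c′ :+ (u₂ :* a :+ u₄ :* b :+ u₅ :* c) :* d′
    := u₀ :* (a :* b′ :- b :* a′) :+ (u₁ :* (a :* c′ :- c :* a′) :+ (u₂ :* (a :* d′ :- d :* a′)
      :+ (u₃ :* (b :* c′ :- c :* b′) :+ (u₄ :* (b :* d′ :- d :* b′) :+ (u₅ :* (c :* d′ :- d :* c′) :+ con 0ℤ)))))) refl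

  -- Bézout coefficients of the minors are the coefficients of an alternating bilinear form taking
  -- the value 1 at (v , w). Its contraction with v is g, which kills v because the form is
  -- alternating.
  unimodular⇒dual : ∀ v w → NoCommonPrime (minors v w) → ∃ λ g → g ∙ v ≡ 0ℤ × g ∙ w ≡ 1ℤ
  unimodular⇒dual v@(⟨ a , b , c , d ⟩) w@(⟨ a′ , b′ , c′ , d′ ⟩) noPrime =
    dual (noCommonPrime⇒unimodular (minors v w) noPrime)
    where
    dual : (∃ λ us → dot us (minors v w) ≡ 1ℤ) → ∃ λ g → g ∙ v ≡ 0ℤ × g ∙ w ≡ 1ℤ
    dual (u₀ ∷ u₁ ∷ u₂ ∷ u₃ ∷ u₄ ∷ u₅ ∷ [] , eq) =
        ⟨ - (u₀ * b + u₁ * c + u₂ * d) , u₀ * a - u₃ * c - u₄ * d , u₁ * a + u₃ * b - u₅ * d , u₂ * a + u₄ * b + u₅ * c ⟩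
      , dual-annihilates u₀ u₁ u₂ u₃ u₄ u₅ a b c d
      , trans (dual-expands u₀ u₁ u₂ u₃ u₄ u₅ a b c d a′ b′ c′ d′) eq

  -- Polynomial identities for the minors of (v , Wv) and for the action of W.

  A-coefficient = solve 8 (λ n h A B r y w σ →
    con 1ℤ :* (con 0ℤ :* w :- y :* (n :* ((r :- h :* B) :* con 0ℤ :+ h :* A :* con 0ℤ) :+ σ)) :+ :- con 1ℤ :* (con 0ℤ :* w :- y :* (n :* ((r :- h :* B) :* con 0ℤ :+ h :* A :* con 1ℤ) :+ σ))
    := y :* (n :* h) :* A) refl

  B-coefficient = solve 10 (λ n h A B C r y w σ₀ σ₁ →
    ((con 1ℤ :* w :- y :* (n :* ((r :- h :* B) :* con 1ℤ :+ h :* A :* con 0ℤ) :+ σ₀)) :- (con 0ℤ :* w :- y :* (n :* ((r :- h :* B) :* con 0ℤ :+ h :* A :* con 0ℤ) :+ σ₀)))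
    :- ((con 1ℤ :* w :- y :* (n :* (r :* con 1ℤ :- h :* C :* con 0ℤ) :+ σ₁)) :- (con 0ℤ :* w :- y :* (n :* (r :* con 0ℤ :- h :* C :* con 0ℤ) :+ σ₁)))
    := y :* (n :* h) :* B) refl

  C-coefficient = solve 7 (λ n h C r y w σ →
    con 1ℤ :* (con 0ℤ :* w :- y :* (n :* (r :* con 0ℤ :- h :* C :* con 1ℤ) :+ σ)) :+ :- con 1ℤ :* (con 0ℤ :* w :- y :* (n :* (r :* con 0ℤ :- h :* C :* con 0ℤ) :+ σ))
    := y :* (n :* h) :* C) refl

  A-coefficient′ = solve 8 (λ n h A B C r σ₀ σ₁ →
    :- con 1ℤ :* (con 0ℤ :* (n :* (r :* con 1ℤ :- h :* C :* con 0ℤ) :+ σ₁) :- con 1ℤ :* (n :* ((r :- h :* B) :* con 0ℤ :+ h :* A :* con 1ℤ) :+ σ₀)) :+ :- con 1ℤ :* σ₀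
    := con 1ℤ :* (n :* h) :* A) refl

  B-coefficient′ = solve 8 (λ n h A B C r σ₀ σ₁ →
    con 1ℤ :* (con 1ℤ :* (n :* (r :* con 1ℤ :- h :* C :* con 1ℤ) :+ σ₁) :- con 1ℤ :* (n :* ((r :- h :* B) :* con 1ℤ :+ h :* A :* con 1ℤ) :+ σ₀))
    :+ :- con 1ℤ :* (con 0ℤ :* (n :* (r :* con 1ℤ :- h :* C :* con 0ℤ) :+ σ₁) :- con 1ℤ :* (n :* ((r :- h :* B) :* con 0ℤ :+ h :* A :* con 1ℤ) :+ σ₀))
    :+ :- con 1ℤ :* (con 1ℤ :* (n :* (r :* con 0ℤ :- h :* C :* con 1ℤ) :+ σ₁) :- con 0ℤ :* (n :* ((r :- h :* B) :* con 1ℤ :+ h :* A :* con 0ℤ) :+ σ₀))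
    := con 1ℤ :* (n :* h) :* B) refl

  C-coefficient′ = solve 8 (λ n h A B C r σ₀ σ₁ →
    :- con 1ℤ :* (con 1ℤ :* (n :* (r :* con 0ℤ :- h :* C :* con 1ℤ) :+ σ₁) :- con 0ℤ :* (n :* ((r :- h :* B) :* con 1ℤ :+ h :* A :* con 0ℤ) :+ σ₀)) :+ con 1ℤ :* σ₁
    := con 1ℤ :* (n :* h) :* C) refl

  σ-identity : ∀ n y e σ → - 1ℤ * (0ℤ - y * (n * e + σ)) + - (y * e) * n ≡ y * σ
  σ-identity = solve 4 (λ n y e σ → :- con 1ℤ :* (con 0ℤ :- y :* (n :* e :+ σ)) :+ :- (y :* e) :* n := y :* σ) refl

  tail-identity = solve 7 (λ n h A B C c d →
    :- (c :* (:- (n :* h :* C :* c)) :- d :* (n :* h :* (A :* d :- B :* c)))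
    := n :* h :* (C :* (c :* c) :- B :* (c :* d) :+ A :* (d :* d))) refl

  transposed-identity = solve 23 (λ n h₁ h₂ A₁ B₁ C₁ A₂ B₂ C₂ r s₀ s₁ t₀ t₁ T g₀ g₁ g₂ g₃ a b c d →
    (g₀ :* (n :* (r :- h₁ :* B₂)) :- g₁ :* (n :* (h₁ :* C₂)) :+ T :* g₀) :* a
    :+ (g₀ :* (n :* (h₁ :* A₂)) :+ g₁ :* (n :* r) :+ T :* g₁) :* b
    :+ (g₀ :* s₀ :+ g₁ :* s₁ :- g₂ :* (n :* h₂ :* B₁) :- g₃ :* (n :* h₂ :* C₁) :+ T :* g₂) :* c
    :+ (g₀ :* t₀ :+ g₁ :* t₁ :+ g₂ :* (n :* h₂ :* A₁) :+ T :* g₃) :* d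
    := g₀ :* (n :* ((r :- h₁ :* B₂) :* a :+ h₁ :* A₂ :* b) :+ (c :* s₀ :+ d :* t₀))
      :+ g₁ :* (n :* (r :* b :- h₁ :* C₂ :* a) :+ (c :* s₁ :+ d :* t₁))
      :+ g₂ :* (n :* h₂ :* (A₁ :* d :- B₁ :* c)) :+ g₃ :* (:- (n :* h₂ :* C₁ :* c))
      :+ T :* (g₀ :* a :+ g₁ :* b :+ g₂ :* c :+ g₃ :* d)) refl

  combine : ℤ → ℤ → ℤ⁴ → ℤ⁴ → ℤ⁴ → ℤ⁴
  combine T N ⟨ x₀ , x₁ , x₂ , x₃ ⟩ ⟨ y₀ , y₁ , y₂ , y₃ ⟩ ⟨ z₀ , z₁ , z₂ , z₃ ⟩ =
    ⟨ x₀ + T * y₀ + N * z₀ , x₁ + T * y₁ + N * z₁ , x₂ + T * y₂ + N * z₂ , x₃ + T * y₃ + N * z₃ ⟩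

  ∙-combine-identity = solve 18 (λ T N g₀ g₁ g₂ g₃ x₀ x₁ x₂ x₃ y₀ y₁ y₂ y₃ z₀ z₁ z₂ z₃ →
    g₀ :* (x₀ :+ T :* y₀ :+ N :* z₀) :+ g₁ :* (x₁ :+ T :* y₁ :+ N :* z₁) :+ g₂ :* (x₂ :+ T :* y₂ :+ N :* z₂) :+ g₃ :* (x₃ :+ T :* y₃ :+ N :* z₃)
    := (g₀ :* x₀ :+ g₁ :* x₁ :+ g₂ :* x₂ :+ g₃ :* x₃) :+ T :* (g₀ :* y₀ :+ g₁ :* y₁ :+ g₂ :* y₂ :+ g₃ :* y₃)
      :+ N :* (g₀ :* z₀ :+ g₁ :* z₁ :+ g₂ :* z₂ :+ g₃ :* z₃)) refl

  ∙-combine : ∀ T N g x y z → g ∙ combine T N x y z ≡ g ∙ x + T * (g ∙ y) + N * (g ∙ z)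
  ∙-combine T N ⟨ g₀ , g₁ , g₂ , g₃ ⟩ ⟨ x₀ , x₁ , x₂ , x₃ ⟩ ⟨ y₀ , y₁ , y₂ , y₃ ⟩ ⟨ z₀ , z₁ , z₂ , z₃ ⟩ =
    ∙-combine-identity T N g₀ g₁ g₂ g₃ x₀ x₁ x₂ x₃ y₀ y₁ y₂ y₃ z₀ z₁ z₂ z₃

  ∙-zeroʳ : ∀ g → g ∙ ⟨ 0ℤ , 0ℤ , 0ℤ , 0ℤ ⟩ ≡ 0ℤ
  ∙-zeroʳ ⟨ g₀ , g₁ , g₂ , g₃ ⟩ = identity g₀ g₁ g₂ g₃
    where
    identity : ∀ g₀ g₁ g₂ g₃ → g₀ * 0ℤ + g₁ * 0ℤ + g₂ * 0ℤ + g₃ * 0ℤ ≡ 0ℤ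
    identity = solve-∀

  -- Modulo h₂ the coordinates of s and -t become those of ηl and ηl′, where nz = l + τ₁l′ and l, l′
  -- in L₂ have coordinates (k₀ , k₁) and (k₂ , k₃).
  s₀-mod-h₂ = solve 10 (λ r h₁ B₂ k₀ A₂ k₁ h₂ B₁ C₁ k₂ →
    con 1ℤ :* ((r :- h₁ :* B₂) :* k₀ :+ h₁ :* A₂ :* k₁ :+ h₂ :* B₁ :* k₀ :- h₂ :* C₁ :* k₂) :+ (C₁ :* k₂ :- B₁ :* k₀) :* h₂
    := (r :- h₁ :* B₂) :* k₀ :+ h₁ :* A₂ :* k₁) refl

  s₁-mod-h₂ = solve 9 (λ r k₁ h₁ C₂ k₀ h₂ B₁ C₁ k₃ →
    con 1ℤ :* (r :* k₁ :- h₁ :* C₂ :* k₀ :+ h₂ :* B₁ :* k₁ :- h₂ :* C₁ :* k₃) :+ (C₁ :* k₃ :- B₁ :* k₁) :* h₂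
    := r :* k₁ :- h₁ :* C₂ :* k₀) refl

  t-mod-h₂ : ∀ h₂ A₁ k x → - 1ℤ * (- (h₂ * A₁ * k + x)) + - (A₁ * k) * h₂ ≡ x
  t-mod-h₂ = solve 4 (λ h₂ A₁ k x → :- con 1ℤ :* (:- (h₂ :* A₁ :* k :+ x)) :+ :- (A₁ :* k) :* h₂ := x) refl

  module Action (n h₁ h₂ A₁ B₁ C₁ A₂ B₂ C₂ r s₀ s₁ t₀ t₁ : ℤ) where

    -- Multiplication by ω on Λ_z in the basis of columns of the period matrix;
    -- s = (η + h₂B₁)nz and t = - h₂A₁nz as elements of ℤτ₂ + ℤ.
    W : ℤ⁴ → ℤ⁴
    W ⟨ a , b , c , d ⟩ = ⟨ n * ((r - h₁ * B₂) * a + h₁ * A₂ * b) + (c * s₀ + d * t₀)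
                          , n * (r * b - h₁ * C₂ * a) + (c * s₁ + d * t₁)
                          , n * h₂ * (A₁ * d - B₁ * c)
                          , - (n * h₂ * C₁ * c) ⟩

    -- The row vector g (W + T).
    transposed : ℤ → ℤ⁴ → ℤ⁴
    transposed T ⟨ g₀ , g₁ , g₂ , g₃ ⟩ =
      ⟨ g₀ * (n * (r - h₁ * B₂)) - g₁ * (n * (h₁ * C₂)) + T * g₀
      , g₀ * (n * (h₁ * A₂)) + g₁ * (n * r) + T * g₁
      , g₀ * s₀ + g₁ * s₁ - g₂ * (n * h₂ * B₁) - g₃ * (n * h₂ * C₁) + T * g₂
      , g₀ * t₀ + g₁ * t₁ + g₂ * (n * h₂ * A₁) + T * g₃ ⟩

    transposed-∙ : ∀ T g u → transposed T g ∙ u ≡ g ∙ W u + T * (g ∙ u)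
    transposed-∙ T ⟨ g₀ , g₁ , g₂ , g₃ ⟩ ⟨ a , b , c , d ⟩ =
      transposed-identity n h₁ h₂ A₁ B₁ C₁ A₂ B₂ C₂ r s₀ s₁ t₀ t₁ T g₀ g₁ g₂ g₃ a b c d

  -- The cyclic vector: local choices at each prime and their assembly.

  module CyclicVector
    (n h₁ h₂ A₁ B₁ C₁ A₂ B₂ C₂ r s₀ s₁ t₀ t₁ : ℤ)
    (n≢0 : n ≢ 0ℤ) (h₁≢0 : h₁ ≢ 0ℤ) (h₂≢0 : h₂ ≢ 0ℤ)
    (coprime    : NoCommonPrime (h₁ ∷ h₂ ∷ []))
    (primitive₁ : NoCommonPrime (A₁ ∷ B₁ ∷ C₁ ∷ []))
    (primitive₂ : NoCommonPrime (A₂ ∷ B₂ ∷ C₂ ∷ []))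
    (nonsplit   : NoCommonPrime (n ∷ s₀ ∷ s₁ ∷ t₀ ∷ t₁ ∷ []))
    (ℓ : ℕ) (ℓ-prime : Prime ℓ) (ℓ∤n : ¬ + ℓ ∣ n)
    where

    open Action n h₁ h₂ A₁ B₁ C₁ A₂ B₂ C₂ r s₀ s₁ t₀ t₁

    -- A₁ times the norm of cτ₁ + d.
    q₁ : ℤ → ℤ → ℤ
    q₁ c d = C₁ * (c * c) - B₁ * (c * d) + A₁ * (d * d)

    -- The coordinates of cs + dt in L₂. Modulo a prime p ∣ n, `W` sends (a , b , c , d) to (σ₀ , σ₁
    -- , 0 , 0).
    σ₀ σ₁ : ℤ → ℤ → ℤ
    σ₀ c d = c * s₀ + d * t₀
    σ₁ c d = c * s₁ + d * t₁

    -- For p ∣ n all minors of (v , Wv) are built from σ mod p, so σ must survive. For p ∤ n a unit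
    -- value of q₁ makes the last minor -n h₂ q₁ a unit as soon as p ∤ h₂.
    record GoodTail (p : ℕ) (c d : ℤ) : Set where
      field
        σ≢0  : + p ∣ n → ¬ (+ p ∣ σ₀ c d × + p ∣ σ₁ c d)
        q₁≢0 : ¬ + p ∣ n → ¬ + p ∣ q₁ c d
    open GoodTail

    goodTail-resp : ∀ {p c d c′ d′} → c ≡ c′ [mod p ] → d ≡ d′ [mod p ] → GoodTail p c d → GoodTail p c′ d′
    goodTail-resp {p} c≡ d≡ good = record
      { σ≢0  = λ p∣n (p∣σ₀ , p∣σ₁) → σ≢0 good p∣n
          ( mod-∣ (mod-* c≡ (mod-refl s₀) ⊞ mod-* d≡ (mod-refl t₀)) p∣σ₀
          , mod-∣ (mod-* c≡ (mod-refl s₁) ⊞ mod-* d≡ (mod-refl t₁)) p∣σ₁)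
      ; q₁≢0 = λ p∤n → q₁≢0 good p∤n ∘ mod-∣
          (mod-* (mod-refl C₁) (mod-* c≡ c≡) ⊞ mod-neg (mod-* (mod-refl B₁) (mod-* c≡ d≡)) ⊞ mod-* (mod-refl A₁) (mod-* d≡ d≡))
      }

    -- For p ∣ n the tails (1 , 0) and (0 , 1) give σ = s and σ = t, which do not both vanish mod p.
    -- For p ∤ n a primitive binary quadratic form takes a unit value at one of (0 , 1), (1 , 0), (1
    -- , 1).
    goodTail-local : ∀ p → Prime p → ∃₂ (GoodTail p)
    goodTail-local p p-prime with + p ∣? n
    goodTail-local p p-prime | yes p∣n with + p ∣? s₀ | + p ∣? s₁
    ... | no p∤s₀ | _ = 1ℤ , 0ℤ , record { σ≢0 = λ _ → p∤s₀ ∘ subst (+ p ∣_) (identity s₀ t₀) ∘ proj₁ ; q₁≢0 = contradiction p∣n }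
      where
      identity : ∀ s t → 1ℤ * s + 0ℤ * t ≡ s
      identity = solve-∀
    ... | yes _ | no p∤s₁ = 1ℤ , 0ℤ , record { σ≢0 = λ _ → p∤s₁ ∘ subst (+ p ∣_) (identity s₁ t₁) ∘ proj₂ ; q₁≢0 = contradiction p∣n }
      where
      identity : ∀ s t → 1ℤ * s + 0ℤ * t ≡ s
      identity = solve-∀
    ... | yes p∣s₀ | yes p∣s₁ = 0ℤ , 1ℤ , record
      { σ≢0 = λ _ (p∣t₀ , p∣t₁) → nonsplit p p-prime
          (p∣n ∷ p∣s₀ ∷ p∣s₁ ∷ subst (+ p ∣_) (identity s₀ t₀) p∣t₀ ∷ subst (+ p ∣_) (identity s₁ t₁) p∣t₁ ∷ [])
      ; q₁≢0 = contradiction p∣n }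
      where
      identity : ∀ s t → 0ℤ * s + 1ℤ * t ≡ t
      identity = solve-∀
    goodTail-local p p-prime | no p∤n with + p ∣? A₁ | + p ∣? C₁
    ... | no p∤A₁ | _ = 0ℤ , 1ℤ , record { σ≢0 = λ p∣n → contradiction p∣n p∤n ; q₁≢0 = λ _ → p∤A₁ ∘ subst (+ p ∣_) (identity A₁ B₁ C₁) }
      where
      identity : ∀ A B C → C * (0ℤ * 0ℤ) - B * (0ℤ * 1ℤ) + A * (1ℤ * 1ℤ) ≡ A
      identity = solve-∀
    ... | yes _ | no p∤C₁ = 1ℤ , 0ℤ , record { σ≢0 = λ p∣n → contradiction p∣n p∤n ; q₁≢0 = λ _ → p∤C₁ ∘ subst (+ p ∣_) (identity A₁ B₁ C₁) }
      where
      identity : ∀ A B C → C * (1ℤ * 1ℤ) - B * (1ℤ * 0ℤ) + A * (0ℤ * 0ℤ) ≡ C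
      identity = solve-∀
    ... | yes p∣A₁ | yes p∣C₁ = 1ℤ , 1ℤ , record { σ≢0 = λ p∣n → contradiction p∣n p∤n ; q₁≢0 = λ _ p∣q →
        primitive₁ p p-prime (p∣A₁ ∷ ∣-combine₃ 1ℤ 1ℤ (- 1ℤ) (identity A₁ B₁ C₁) p∣A₁ p∣C₁ p∣q ∷ p∣C₁ ∷ []) }
      where
      identity : ∀ A B C → 1ℤ * A + 1ℤ * C + - 1ℤ * (C * (1ℤ * 1ℤ) - B * (1ℤ * 1ℤ) + A * (1ℤ * 1ℤ)) ≡ B
      identity = solve-∀

    -- At the auxiliary prime ℓ ∤ n the tail satisfies q₁ ≢ 0 mod ℓ, hence q₁ ≢ 0.
    tail : ∃₂ λ c d → ∀ p → Prime p → + p ∣ n * h₁ * + ℓ → GoodTail p c d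
    tail = Approximation.approximate GoodTail goodTail-resp goodTail-local (n * h₁ * + ℓ)
      (*-≢0 (*-≢0 n≢0 h₁≢0) ℓ≢0)
      where
      ℓ≢0 : + ℓ ≢ 0ℤ
      ℓ≢0 refl = ¬prime[0] ℓ-prime

    HeadMinorsDivisible : ℕ → (y w σ₀ σ₁ a b : ℤ) → Set
    HeadMinorsDivisible p y w σ₀ σ₁ a b =
        + p ∣ a * w - y * (n * ((r - h₁ * B₂) * a + h₁ * A₂ * b) + σ₀)
      × + p ∣ b * w - y * (n * (r * b - h₁ * C₂ * a) + σ₁)

    FirstMinorDivisible : ℕ → (σ₀ σ₁ a b : ℤ) → Set
    FirstMinorDivisible p σ₀ σ₁ a b =
      + p ∣ a * (n * (r * b - h₁ * C₂ * a) + σ₁) - b * (n * ((r - h₁ * B₂) * a + h₁ * A₂ * b) + σ₀)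

    module _ {p} (p-prime : Prime p) (p∤n : ¬ + p ∣ n) (p∤h₁ : ¬ + p ∣ h₁) where

      cancel-coefficient : ∀ {y} x → ¬ + p ∣ y → + p ∣ y * (n * h₁) * x → + p ∣ x
      cancel-coefficient {y} x p∤y p∣ with prime-∣-* (y * (n * h₁)) x p-prime p∣
      ... | inj₁ p∣ynh₁ = contradiction p∣ynh₁ (prime-∤-* y (n * h₁) p-prime p∤y (prime-∤-* n h₁ p-prime p∤n p∤h₁))
      ... | inj₂ p∣x    = p∣x

      -- Both minors are affine in (a , b). Differences of their values at (0 , 0), (1 , 0) and (0 ,
      -- 1) produce y n h₁ times A₂, B₂ and C₂, so the minors cannot vanish mod p at all three
      -- points.
      head-nonzero : ∀ y w σ₀ σ₁ → ¬ + p ∣ y → ∃₂ λ a b → ¬ HeadMinorsDivisible p y w σ₀ σ₁ a b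
      head-nonzero y w σ₀ σ₁ p∤y with divisible? 0ℤ 0ℤ | divisible? 1ℤ 0ℤ | divisible? 0ℤ 1ℤ
        where
        divisible? : ∀ a b → Dec (HeadMinorsDivisible p y w σ₀ σ₁ a b)
        divisible? a b = (+ p ∣? _) ×-dec (+ p ∣? _)
      ... | no ¬div | _ | _ = 0ℤ , 0ℤ , ¬div
      ... | yes _ | no ¬div | _ = 1ℤ , 0ℤ , ¬div
      ... | yes _ | yes _ | no ¬div = 0ℤ , 1ℤ , ¬div
      ... | yes (p∣₀₀ , p∣₀₁) | yes (p∣₁₀ , p∣₁₁) | yes (p∣₂₀ , p∣₂₁) = contradiction
        ( cancel-coefficient A₂ p∤y (∣-combine₂ 1ℤ (- 1ℤ) (A-coefficient n h₁ A₂ B₂ r y w σ₀) p∣₀₀ p∣₂₀)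
        ∷ cancel-coefficient B₂ p∤y (subst (+ p ∣_) (B-coefficient n h₁ A₂ B₂ C₂ r y w σ₀ σ₁)
            (∣m∣n⇒∣m-n (∣m∣n⇒∣m-n p∣₁₀ p∣₀₀) (∣m∣n⇒∣m-n p∣₂₁ p∣₀₁)))
        ∷ cancel-coefficient C₂ p∤y (∣-combine₂ 1ℤ (- 1ℤ) (C-coefficient n h₁ C₂ r y w σ₁) p∣₁₁ p∣₀₁)
        ∷ []) (primitive₂ p p-prime)

      -- Modulo p the minor is -n h₁ (C₂a² - B₂ab + A₂b²), a unit times a primitive form, which is
      -- nonzero at one of the three points tried.
      first-nonzero : ∀ σ₀ σ₁ → + p ∣ σ₀ → + p ∣ σ₁ → ∃₂ λ a b →
        ¬ FirstMinorDivisible p σ₀ σ₁ a b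
      first-nonzero σ₀ σ₁ p∣σ₀ p∣σ₁ with divisible? 1ℤ 0ℤ | divisible? 0ℤ 1ℤ | divisible? 1ℤ 1ℤ
        where
        divisible? : ∀ a b → Dec (FirstMinorDivisible p σ₀ σ₁ a b)
        divisible? a b = + p ∣? _
      ... | no ¬div | _ | _ = 1ℤ , 0ℤ , ¬div
      ... | yes _ | no ¬div | _ = 0ℤ , 1ℤ , ¬div
      ... | yes _ | yes _ | no ¬div = 1ℤ , 1ℤ , ¬div
      ... | yes p∣C | yes p∣A | yes p∣A-B+C = contradiction
        ( cancel-coefficient A₂ (prime-∤-1 p-prime) (∣-combine₂ (- 1ℤ) (- 1ℤ) (A-coefficient′ n h₁ A₂ B₂ C₂ r σ₀ σ₁) p∣A p∣σ₀)
        ∷ cancel-coefficient B₂ (prime-∤-1 p-prime) (∣-combine₃ 1ℤ (- 1ℤ) (- 1ℤ) (B-coefficient′ n h₁ A₂ B₂ C₂ r σ₀ σ₁) p∣A-B+C p∣A p∣C)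
        ∷ cancel-coefficient C₂ (prime-∤-1 p-prime) (∣-combine₂ (- 1ℤ) 1ℤ (C-coefficient′ n h₁ A₂ B₂ C₂ r σ₀ σ₁) p∣C p∣σ₁)
        ∷ []) (primitive₂ p p-prime)

    module _ (c d : ℤ) where

      Unimodular : ℕ → ℤ → ℤ → Set
      Unimodular p a b = ¬ All (+ p ∣_) (minors ⟨ a , b , c , d ⟩ (W ⟨ a , b , c , d ⟩))

      unimodular-resp : ∀ {p a b a′ b′} → a ≡ a′ [mod p ] → b ≡ b′ [mod p ] → Unimodular p a b → Unimodular p a′ b′
      unimodular-resp {p} {a} {b} {a′} {b′} a≡ b≡ unimod (m₀ ∷ m₁ ∷ m₂ ∷ m₃ ∷ m₄ ∷ m₅ ∷ []) = unimod
        ( mod-∣ (mod-minor a≡ w₁≡ b≡ w₀≡) m₀ ∷ mod-∣ (mod-minor a≡ (mod-refl _) (mod-refl c) w₀≡) m₁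
        ∷ mod-∣ (mod-minor a≡ (mod-refl _) (mod-refl d) w₀≡) m₂ ∷ mod-∣ (mod-minor b≡ (mod-refl _) (mod-refl c) w₁≡) m₃
        ∷ mod-∣ (mod-minor b≡ (mod-refl _) (mod-refl d) w₁≡) m₄ ∷ m₅ ∷ [])
        where
        w₀≡ : n * ((r - h₁ * B₂) * a + h₁ * A₂ * b) + σ₀ c d ≡ n * ((r - h₁ * B₂) * a′ + h₁ * A₂ * b′) + σ₀ c d [mod p ]
        w₀≡ = mod-* (mod-refl n) (mod-* (mod-refl (r - h₁ * B₂)) a≡ ⊞ mod-* (mod-refl (h₁ * A₂)) b≡) ⊞ mod-refl (σ₀ c d)
        w₁≡ : n * (r * b - h₁ * C₂ * a) + σ₁ c d ≡ n * (r * b′ - h₁ * C₂ * a′) + σ₁ c d [mod p ]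
        w₁≡ = mod-* (mod-refl n) (mod-* (mod-refl r) b≡ ⊞ mod-neg (mod-* (mod-refl (h₁ * C₂)) a≡)) ⊞ mod-refl (σ₁ c d)

      -- The last minor equals -n h₂ q₁(c , d) whatever the head (a , b); this settles all primes
      -- outside n h₂ q₁(c , d) at once.
      tail-minor : ∀ {p} a b → Prime p → ¬ + p ∣ n → ¬ + p ∣ h₂ → ¬ + p ∣ q₁ c d → Unimodular p a b
      tail-minor {p} a b p-prime p∤n p∤h₂ p∤q₁ (_ ∷ _ ∷ _ ∷ _ ∷ _ ∷ m₅ ∷ []) =
        prime-∤-* (n * h₂) (q₁ c d) p-prime (prime-∤-* n h₂ p-prime p∤n p∤h₂) p∤q₁
          (subst (+ p ∣_) (tail-identity n h₂ A₁ B₁ C₁ c d) (∣m⇒∣-m m₅))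

      -- If p does not divide the second factor, it divides both c and d, and then the combination
      -- of them as well.
      linear-∣ : ∀ {p} s t → Prime p → + p ∣ c * (c * s + d * t) → + p ∣ d * (c * s + d * t) → + p ∣ c * s + d * t
      linear-∣ s t p-prime p∣cσ p∣dσ with prime-∣-* c (c * s + d * t) p-prime p∣cσ | prime-∣-* d (c * s + d * t) p-prime p∣dσ
      ... | inj₂ p∣σ | _        = p∣σ
      ... | inj₁ _   | inj₂ p∣σ = p∣σ
      ... | inj₁ p∣c | inj₁ p∣d = ∣m∣n⇒∣m+n (∣m⇒∣m*n s p∣c) (∣m⇒∣m*n t p∣d)

      unimodular-at : ∀ {p} → Prime p → ¬ + p ∣ n → ¬ + p ∣ h₁ → ∃₂ (Unimodular p)
      unimodular-at {p} p-prime p∤n p∤h₁ with + p ∣? c | + p ∣? d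
      ... | no p∤c | _ = from-c (head-nonzero p-prime p∤n p∤h₁ c w₂ (σ₀ c d) (σ₁ c d) p∤c)
        where
        w₂ = n * h₂ * (A₁ * d - B₁ * c)
        from-c : (∃₂ λ a b → ¬ HeadMinorsDivisible p c w₂ (σ₀ c d) (σ₁ c d) a b) → ∃₂ (Unimodular p)
        from-c (a , b , ¬div) = a , b , λ where (_ ∷ m₁ ∷ _ ∷ m₃ ∷ _ ∷ _ ∷ []) → ¬div (m₁ , m₃)
      ... | yes _ | no p∤d = from-d (head-nonzero p-prime p∤n p∤h₁ d w₃ (σ₀ c d) (σ₁ c d) p∤d)
        where
        w₃ = - (n * h₂ * C₁ * c)
        from-d : (∃₂ λ a b → ¬ HeadMinorsDivisible p d w₃ (σ₀ c d) (σ₁ c d) a b) → ∃₂ (Unimodular p)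
        from-d (a , b , ¬div) = a , b , λ where (_ ∷ _ ∷ m₂ ∷ _ ∷ m₄ ∷ _ ∷ []) → ¬div (m₂ , m₄)
      -- The tail vanishes mod p, hence so does σ, and only the minor of the two head coordinates
      -- can be a unit.
      ... | yes p∣c | yes p∣d = from-head (first-nonzero p-prime p∤n p∤h₁ (σ₀ c d) (σ₁ c d)
              (∣m∣n⇒∣m+n (∣m⇒∣m*n s₀ p∣c) (∣m⇒∣m*n t₀ p∣d)) (∣m∣n⇒∣m+n (∣m⇒∣m*n s₁ p∣c) (∣m⇒∣m*n t₁ p∣d)))
        where
        from-head : (∃₂ λ a b → ¬ FirstMinorDivisible p (σ₀ c d) (σ₁ c d) a b) → ∃₂ (Unimodular p)
        from-head (a , b , ¬div) = a , b , λ where (m₀ ∷ _ ∷ _ ∷ _ ∷ _ ∷ _ ∷ []) → ¬div m₀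

      unimodular-local : (∀ p → Prime p → + p ∣ n * h₁ * + ℓ → GoodTail p c d) → ∀ p → Prime p → ∃₂ (Unimodular p)
      unimodular-local good p p-prime with + p ∣? n
      -- With head 0 the mixed minors are -cσ₀, -dσ₀, -cσ₁, -dσ₁ mod p.
      ... | yes p∣n = 0ℤ , 0ℤ , λ where
          (_ ∷ m₁ ∷ m₂ ∷ m₃ ∷ m₄ ∷ _ ∷ []) → σ≢0 (good p p-prime (∣m⇒∣m*n (+ ℓ) (∣m⇒∣m*n h₁ p∣n))) p∣n
            ( linear-∣ s₀ t₀ p-prime (∣-σ c _ m₁) (∣-σ d _ m₂)
            , linear-∣ s₁ t₁ p-prime (∣-σ c _ m₃) (∣-σ d _ m₄))
        where
        ∣-σ : ∀ y e {σ} → + p ∣ 0ℤ - y * (n * e + σ) → + p ∣ y * σ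
        ∣-σ y e {σ} p∣m = ∣-combine₂ (- 1ℤ) (- (y * e)) (σ-identity n y e σ) p∣m p∣n
      ... | no p∤n with + p ∣? h₁
      ...   | no p∤h₁ = unimodular-at p-prime p∤n p∤h₁
      -- Since p ∤ h₂ here, the last minor is a unit for every head; 0 is a default.
      ...   | yes p∣h₁ = 0ℤ , 0ℤ , tail-minor 0ℤ 0ℤ p-prime p∤n
        (λ p∣h₂ → coprime p p-prime (p∣h₁ ∷ p∣h₂ ∷ []))
        (q₁≢0 (good p p-prime (∣m⇒∣m*n (+ ℓ) (∣n⇒∣m*n n p∣h₁))) p∤n)

    cyclicVector : ∃₂ λ v g → g ∙ v ≡ 0ℤ × g ∙ W v ≡ 1ℤ
    cyclicVector =
      let c , d , good = tail
          a , b , good′ = Approximation.approximate (Unimodular c d) (unimodular-resp c d) (unimodular-local c d good)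
            (n * h₂ * q₁ c d) (*-≢0 (*-≢0 n≢0 h₂≢0) (q₁-nonzero c d good))
          v = ⟨ a , b , c , d ⟩
      in v , unimodular⇒dual v (W v) (unimodular a b c d good′)
      where
      q₁-nonzero : ∀ c d → (∀ p → Prime p → + p ∣ n * h₁ * + ℓ → GoodTail p c d) → q₁ c d ≢ 0ℤ
      q₁-nonzero c d good q₁≡0 = q₁≢0 (good ℓ ℓ-prime (∣n⇒∣m*n (n * h₁) ∣-refl)) ℓ∤n
        (subst (+ ℓ ∣_) (sym q₁≡0) (divides 0ℤ refl))
      unimodular : ∀ a b c d → (∀ p → Prime p → + p ∣ n * h₂ * q₁ c d → Unimodular c d p a b) →
        ∀ p → Prime p → Unimodular c d p a b
      unimodular a b c d good p p-prime with + p ∣? n * h₂ * q₁ c d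
      ... | yes p∣N = good p p-prime p∣N
      ... | no p∤N  = tail-minor c d a b p-prime (p∤N ∘ ∣m⇒∣m*n (q₁ c d) ∘ ∣m⇒∣m*n h₂)
        (p∤N ∘ ∣m⇒∣m*n (q₁ c d) ∘ ∣n⇒∣m*n n) (p∤N ∘ ∣n⇒∣m*n (n * h₂))

open Arithmetic

-- Polynomial identities in a commutative ring that receives ℤ.

ℤ-rawRing : RawRing 0ℓ 0ℓ
ℤ-rawRing = CommutativeRing.rawRing ℤ.+-*-commutativeRing

-- The ring is a parameter because the same tools serve twice: over ℝ, for the products of pairs
-- that make ℂ a ring, and then over ℂ, for the lattices.
module Over
  (R : CommutativeRing 0ℓ 0ℓ) (ι : ℤ → CommutativeRing.Carrier R)
  (ι-isRingHomomorphism : RingMorphisms.IsRingHomomorphism ℤ-rawRing (CommutativeRing.rawRing R) ι)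
  where

  open CommutativeRing R renaming (refl to ≈-refl; sym to ≈-sym; trans to ≈-trans) hiding (zero)
  open RingMorphisms.IsRingHomomorphism ι-isRingHomomorphism
    using (+-homo; *-homo; -‿homo; 0#-homo; 1#-homo) renaming (⟦⟧-cong to ι-cong)
  open AbelianGroupProperties +-abelianGroup using () renaming (x∙y⁻¹≈ε⇒x≈y to x-y≈0⇒x≈y; x≈y⇒x∙y⁻¹≈ε to x≈y⇒x-y≈0)
  open import Relation.Binary.Reasoning.Setoid setoid

  ι-morphism : ℤ-rawRing -Raw-AlmostCommutative⟶ fromCommutativeRing R
  ι-morphism = record
    { ⟦_⟧ = ι ; +-homo = +-homo ; *-homo = *-homo ; -‿homo = -‿homo ; 0-homo = 0#-homo ; 1-homo = 1#-homo }

  ι-≟ : ∀ a b → Maybe (ι a ≈ ι b)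
  ι-≟ a b with a ℤ.≟ b
  ... | yes a≡b = just (ι-cong a≡b)
  ... | no  _   = nothing

  open RingSolver ℤ-rawRing (fromCommutativeRing R) ι-morphism ι-≟
    using (Polynomial; op; [+]; [*]; con; var; _:^_; solve; _:+_; _:*_; :-_; _:-_; _:=_) renaming (⟦_⟧ to eval)

  private
    evalℤ : ∀ {n} → Polynomial n → Vec ℤ n → ℤ
    evalℤ (op [+] p q) ρ = evalℤ p ρ ℤ.+ evalℤ q ρ
    evalℤ (op [*] p q) ρ = evalℤ p ρ ℤ.* evalℤ q ρ
    evalℤ (con c)      ρ = c
    evalℤ (var x)      ρ = Vec.lookup ρ x
    evalℤ (p :^ zero)  ρ = 1ℤ
    evalℤ (p :^ suc k) ρ = evalℤ p ρ ℤ.* evalℤ (p :^ k) ρ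
    evalℤ (:- p)       ρ = ℤ.- evalℤ p ρ

    ι-eval : ∀ {n} (p : Polynomial n) ρ → ι (evalℤ p ρ) ≈ eval p (Vec.map ι ρ)
    ι-eval (op [+] p q) ρ = ≈-trans (+-homo _ _) (+-cong (ι-eval p ρ) (ι-eval q ρ))
    ι-eval (op [*] p q) ρ = ≈-trans (*-homo _ _) (*-cong (ι-eval p ρ) (ι-eval q ρ))
    ι-eval (con c)      ρ = ≈-refl
    ι-eval (var x)      ρ = reflexive (≡.sym (Vec.lookup-map x ι ρ))
    ι-eval (p :^ zero)  ρ = 1#-homo
    ι-eval (p :^ suc k) ρ = ≈-trans (*-homo _ _) (*-cong (ι-eval p ρ) (ι-eval (p :^ k) ρ))
    ι-eval (:- p)       ρ = ≈-trans (-‿homo _) (-‿cong (ι-eval p ρ))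

    -- Distributes `ι` over a whole polynomial at once. The solver syntax evaluates in ℤ, by
    -- computation, to the very formulas that define the integer coordinates below.
    ι-poly : ∀ n (f : N-ary n (Polynomial n) (Polynomial n)) →
      let p = f $ⁿ Vec.map var (Vec.allFin n)
      in Eq n _≈_ (curryⁿ {n = n} λ ρ → ι (evalℤ p ρ)) (curryⁿ {n = n} λ ρ → eval p (Vec.map ι ρ))
    ι-poly n f = curryⁿ-cong _≈_ {n = n} _ _ (ι-eval (f $ⁿ Vec.map var (Vec.allFin n)))

  multiple≈0 : ∀ {e} k → e ≈ 0# → k * e ≈ 0#
  multiple≈0 k e≈0 = ≈-trans (*-congˡ e≈0) (zeroʳ k)

  -- Equality modulo the ideal of the known relations: the solver certifies x - y as an explicit
  -- combination of them. Callers pass `_` for the coefficients, since the certificate determines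
  -- them.
  modulo₁ : ∀ {x y e₁} k₁ → e₁ ≈ 0# → x - y ≈ k₁ * e₁ → x ≈ y
  modulo₁ k₁ e₁≈0 eq = x-y≈0⇒x≈y _ _ (≈-trans eq (multiple≈0 k₁ e₁≈0))

  modulo₂ : ∀ {x y e₁ e₂} k₁ k₂ → e₁ ≈ 0# → e₂ ≈ 0# → x - y ≈ k₁ * e₁ + k₂ * e₂ → x ≈ y
  modulo₂ k₁ k₂ e₁≈0 e₂≈0 eq = x-y≈0⇒x≈y _ _
    (≈-trans eq (≈-trans (+-cong (multiple≈0 k₁ e₁≈0) (multiple≈0 k₂ e₂≈0)) (+-identityʳ 0#)))

  modulo₃ : ∀ {x y e₁ e₂ e₃} k₁ k₂ k₃ → e₁ ≈ 0# → e₂ ≈ 0# → e₃ ≈ 0# → x - y ≈ k₁ * e₁ + k₂ * e₂ + k₃ * e₃ → x ≈ y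
  modulo₃ k₁ k₂ k₃ e₁≈0 e₂≈0 e₃≈0 eq = modulo₂ 1# k₃
    (≈-trans (+-cong (multiple≈0 k₁ e₁≈0) (multiple≈0 k₂ e₂≈0)) (+-identityʳ 0#)) e₃≈0
    (≈-trans eq (+-congʳ (≈-sym (*-identityˡ _))))

  modulo₄ : ∀ {x y e₁ e₂ e₃ e₄} k₁ k₂ k₃ k₄ → e₁ ≈ 0# → e₂ ≈ 0# → e₃ ≈ 0# → e₄ ≈ 0# →
    x - y ≈ k₁ * e₁ + k₂ * e₂ + k₃ * e₃ + k₄ * e₄ → x ≈ y
  modulo₄ k₁ k₂ k₃ k₄ e₁≈0 e₂≈0 e₃≈0 e₄≈0 eq = modulo₃ 1# k₃ k₄
    (≈-trans (+-cong (multiple≈0 k₁ e₁≈0) (multiple≈0 k₂ e₂≈0)) (+-identityʳ 0#)) e₃≈0 e₄≈0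
    (≈-trans eq (+-congʳ (+-congʳ (≈-sym (*-identityˡ _)))))

  modulo₅ : ∀ {x y e₁ e₂ e₃ e₄ e₅} k₁ k₂ k₃ k₄ k₅ → e₁ ≈ 0# → e₂ ≈ 0# → e₃ ≈ 0# → e₄ ≈ 0# → e₅ ≈ 0# →
    x - y ≈ k₁ * e₁ + k₂ * e₂ + k₃ * e₃ + k₄ * e₄ + k₅ * e₅ → x ≈ y
  modulo₅ k₁ k₂ k₃ k₄ k₅ e₁≈0 e₂≈0 e₃≈0 e₄≈0 e₅≈0 eq = modulo₄ 1# k₃ k₄ k₅
    (≈-trans (+-cong (multiple≈0 k₁ e₁≈0) (multiple≈0 k₂ e₂≈0)) (+-identityʳ 0#)) e₃≈0 e₄≈0 e₅≈0
    (≈-trans eq (+-congʳ (+-congʳ (+-congʳ (≈-sym (*-identityˡ _))))))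

  Independent : Carrier → Set
  Independent τ = ∀ a b → ι a * τ + ι b ≈ 0# → a ≡ 0ℤ × b ≡ 0ℤ

  TorsionFree : Set
  TorsionFree = ∀ k {x} → k ≢ 0ℤ → ι k * x ≈ 0# → x ≈ 0#

  module GaussianIdentities where

    assoc-re = solve 6 (λ a b c d e f →
      (a :* c :+ :- (b :* d)) :* e :+ :- ((a :* d :+ b :* c) :* f)
      := a :* (c :* e :+ :- (d :* f)) :+ :- (b :* (c :* f :+ d :* e))) ≈-refl

    assoc-im = solve 6 (λ a b c d e f →
      (a :* c :+ :- (b :* d)) :* f :+ (a :* d :+ b :* c) :* e
      := a :* (c :* f :+ d :* e) :+ b :* (c :* e :+ :- (d :* f))) ≈-refl

    comm-re : ∀ a b c d → a * c + - (b * d) ≈ c * a + - (d * b)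
    comm-re = solve 4 (λ a b c d → a :* c :+ :- (b :* d) := c :* a :+ :- (d :* b)) ≈-refl

    comm-im : ∀ a b c d → a * d + b * c ≈ c * b + d * a
    comm-im = solve 4 (λ a b c d → a :* d :+ b :* c := c :* b :+ d :* a) ≈-refl

    identity-re : ∀ a b → ι 1ℤ * a + - (ι 0ℤ * b) ≈ a
    identity-re = solve 2 (λ a b → con 1ℤ :* a :+ :- (con 0ℤ :* b) := a) ≈-refl

    identity-im : ∀ a b → ι 1ℤ * b + ι 0ℤ * a ≈ b
    identity-im = solve 2 (λ a b → con 1ℤ :* b :+ con 0ℤ :* a := b) ≈-refl

    distrib-re : ∀ a b c d e f → a * (c + e) + - (b * (d + f)) ≈ (a * c + - (b * d)) + (a * e + - (b * f))
    distrib-re = solve 6 (λ a b c d e f →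
      a :* (c :+ e) :+ :- (b :* (d :+ f))
      := (a :* c :+ :- (b :* d)) :+ (a :* e :+ :- (b :* f))) ≈-refl

    distrib-im : ∀ a b c d e f → a * (d + f) + b * (c + e) ≈ (a * d + b * c) + (a * f + b * e)
    distrib-im = solve 6 (λ a b c d e f →
      a :* (d :+ f) :+ b :* (c :+ e)
      := (a :* d :+ b :* c) :+ (a :* f :+ b :* e)) ≈-refl

  -- The matrices (p q ; -w v) and (v -q ; w p) are inverse to each other when pv + qw = 1. The
  -- trailing zeros reproduce the fold in `apply`.
  module MatrixIdentities where

    MN₀ = solve 6 (λ p q v w a b →
      (p :* (v :* a :+ (:- q :* b :+ con 0ℤ)) :+ (q :* (w :* a :+ (p :* b :+ con 0ℤ)) :+ con 0ℤ)) :- a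
      := a :* (p :* v :+ q :* w :- con 1ℤ)) ≈-refl

    MN₁ = solve 6 (λ p q v w a b →
      (:- w :* (v :* a :+ (:- q :* b :+ con 0ℤ)) :+ (v :* (w :* a :+ (p :* b :+ con 0ℤ)) :+ con 0ℤ)) :- b
      := b :* (p :* v :+ q :* w :- con 1ℤ)) ≈-refl

    NM₀ = solve 6 (λ p q v w a b →
      (v :* (p :* a :+ (q :* b :+ con 0ℤ)) :+ (:- q :* (:- w :* a :+ (v :* b :+ con 0ℤ)) :+ con 0ℤ)) :- a
      := a :* (p :* v :+ q :* w :- con 1ℤ)) ≈-refl

    NM₁ = solve 6 (λ p q v w a b →
      (w :* (p :* a :+ (q :* b :+ con 0ℤ)) :+ (p :* (:- w :* a :+ (v :* b :+ con 0ℤ)) :+ con 0ℤ)) :- b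
      := b :* (p :* v :+ q :* w :- con 1ℤ)) ≈-refl

    row-M₀ : ∀ p q x y → p * x + (q * y + ι 0ℤ) ≈ p * x + q * y
    row-M₀ = solve 4 (λ p q x y → p :* x :+ (q :* y :+ con 0ℤ) := p :* x :+ q :* y) ≈-refl

    row-M₁ : ∀ v w x y → - w * x + (v * y + ι 0ℤ) ≈ v * y - w * x
    row-M₁ = solve 4 (λ v w x y → :- w :* x :+ (v :* y :+ con 0ℤ) := v :* y :- w :* x) ≈-refl

    row-N₀ : ∀ v q α δ → v * α - q * δ ≈ v * α + (- q * δ + ι 0ℤ)
    row-N₀ = solve 4 (λ v q α δ → v :* α :- q :* δ := v :* α :+ (:- q :* δ :+ con 0ℤ)) ≈-refl

    row-N₁ : ∀ w p α δ → w * α + p * δ ≈ w * α + (p * δ + ι 0ℤ)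
    row-N₁ = solve 4 (λ w p α δ → w :* α :+ p :* δ := w :* α :+ (p :* δ :+ con 0ℤ)) ≈-refl

  -- Groups of the form ℤτ + ℤ.

  -- One predicate for several groups: Lᵢ for τ = τᵢ, its multiplier ring for τ = Aᵢτᵢ, and 𝒪_{nf}
  -- for τ = ω.
  Rank₂ : Carrier → Carrier → Set
  Rank₂ τ x = ∃₂ λ a b → x ≈ ι a * τ + ι b

  rank₂-+ : ∀ {τ x y} → Rank₂ τ x → Rank₂ τ y → Rank₂ τ (x + y)
  rank₂-+ {τ} (a , b , x≈) (a′ , b′ , y≈) = a ℤ.+ a′ , b ℤ.+ b′ , ≈-trans (+-cong x≈ y≈)
    (≈-trans (identity (ι a) (ι b) (ι a′) (ι b′) τ) (≈-sym (+-cong (*-congʳ (+-homo a a′)) (+-homo b b′))))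
    where
    identity : ∀ a b a′ b′ τ → (a * τ + b) + (a′ * τ + b′) ≈ (a + a′) * τ + (b + b′)
    identity = solve 5 (λ a b a′ b′ τ → (a :* τ :+ b) :+ (a′ :* τ :+ b′) := (a :+ a′) :* τ :+ (b :+ b′)) ≈-refl

  rank₂-resp : ∀ {τ x y} → x ≈ y → Rank₂ τ x → Rank₂ τ y
  rank₂-resp x≈y (a , b , x≈) = a , b , ≈-trans (≈-sym x≈y) x≈

  rank₂-scale : ∀ {τ x} k → Rank₂ τ x → Rank₂ τ (ι k * x)
  rank₂-scale {τ} k (a , b , x≈) = k ℤ.* a , k ℤ.* b , ≈-trans (*-congˡ x≈)
    (≈-trans (identity (ι k) (ι a) (ι b) τ) (≈-sym (+-cong (*-congʳ (*-homo k a)) (*-homo k b))))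
    where
    identity : ∀ k a b τ → k * (a * τ + b) ≈ (k * a) * τ + k * b
    identity = solve 4 (λ k a b τ → k :* (a :* τ :+ b) := (k :* a) :* τ :+ k :* b) ≈-refl

  rank₂-divide : ∀ {τ a b p} → + p ∣ a → + p ∣ b → ∃ λ x → Rank₂ τ x × ι a * τ + ι b ≈ ι (+ p) * x
  rank₂-divide {τ} {a} {b} {p} (divides a′ a≡a′p) (divides b′ b≡b′p) = ι a′ * τ + ι b′ , (a′ , b′ , ≈-refl) ,
    ≈-trans (+-cong (*-congʳ (≈-trans (ι-cong a≡a′p) (*-homo a′ (+ p)))) (≈-trans (ι-cong b≡b′p) (*-homo b′ (+ p))))
      (identity (ι a′) (ι b′) (ι (+ p)) τ)
    where
    identity : ∀ a b p τ → (a * p) * τ + b * p ≈ p * (a * τ + b)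
    identity = solve 4 (λ a b p τ → (a :* p) :* τ :+ b :* p := p :* (a :* τ :+ b)) ≈-refl

  private module Identities where

    s-identity = solve 15 (λ h₁ h₂ A₁ B₁ C₁ A₂ B₂ C₂ r k₀ k₁ k₂ k₃ τ₁ τ₂ →
      (((r :- h₁ :* B₂) :* k₀ :+ h₁ :* A₂ :* k₁ :+ h₂ :* B₁ :* k₀ :- h₂ :* C₁ :* k₂) :* τ₂
        :+ (r :* k₁ :- h₁ :* C₂ :* k₀ :+ h₂ :* B₁ :* k₁ :- h₂ :* C₁ :* k₃))
      :- (h₂ :* A₁ :* τ₁ :+ h₂ :* B₁) :* (k₀ :* τ₂ :+ k₁ :+ τ₁ :* (k₂ :* τ₂ :+ k₃))
      := :- (h₂ :* (k₂ :* τ₂ :+ k₃)) :* (A₁ :* (τ₁ :* τ₁) :+ B₁ :* τ₁ :+ C₁) :+ :- (h₁ :* k₀) :* (A₂ :* (τ₂ :* τ₂) :+ B₂ :* τ₂ :+ C₂)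
        :+ :- (k₀ :* τ₂ :+ k₁) :* (h₂ :* A₁ :* τ₁ :- (h₁ :* A₂ :* τ₂ :+ r))) ≈-refl

    t-identity = solve 13 (λ h₁ h₂ A₁ A₂ B₂ C₂ r k₀ k₁ k₂ k₃ τ₁ τ₂ →
      (:- (h₂ :* A₁ :* k₀ :+ ((r :- h₁ :* B₂) :* k₂ :+ h₁ :* A₂ :* k₃)) :* τ₂ :+ :- (h₂ :* A₁ :* k₁ :+ (r :* k₃ :- h₁ :* C₂ :* k₂)))
      :- :- (h₂ :* A₁ :* (k₀ :* τ₂ :+ k₁ :+ τ₁ :* (k₂ :* τ₂ :+ k₃)))
      := (h₁ :* k₂) :* (A₂ :* (τ₂ :* τ₂) :+ B₂ :* τ₂ :+ C₂) :+ (k₂ :* τ₂ :+ k₃) :* (h₂ :* A₁ :* τ₁ :- (h₁ :* A₂ :* τ₂ :+ r))) ≈-refl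

    W₀-identity = solve 20 (λ n h₁ h₂ A₁ B₁ A₂ B₂ C₂ r s₀ s₁ t₀ t₁ τ₁ τ₂ z a b c d →
      ((n :* ((r :- h₁ :* B₂) :* a :+ h₁ :* A₂ :* b) :+ (c :* s₀ :+ d :* t₀)) :* τ₂
        :+ (n :* (r :* b :- h₁ :* C₂ :* a) :+ (c :* s₁ :+ d :* t₁)) :+ n :* h₂ :* (A₁ :* d :- B₁ :* c) :* z)
      :- n :* (h₂ :* A₁ :* τ₁) :* (a :* τ₂ :+ b :+ c :* z)
      := :- (n :* h₁ :* a) :* (A₂ :* (τ₂ :* τ₂) :+ B₂ :* τ₂ :+ C₂) :+ :- (n :* (a :* τ₂ :+ b)) :* (h₂ :* A₁ :* τ₁ :- (h₁ :* A₂ :* τ₂ :+ r))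
        :+ c :* (s₀ :* τ₂ :+ s₁ :- (h₂ :* A₁ :* τ₁ :+ h₂ :* B₁) :* (n :* z)) :+ d :* (t₀ :* τ₂ :+ t₁ :- :- (h₂ :* A₁ :* (n :* z)))) ≈-refl

    W₁-identity = solve 8 (λ n h₂ A₁ B₁ C₁ τ₁ c d →
      (n :* h₂ :* (A₁ :* d :- B₁ :* c) :* τ₁ :+ :- (n :* h₂ :* C₁ :* c)) :- n :* (h₂ :* A₁ :* τ₁) :* (c :* τ₁ :+ d)
      := :- (n :* h₂ :* c) :* (A₁ :* (τ₁ :* τ₁) :+ B₁ :* τ₁ :+ C₁)) ≈-refl

    ω-identity = solve 6 (λ n h₂ A₁ B₁ C₁ τ₁ →
      (n :* (h₂ :* A₁ :* τ₁)) :* (n :* (h₂ :* A₁ :* τ₁)) :+ n :* h₂ :* B₁ :* (n :* (h₂ :* A₁ :* τ₁)) :+ n :* h₂ :* (n :* h₂) :* A₁ :* C₁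
      := n :* h₂ :* (n :* h₂) :* A₁ :* (A₁ :* (τ₁ :* τ₁) :+ B₁ :* τ₁ :+ C₁)) ≈-refl

    trace-identity = solve 11 (λ h₁ h₂ A₁ B₁ C₁ A₂ B₂ C₂ r τ₁ τ₂ →
      ((r :+ r :- h₁ :* B₂ :+ h₂ :* B₁) :* (h₂ :* A₁) :* τ₁ :+ (h₂ :* h₂ :* A₁ :* C₁ :- h₁ :* h₁ :* A₂ :* C₂ :- r :* r :+ r :* h₁ :* B₂)) :- con 0ℤ
      := h₂ :* h₂ :* A₁ :* (A₁ :* (τ₁ :* τ₁) :+ B₁ :* τ₁ :+ C₁) :+ :- (h₁ :* h₁ :* A₂) :* (A₂ :* (τ₂ :* τ₂) :+ B₂ :* τ₂ :+ C₂)
        :+ :- (h₂ :* A₁ :* τ₁ :- r :+ h₁ :* A₂ :* τ₂ :+ h₁ :* B₂) :* (h₂ :* A₁ :* τ₁ :- (h₁ :* A₂ :* τ₂ :+ r))) ≈-refl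

    coprime-case-identity = solve 15 (λ p h₂ A B C τ₁ S T u v w u′ w′ l l′ →
      (l :+ τ₁ :* l′) :- p :* ((u′ :* (:- u :* T :+ v :* S) :+ w′ :* l) :+ τ₁ :* (u′ :* (v :* T :+ :- w :* S) :+ w′ :* l′))
      := :- (u′ :* (:- u :+ v :* τ₁)) :* (p :* T :- :- (h₂ :* A :* (l :+ τ₁ :* l′)))
        :+ :- (u′ :* (v :- w :* τ₁)) :* (p :* S :- (h₂ :* A :* τ₁ :+ h₂ :* B) :* (l :+ τ₁ :* l′))
        :+ u′ :* w :* h₂ :* (l :+ τ₁ :* l′) :* (A :* (τ₁ :* τ₁) :+ B :* τ₁ :+ C)
        :+ :- (l :+ τ₁ :* l′) :* (u′ :* h₂ :+ w′ :* p :- con 1ℤ)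
        :+ :- (u′ :* h₂ :* (l :+ τ₁ :* l′)) :* (u :* A :+ (v :* B :+ (w :* C :+ con 0ℤ)) :- con 1ℤ)) ≈-refl

    divisible-case-identity = solve 14 (λ p h A B C τ₁ τ₂ h₁ A₂ r m m′ e e′ →
      ((h₁ :* A₂ :* τ₂ :+ r) :* m :+ p :* e :+ τ₁ :* ((h₁ :* A₂ :* τ₂ :+ r) :* m′ :+ p :* e′))
      :- p :* ((e :+ :- (h :* C) :* m′) :+ τ₁ :* ((h :* A) :* m :+ (e′ :+ :- (h :* B) :* m′)))
      := p :* h :* m′ :* (A :* (τ₁ :* τ₁) :+ B :* τ₁ :+ C) :+ :- (m :+ τ₁ :* m′) :* ((h :* p) :* A :* τ₁ :- (h₁ :* A₂ :* τ₂ :+ r))) ≈-refl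

    Φ-identity = solve 13 (λ ω g₀ g₁ g₂ g₃ g₀′ g₁′ g₂′ g₃′ a b c d →
      a :* (g₀′ :+ ω :* g₀) :+ b :* (g₁′ :+ ω :* g₁) :+ c :* (g₂′ :+ ω :* g₂) :+ d :* (g₃′ :+ ω :* g₃)
      := (g₀′ :* a :+ g₁′ :* b :+ g₂′ :* c :+ g₃′ :* d) :+ ω :* (g₀ :* a :+ g₁ :* b :+ g₂ :* c :+ g₃ :* d)) ≈-refl

    Φ-W-identity = solve 6 (λ ω T N X Y Z →
      (X :+ T :* Y :+ ω :* Y) :- ω :* (Y :+ T :* Z :+ ω :* Z)
      := con 1ℤ :* (X :+ T :* Y :+ N :* Z) :+ :- Z :* (ω :* ω :+ T :* ω :+ N)) ≈-refl

    φ₀-identity = solve 20 (λ n h₁ A₂ B₂ C₂ r s₀ s₁ t₀ t₁ h₂ A₁ B₁ C₁ τ₁ τ₂ φ₀ φ₁ φ₂ φ₃ →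
      n :* h₁ :* A₂ :* (φ₁ :* τ₂ :- φ₀) :- con 0ℤ
      := :- (n :* φ₁) :* (h₂ :* A₁ :* τ₁ :- (h₁ :* A₂ :* τ₂ :+ r))
        :+ :- con 1ℤ :* (((n :* ((r :- h₁ :* B₂) :* con 0ℤ :+ h₁ :* A₂ :* con 1ℤ) :+ (con 0ℤ :* s₀ :+ con 0ℤ :* t₀)) :* φ₀
            :+ (n :* (r :* con 1ℤ :- h₁ :* C₂ :* con 0ℤ) :+ (con 0ℤ :* s₁ :+ con 0ℤ :* t₁)) :* φ₁
            :+ n :* h₂ :* (A₁ :* con 0ℤ :- B₁ :* con 0ℤ) :* φ₂ :+ :- (n :* h₂ :* C₁ :* con 0ℤ) :* φ₃)
          :- n :* (h₂ :* A₁ :* τ₁) :* (con 0ℤ :* φ₀ :+ con 1ℤ :* φ₁ :+ con 0ℤ :* φ₂ :+ con 0ℤ :* φ₃))) ≈-refl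

    φ₂-identity = solve 21 (λ n h₁ A₂ B₂ C₂ r s₀ s₁ t₀ t₁ h₂ A₁ B₁ C₁ τ₁ τ₂ z φ₀ φ₁ φ₂ φ₃ →
      n :* h₂ :* A₁ :* ((φ₁ :* z :+ φ₃ :* τ₁) :- φ₂) :- con 0ℤ
      := t₀ :* (φ₀ :- φ₁ :* τ₂) :+ φ₁ :* (t₀ :* τ₂ :+ t₁ :- :- (h₂ :* A₁ :* (n :* z)))
        :+ :- con 1ℤ :* (((n :* ((r :- h₁ :* B₂) :* con 0ℤ :+ h₁ :* A₂ :* con 0ℤ) :+ (con 0ℤ :* s₀ :+ con 1ℤ :* t₀)) :* φ₀
            :+ (n :* (r :* con 0ℤ :- h₁ :* C₂ :* con 0ℤ) :+ (con 0ℤ :* s₁ :+ con 1ℤ :* t₁)) :* φ₁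
            :+ n :* h₂ :* (A₁ :* con 1ℤ :- B₁ :* con 0ℤ) :* φ₂ :+ :- (n :* h₂ :* C₁ :* con 0ℤ) :* φ₃)
          :- n :* (h₂ :* A₁ :* τ₁) :* (con 0ℤ :* φ₀ :+ con 0ℤ :* φ₁ :+ con 0ℤ :* φ₂ :+ con 1ℤ :* φ₃))) ≈-refl

    Φ-vec-identity = solve 9 (λ p q τ₁ τ₂ z a b c d →
      a :* (p :* τ₂) :+ b :* p :+ c :* (p :* z :+ q :* τ₁) :+ d :* q
      := p :* (a :* τ₂ :+ b :+ c :* z) :+ q :* (c :* τ₁ :+ d)) ≈-refl

    combine-vec₀-identity = solve 13 (λ T N x₀ x₁ x₂ y₀ y₁ y₂ u₀ u₁ u₂ τ₂ z →
      (x₀ :+ T :* y₀ :+ N :* u₀) :* τ₂ :+ (x₁ :+ T :* y₁ :+ N :* u₁) :+ (x₂ :+ T :* y₂ :+ N :* u₂) :* z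
      := (x₀ :* τ₂ :+ x₁ :+ x₂ :* z) :+ T :* (y₀ :* τ₂ :+ y₁ :+ y₂ :* z) :+ N :* (u₀ :* τ₂ :+ u₁ :+ u₂ :* z)) ≈-refl

    combine-vec₁-identity = solve 9 (λ T N x₂ x₃ y₂ y₃ u₂ u₃ τ₁ →
      (x₂ :+ T :* y₂ :+ N :* u₂) :* τ₁ :+ (x₃ :+ T :* y₃ :+ N :* u₃)
      := (x₂ :* τ₁ :+ x₃) :+ T :* (y₂ :* τ₁ :+ y₃) :+ N :* (u₂ :* τ₁ :+ u₃)) ≈-refl

    quadratic-action-identity : ∀ ω T N x → ω * (ω * x) + T * (ω * x) + N * x ≈ x * (ω * ω + T * ω + N)
    quadratic-action-identity = solve 4 (λ ω T N x →
      ω :* (ω :* x) :+ T :* (ω :* x) :+ N :* x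
      := x :* (ω :* ω :+ T :* ω :+ N)) ≈-refl

    determinant-+ = solve 13 (λ a b c d k a′ b′ c′ d′ k′ τ₁ τ₂ z →
      (a :* τ₂ :+ b :+ τ₁ :* (c :* τ₂ :+ d) :+ k :* z) :+ (a′ :* τ₂ :+ b′ :+ τ₁ :* (c′ :* τ₂ :+ d′) :+ k′ :* z)
      := (a :+ a′) :* τ₂ :+ (b :+ b′) :+ τ₁ :* ((c :+ c′) :* τ₂ :+ (d :+ d′)) :+ (k :+ k′) :* z) ≈-refl

    determinant-neg = solve 8 (λ a b c d k τ₁ τ₂ z →
      :- (a :* τ₂ :+ b :+ τ₁ :* (c :* τ₂ :+ d) :+ k :* z)
      := :- a :* τ₂ :+ :- b :+ τ₁ :* (:- c :* τ₂ :+ :- d) :+ :- k :* z) ≈-refl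

    determinant-zero = solve 3 (λ τ₁ τ₂ z →
      con 0ℤ
      := con 0ℤ :* τ₂ :+ con 0ℤ :+ τ₁ :* (con 0ℤ :* τ₂ :+ con 0ℤ) :+ con 0ℤ :* z) ≈-refl

    determinant-z = solve 3 (λ τ₁ τ₂ z →
      z
      := con 0ℤ :* τ₂ :+ con 0ℤ :+ τ₁ :* (con 0ℤ :* τ₂ :+ con 0ℤ) :+ con 1ℤ :* z) ≈-refl

    determinant-product = solve 7 (λ a b c d τ₁ τ₂ z →
      (a :* τ₂ :+ b) :+ τ₁ :* (c :* τ₂ :+ d)
      := a :* τ₂ :+ b :+ τ₁ :* (c :* τ₂ :+ d) :+ con 0ℤ :* z) ≈-refl

  -- The action of ω on Λ_z and the splitting it yields.

  module Extension
    (torsionFree : TorsionFree)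
    (τ₁ τ₂ z : Carrier) (independent₁ : Independent τ₁) (independent₂ : Independent τ₂)
    (n h₁ h₂ A₁ B₁ C₁ A₂ B₂ C₂ r k₀ k₁ k₂ k₃ : ℤ)
    (n≢0 : n ≢ 0ℤ) (h₁≢0 : h₁ ≢ 0ℤ) (h₂≢0 : h₂ ≢ 0ℤ) (A₁≢0 : A₁ ≢ 0ℤ) (A₂≢0 : A₂ ≢ 0ℤ)
    (root₁ : ι A₁ * (τ₁ * τ₁) + ι B₁ * τ₁ + ι C₁ ≈ 0#)
    (root₂ : ι A₂ * (τ₂ * τ₂) + ι B₂ * τ₂ + ι C₂ ≈ 0#)
    (η-eq  : ι h₂ * ι A₁ * τ₁ ≈ ι h₁ * ι A₂ * τ₂ + ι r)
    (nz-eq : ι n * z ≈ ι k₀ * τ₂ + ι k₁ + τ₁ * (ι k₂ * τ₂ + ι k₃))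
    where

    open Identities

    private
      -- Write nz = l + τ₁l′ with l, l′ in L₂. As (η + h₂B₁)τ₁ = -h₂C₁, one has s = (η + h₂B₁)l -
      -- h₂C₁l′ and t = -(h₂A₁l + ηl′). Both lie in L₂, since η = h₁A₂τ₂ + r multiplies L₂ into
      -- itself.
      s₀ s₁ t₀ t₁ : ℤ
      s₀ = (r ℤ.- h₁ ℤ.* B₂) ℤ.* k₀ ℤ.+ h₁ ℤ.* A₂ ℤ.* k₁ ℤ.+ h₂ ℤ.* B₁ ℤ.* k₀ ℤ.- h₂ ℤ.* C₁ ℤ.* k₂
      s₁ = r ℤ.* k₁ ℤ.- h₁ ℤ.* C₂ ℤ.* k₀ ℤ.+ h₂ ℤ.* B₁ ℤ.* k₁ ℤ.- h₂ ℤ.* C₁ ℤ.* k₃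
      t₀ = ℤ.- (h₂ ℤ.* A₁ ℤ.* k₀ ℤ.+ ((r ℤ.- h₁ ℤ.* B₂) ℤ.* k₂ ℤ.+ h₁ ℤ.* A₂ ℤ.* k₃))
      t₁ = ℤ.- (h₂ ℤ.* A₁ ℤ.* k₁ ℤ.+ (r ℤ.* k₃ ℤ.- h₁ ℤ.* C₂ ℤ.* k₂))

      open Action n h₁ h₂ A₁ B₁ C₁ A₂ B₂ C₂ r s₀ s₁ t₀ t₁

    η ω : Carrier
    η = ι h₂ * ι A₁ * τ₁
    ω = ι n * η

    private
      η-rel : η - (ι h₁ * ι A₂ * τ₂ + ι r) ≈ 0#
      η-rel = x≈y⇒x-y≈0 η-eq

      ι-s₀ = ι-poly 10 (λ r h₁ B₂ k₀ A₂ k₁ h₂ B₁ C₁ k₂ →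
        (r :- h₁ :* B₂) :* k₀ :+ h₁ :* A₂ :* k₁ :+ h₂ :* B₁ :* k₀ :- h₂ :* C₁ :* k₂)

      ι-s₁ = ι-poly 9 (λ r k₁ h₁ C₂ k₀ h₂ B₁ C₁ k₃ → r :* k₁ :- h₁ :* C₂ :* k₀ :+ h₂ :* B₁ :* k₁ :- h₂ :* C₁ :* k₃)

      ι-t₀ = ι-poly 9 (λ h₂ A₁ k₀ r h₁ B₂ k₂ A₂ k₃ → :- (h₂ :* A₁ :* k₀ :+ ((r :- h₁ :* B₂) :* k₂ :+ h₁ :* A₂ :* k₃)))

      ι-t₁ = ι-poly 8 (λ h₂ A₁ k₁ r k₃ h₁ C₂ k₂ → :- (h₂ :* A₁ :* k₁ :+ (r :* k₃ :- h₁ :* C₂ :* k₂)))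

      s-value : ι s₀ * τ₂ + ι s₁ ≈ (η + ι h₂ * ι B₁) * (ι n * z)
      s-value = ≈-trans
        (+-cong (*-congʳ (ι-s₀ r h₁ B₂ k₀ A₂ k₁ h₂ B₁ C₁ k₂)) (ι-s₁ r k₁ h₁ C₂ k₀ h₂ B₁ C₁ k₃))
        (≈-trans
          (modulo₃ _ _ _ root₁ root₂ η-rel
            (s-identity (ι h₁) (ι h₂) (ι A₁) (ι B₁) (ι C₁) (ι A₂) (ι B₂) (ι C₂) (ι r) (ι k₀) (ι k₁) (ι k₂) (ι k₃) τ₁ τ₂))
          (*-congˡ (≈-sym nz-eq)))

      t-value : ι t₀ * τ₂ + ι t₁ ≈ - (ι h₂ * ι A₁ * (ι n * z))
      t-value = ≈-trans
        (+-cong (*-congʳ (ι-t₀ h₂ A₁ k₀ r h₁ B₂ k₂ A₂ k₃)) (ι-t₁ h₂ A₁ k₁ r k₃ h₁ C₂ k₂))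
        (≈-trans
          (modulo₂ _ _ root₂ η-rel
            (t-identity (ι h₁) (ι h₂) (ι A₁) (ι A₂) (ι B₂) (ι C₂) (ι r) (ι k₀) (ι k₁) (ι k₂) (ι k₃) τ₁ τ₂))
          (-‿cong (*-congˡ (≈-sym nz-eq))))

    vec₀ vec₁ : ℤ⁴ → Carrier
    vec₀ ⟨ a , b , c , d ⟩ = ι a * τ₂ + ι b + ι c * z
    vec₁ ⟨ a , b , c , d ⟩ = ι c * τ₁ + ι d

    private
      vec-injective : ∀ {a b c d} → vec₀ ⟨ a , b , c , d ⟩ ≈ 0# → vec₁ ⟨ a , b , c , d ⟩ ≈ 0# →
        ⟨ a , b , c , d ⟩ ≡ ⟨ 0ℤ , 0ℤ , 0ℤ , 0ℤ ⟩
      vec-injective {a} {b} {c} {d} eq₀ eq₁ with independent₁ c d eq₁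
      ... | ≡.refl , ≡.refl with independent₂ a b (≈-trans (≈-sym (≈-trans (+-congˡ 0z≈0) (+-identityʳ _))) eq₀)
        where
        0z≈0 : ι 0ℤ * z ≈ 0#
        0z≈0 = ≈-trans (*-congʳ 0#-homo) (zeroˡ z)
      ...   | ≡.refl , ≡.refl = ≡.refl

      ι-W₀ = ι-poly 11 (λ n r h₁ B₂ a A₂ b c s₀ d t₀ →
        n :* ((r :- h₁ :* B₂) :* a :+ h₁ :* A₂ :* b) :+ (c :* s₀ :+ d :* t₀))

      ι-W₁ = ι-poly 10 (λ n r b h₁ C₂ a c s₁ d t₁ → n :* (r :* b :- h₁ :* C₂ :* a) :+ (c :* s₁ :+ d :* t₁))

      ι-W₂ = ι-poly 6 (λ n h₂ A₁ d B₁ c → n :* h₂ :* (A₁ :* d :- B₁ :* c))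

      ι-W₃ = ι-poly 4 (λ n h₂ C₁ c → :- (n :* h₂ :* C₁ :* c))

      vec₀-W : ∀ u → vec₀ (W u) ≈ ω * vec₀ u
      vec₀-W ⟨ a , b , c , d ⟩ = ≈-trans
        (+-cong (+-cong (*-congʳ (ι-W₀ n r h₁ B₂ a A₂ b c s₀ d t₀)) (ι-W₁ n r b h₁ C₂ a c s₁ d t₁)) (*-congʳ (ι-W₂ n h₂ A₁ d B₁ c)))
        (modulo₄ _ _ _ _ root₂ η-rel (x≈y⇒x-y≈0 s-value) (x≈y⇒x-y≈0 t-value)
          (W₀-identity (ι n) (ι h₁) (ι h₂) (ι A₁) (ι B₁) (ι A₂) (ι B₂) (ι C₂) (ι r) (ι s₀) (ι s₁) (ι t₀) (ι t₁) τ₁ τ₂ z (ι a) (ι b) (ι c) (ι d)))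

      vec₁-W : ∀ u → vec₁ (W u) ≈ ω * vec₁ u
      vec₁-W ⟨ a , b , c , d ⟩ = ≈-trans
        (+-cong (*-congʳ (ι-W₂ n h₂ A₁ d B₁ c)) (ι-W₃ n h₂ C₁ c))
        (modulo₁ _ root₁ (W₁-identity (ι n) (ι h₂) (ι A₁) (ι B₁) (ι C₁) τ₁ (ι c) (ι d)))

      -- Minus the trace, and the norm, of ω: the equation of τ₁ rescaled to a monic one for n h₂ A₁
      -- τ₁.
      T N : ℤ
      T = n ℤ.* h₂ ℤ.* B₁
      N = n ℤ.* h₂ ℤ.* (n ℤ.* h₂) ℤ.* A₁ ℤ.* C₁

      ι-T = ι-poly 3 (λ n h₂ B₁ → n :* h₂ :* B₁)

      ι-N = ι-poly 4 (λ n h₂ A₁ C₁ → n :* h₂ :* (n :* h₂) :* A₁ :* C₁)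

      ω-quadratic : ω * ω + ι T * ω + ι N ≈ 0#
      ω-quadratic = ≈-trans (+-cong (+-congˡ (*-congʳ (ι-T n h₂ B₁))) (ι-N n h₂ A₁ C₁))
        (≈-trans (ω-identity (ι n) (ι h₂) (ι A₁) (ι B₁) (ι C₁) τ₁) (multiple≈0 _ root₁))

      ι-combine = ι-poly 5 (λ T N x y u → x :+ T :* y :+ N :* u)

      vec₀-combine : ∀ T N x y u → vec₀ (combine T N x y u) ≈ vec₀ x + ι T * vec₀ y + ι N * vec₀ u
      vec₀-combine T N ⟨ x₀ , x₁ , x₂ , x₃ ⟩ ⟨ y₀ , y₁ , y₂ , y₃ ⟩ ⟨ u₀ , u₁ , u₂ , u₃ ⟩ = ≈-trans
        (+-cong (+-cong (*-congʳ (ι-combine T N x₀ y₀ u₀)) (ι-combine T N x₁ y₁ u₁)) (*-congʳ (ι-combine T N x₂ y₂ u₂)))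
        (combine-vec₀-identity (ι T) (ι N) (ι x₀) (ι x₁) (ι x₂) (ι y₀) (ι y₁) (ι y₂) (ι u₀) (ι u₁) (ι u₂) τ₂ z)

      vec₁-combine : ∀ T N x y u → vec₁ (combine T N x y u) ≈ vec₁ x + ι T * vec₁ y + ι N * vec₁ u
      vec₁-combine T N ⟨ x₀ , x₁ , x₂ , x₃ ⟩ ⟨ y₀ , y₁ , y₂ , y₃ ⟩ ⟨ u₀ , u₁ , u₂ , u₃ ⟩ = ≈-trans
        (+-cong (*-congʳ (ι-combine T N x₂ y₂ u₂)) (ι-combine T N x₃ y₃ u₃))
        (combine-vec₁-identity (ι T) (ι N) (ι x₂) (ι x₃) (ι y₂) (ι y₃) (ι u₂) (ι u₃) τ₁)

      -- The relation is checked in R instead of by squaring an integer matrix: both coordinates of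
      -- the corresponding period are multiples of ω² + Tω + N, and periods determine their integer
      -- coordinates.
      W-quadratic : ∀ u → combine T N (W (W u)) (W u) u ≡ ⟨ 0ℤ , 0ℤ , 0ℤ , 0ℤ ⟩
      W-quadratic u = vec-injective
        (vanishes vec₀ (vec₀-combine T N (W (W u)) (W u) u) (vec₀-W u) (vec₀-W (W u)))
        (vanishes vec₁ (vec₁-combine T N (W (W u)) (W u) u) (vec₁-W u) (vec₁-W (W u)))
        where
        vanishes : (vec : ℤ⁴ → Carrier) →
          vec (combine T N (W (W u)) (W u) u) ≈ vec (W (W u)) + ι T * vec (W u) + ι N * vec u →
          vec (W u) ≈ ω * vec u → vec (W (W u)) ≈ ω * vec (W u) → vec (combine T N (W (W u)) (W u) u) ≈ 0#
        vanishes vec eq eq₁ eq₂ = begin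
          vec (combine T N (W (W u)) (W u) u)                    ≈⟨ eq ⟩
          vec (W (W u)) + ι T * vec (W u) + ι N * vec u          ≈⟨ +-congʳ (+-cong (≈-trans eq₂ (*-congˡ eq₁)) (*-congˡ eq₁)) ⟩
          ω * (ω * vec u) + ι T * (ω * vec u) + ι N * vec u      ≈⟨ quadratic-action-identity ω (ι T) (ι N) (vec u) ⟩
          vec u * (ω * ω + ι T * ω + ι N)                        ≈⟨ multiple≈0 (vec u) ω-quadratic ⟩
          0#                                                     ∎

      ι-∙ = ι-poly 8 (λ g₀ g₁ g₂ g₃ a b c d → g₀ :* a :+ g₁ :* b :+ g₂ :* c :+ g₃ :* d)

      ι-+* : ∀ x T y → ι (x ℤ.+ T ℤ.* y) ≈ ι x + ι T * ι y
      ι-+* = ι-poly 3 (λ x T y → x :+ T :* y)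

      -- The trace of η is -h₂B₁ by the equation of τ₁ and 2r - h₁B₂ by that of τ₂. Subtracting the
      -- two quadratic equations for η leaves κη + δ = 0, and η = h₂A₁τ₁ is independent of 1.
      trace≡0 : r ℤ.+ r ℤ.- h₁ ℤ.* B₂ ℤ.+ h₂ ℤ.* B₁ ≡ 0ℤ
      trace≡0 = [ (λ κ≡0 → κ≡0) , (λ h₂A₁≡0 → contradiction h₂A₁≡0 (*-≢0 h₂≢0 A₁≢0)) ]′
        (ℤ.i*j≡0⇒i≡0∨j≡0 κ (proj₁ (independent₁ (κ ℤ.* (h₂ ℤ.* A₁)) δ dependence)))
        where
        κ δ : ℤ
        κ = r ℤ.+ r ℤ.- h₁ ℤ.* B₂ ℤ.+ h₂ ℤ.* B₁
        δ = h₂ ℤ.* h₂ ℤ.* A₁ ℤ.* C₁ ℤ.- h₁ ℤ.* h₁ ℤ.* A₂ ℤ.* C₂ ℤ.- r ℤ.* r ℤ.+ r ℤ.* h₁ ℤ.* B₂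
        ι-κ = ι-poly 6 (λ r h₁ B₂ h₂ B₁ A₁ → (r :+ r :- h₁ :* B₂ :+ h₂ :* B₁) :* (h₂ :* A₁))
        ι-δ = ι-poly 8 (λ h₂ A₁ C₁ h₁ A₂ C₂ r B₂ →
          h₂ :* h₂ :* A₁ :* C₁ :- h₁ :* h₁ :* A₂ :* C₂ :- r :* r :+ r :* h₁ :* B₂)
        dependence : ι (κ ℤ.* (h₂ ℤ.* A₁)) * τ₁ + ι δ ≈ 0#
        dependence = ≈-trans (+-cong (*-congʳ (ι-κ r h₁ B₂ h₂ B₁ A₁)) (ι-δ h₂ A₁ C₁ h₁ A₂ C₂ r B₂))
          (≈-trans
            (modulo₃ _ _ _ root₁ root₂ η-rel
              (trace-identity (ι h₁) (ι h₂) (ι A₁) (ι B₁) (ι C₁) (ι A₂) (ι B₂) (ι C₂) (ι r) τ₁ τ₂))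
            0#-homo)

      module _
        (order : ∀ p → Prime p → + p ∣ n → ∀ x y → Rank₂ τ₂ x → Rank₂ τ₂ y → ¬ ι n * z ≈ ι (+ p) * (x + τ₁ * y))
        (coprime    : NoCommonPrime (h₁ ∷ h₂ ∷ []))
        (primitive₁ : NoCommonPrime (A₁ ∷ B₁ ∷ C₁ ∷ []))
        (primitive₂ : NoCommonPrime (A₂ ∷ B₂ ∷ C₂ ∷ []))
        where

        private
          l l′ : Carrier
          l  = ι k₀ * τ₂ + ι k₁
          l′ = ι k₂ * τ₂ + ι k₃

          l∈ : Rank₂ τ₂ l
          l∈ = k₀ , k₁ , ≈-refl
          l′∈ : Rank₂ τ₂ l′
          l′∈ = k₂ , k₃ , ≈-refl

          scale-neg : ∀ {x} k → Rank₂ τ₂ x → Rank₂ τ₂ (- ι k * x)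
          scale-neg k x∈ = let a′ , b′ , eq = rank₂-scale (ℤ.- k) x∈ in a′ , b′ , ≈-trans (*-congʳ (≈-sym (-‿homo k))) eq

          ι-bézout₂ = ι-poly 4 (λ u h w p → u :* h :+ w :* p)

          ι-bézout₃ = ι-poly 6 (λ u A v B w C → u :* A :+ (v :* B :+ (w :* C :+ con 0ℤ)))

        -- Let s = pS and t = pT′. Then h₂A₁nz = -pT′, h₂B₁nz = p(S + τ₁T′) and h₂C₁nz = -pτ₁S.
        -- Bézout for (A₁ , B₁ , C₁) puts h₂nz into p L₁L₂, and Bézout for (h₂ , p) removes h₂.
        coprime-case : ∀ {p} → Prime p → ¬ + p ∣ h₂ → + p ∣ s₀ → + p ∣ s₁ → + p ∣ t₀ → + p ∣ t₁ →
          ∃₂ λ x y → Rank₂ τ₂ x × Rank₂ τ₂ y × ι n * z ≈ ι (+ p) * (x + τ₁ * y)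
        coprime-case {p} p-prime p∤h₂ p∣s₀ p∣s₁ p∣t₀ p∣t₁ = divided
          (noCommonPrime⇒unimodular (A₁ ∷ B₁ ∷ C₁ ∷ []) primitive₁) (inverse-mod h₂ p-prime p∤h₂)
          (rank₂-divide p∣s₀ p∣s₁) (rank₂-divide p∣t₀ p∣t₁)
          where
          divided : (∃ λ us → dot us (A₁ ∷ B₁ ∷ C₁ ∷ []) ≡ 1ℤ) → (∃₂ λ u′ w′ → u′ ℤ.* h₂ ℤ.+ w′ ℤ.* + p ≡ 1ℤ) →
            (∃ λ S → Rank₂ τ₂ S × ι s₀ * τ₂ + ι s₁ ≈ ι (+ p) * S) → (∃ λ T′ → Rank₂ τ₂ T′ × ι t₀ * τ₂ + ι t₁ ≈ ι (+ p) * T′) →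
            ∃₂ λ x y → Rank₂ τ₂ x × Rank₂ τ₂ y × ι n * z ≈ ι (+ p) * (x + τ₁ * y)
          divided (u ∷ v ∷ w ∷ [] , uA+vB+wC≡1) (u′ , w′ , u′h+w′p≡1) (S , S∈ , s≈pS) (T′ , T∈ , t≈pT) =
              ι u′ * (- ι u * T′ + ι v * S) + ι w′ * l
            , ι u′ * (ι v * T′ + - ι w * S) + ι w′ * l′
            , rank₂-+ (rank₂-scale u′ (rank₂-+ (scale-neg u T∈) (rank₂-scale v S∈))) (rank₂-scale w′ l∈)
            , rank₂-+ (rank₂-scale u′ (rank₂-+ (rank₂-scale v T∈) (scale-neg w S∈))) (rank₂-scale w′ l′∈)
            , ≈-trans nz-eq (modulo₅ _ _ _ _ _
                (x≈y⇒x-y≈0 (≈-trans (≈-sym t≈pT) (≈-trans t-value (-‿cong (*-congˡ nz-eq)))))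
                (x≈y⇒x-y≈0 (≈-trans (≈-sym s≈pS) (≈-trans s-value (*-congˡ nz-eq))))
                root₁
                (x≈y⇒x-y≈0 (≈-trans (≈-sym (ι-bézout₂ u′ h₂ w′ (+ p))) (ι-cong u′h+w′p≡1)))
                (x≈y⇒x-y≈0 (≈-trans (≈-sym (ι-bézout₃ u A₁ v B₁ w C₁)) (ι-cong uA+vB+wC≡1)))
                (coprime-case-identity (ι (+ p)) (ι h₂) (ι A₁) (ι B₁) (ι C₁) τ₁ S T′ (ι u) (ι v) (ι w) (ι u′) (ι w′) l l′))

        private
          η-decompose : ∀ {p} k k′ m₀ m₁ →
            + p ∣ k ℤ.- ((r ℤ.- h₁ ℤ.* B₂) ℤ.* m₀ ℤ.+ h₁ ℤ.* A₂ ℤ.* m₁) → + p ∣ k′ ℤ.- (r ℤ.* m₁ ℤ.- h₁ ℤ.* C₂ ℤ.* m₀) →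
            ∃ λ e → Rank₂ τ₂ e × ι k * τ₂ + ι k′ ≈ (ι h₁ * ι A₂ * τ₂ + ι r) * (ι m₀ * τ₂ + ι m₁) + ι (+ p) * e
          η-decompose k k′ m₀ m₁ p∣₀ p∣₁ = let e , e∈ , eq = rank₂-divide {τ₂} p∣₀ p∣₁ in e , e∈ , ≈-trans
            (modulo₁ _ root₂ (identity (ι h₁) (ι A₂) (ι B₂) (ι C₂) (ι r) τ₂ (ι k) (ι k′) (ι m₀) (ι m₁)))
            (+-congˡ (≈-trans (≈-sym (+-cong (*-congʳ (ι-₀ k r h₁ B₂ m₀ A₂ m₁)) (ι-₁ k′ r m₁ h₁ C₂ m₀))) eq))
            where
            ι-₀ = ι-poly 7 (λ k r h₁ B₂ m₀ A₂ m₁ → k :- ((r :- h₁ :* B₂) :* m₀ :+ h₁ :* A₂ :* m₁))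
            ι-₁ = ι-poly 6 (λ k′ r m₁ h₁ C₂ m₀ → k′ :- (r :* m₁ :- h₁ :* C₂ :* m₀))
            identity = solve 10 (λ h A B C r τ k k′ m₀ m₁ →
              (k :* τ :+ k′) :- ((h :* A :* τ :+ r) :* (m₀ :* τ :+ m₁)
                :+ ((k :- ((r :- h :* B) :* m₀ :+ h :* A :* m₁)) :* τ :+ (k′ :- (r :* m₁ :- h :* C :* m₀))))
              := :- (h :* m₀) :* (A :* (τ :* τ) :+ B :* τ :+ C)) ≈-refl

        -- Now s ≡ ηl and t ≡ -ηl′ mod p, so l and l′ lie in the kernel of η on L₂/p and hence in
        -- its image: l = ηm + pe, l′ = ηm′ + pe′. With h₂ = hp one has η = phA₁τ₁, so η(m + τ₁m′)
        -- lies in p L₁L₂ after A₁τ₁² is replaced by -B₁τ₁ - C₁.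
        divisible-case : ∀ {p} → Prime p → + p ∣ h₂ → + p ∣ s₀ → + p ∣ s₁ → + p ∣ t₀ → + p ∣ t₁ →
          ∃₂ λ x y → Rank₂ τ₂ x × Rank₂ τ₂ y × ι n * z ≈ ι (+ p) * (x + τ₁ * y)
        divisible-case {p} p-prime p∣h₂@(divides h h₂≡hp) p∣s₀ p∣s₁ p∣t₀ p∣t₁ =
          let m₀  , m₁  , p∣m₀  , p∣m₁  = kernel⊆image k₀ k₁
                (∣-combine₂ 1ℤ (C₁ ℤ.* k₂ ℤ.- B₁ ℤ.* k₀) (s₀-mod-h₂ r h₁ B₂ k₀ A₂ k₁ h₂ B₁ C₁ k₂) p∣s₀ p∣h₂)
                (∣-combine₂ 1ℤ (C₁ ℤ.* k₃ ℤ.- B₁ ℤ.* k₁) (s₁-mod-h₂ r k₁ h₁ C₂ k₀ h₂ B₁ C₁ k₃) p∣s₁ p∣h₂)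
              m₀′ , m₁′ , p∣m₀′ , p∣m₁′ = kernel⊆image k₂ k₃
                (∣-combine₂ (ℤ.- 1ℤ) (ℤ.- (A₁ ℤ.* k₀)) (t-mod-h₂ h₂ A₁ k₀ ((r ℤ.- h₁ ℤ.* B₂) ℤ.* k₂ ℤ.+ h₁ ℤ.* A₂ ℤ.* k₃)) p∣t₀ p∣h₂)
                (∣-combine₂ (ℤ.- 1ℤ) (ℤ.- (A₁ ℤ.* k₁)) (t-mod-h₂ h₂ A₁ k₁ (r ℤ.* k₃ ℤ.- h₁ ℤ.* C₂ ℤ.* k₂)) p∣t₁ p∣h₂)
              e  , e∈  , l≈  = η-decompose k₀ k₁ m₀ m₁ p∣m₀ p∣m₁
              e′ , e′∈ , l′≈ = η-decompose k₂ k₃ m₀′ m₁′ p∣m₀′ p∣m₁′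
              m  = ι m₀ * τ₂ + ι m₁
              m′ = ι m₀′ * τ₂ + ι m₁′
              m∈ : Rank₂ τ₂ m
              m∈ = m₀ , m₁ , ≈-refl
              m′∈ : Rank₂ τ₂ m′
              m′∈ = m₀′ , m₁′ , ≈-refl
          in e + - (ι h * ι C₁) * m′
           , (ι h * ι A₁) * m + (e′ + - (ι h * ι B₁) * m′)
           , rank₂-+ e∈ (scale-product-neg h C₁ m′∈)
           , rank₂-+ (scale-product h A₁ m∈) (rank₂-+ e′∈ (scale-product-neg h B₁ m′∈))
           , ≈-trans nz-eq (≈-trans (+-cong l≈ (*-congˡ l′≈)) (modulo₂ _ _ root₁
               (≈-trans (+-congʳ (*-congʳ (*-congʳ (≈-sym ι-h₂)))) η-rel)
               (divisible-case-identity (ι (+ p)) (ι h) (ι A₁) (ι B₁) (ι C₁) τ₁ τ₂ (ι h₁) (ι A₂) (ι r) m m′ e e′)))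
          where
          open NilpotentModP p-prime h₁ A₂ B₂ C₂ r (h₂ ℤ.* B₁)
            (λ p∣h₁ → coprime p p-prime (p∣h₁ ∷ p∣h₂ ∷ [])) primitive₂ trace≡0 (∣m⇒∣m*n B₁ p∣h₂)
          ι-h₂ : ι h₂ ≈ ι h * ι (+ p)
          ι-h₂ = ≈-trans (ι-cong h₂≡hp) (*-homo h (+ p))
          scale-product : ∀ a b {x} → Rank₂ τ₂ x → Rank₂ τ₂ ((ι a * ι b) * x)
          scale-product a b x∈ = let c , d , eq = rank₂-scale (a ℤ.* b) x∈ in c , d , ≈-trans (*-congʳ (≈-sym (*-homo a b))) eq
          scale-product-neg : ∀ a b {x} → Rank₂ τ₂ x → Rank₂ τ₂ (- (ι a * ι b) * x)
          scale-product-neg a b x∈ = let c , d , eq = scale-neg (a ℤ.* b) x∈ in c , d , ≈-trans (*-congʳ (-‿cong (≈-sym (*-homo a b)))) eq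

        nonsplit : NoCommonPrime (n ∷ s₀ ∷ s₁ ∷ t₀ ∷ t₁ ∷ [])
        nonsplit p p-prime (p∣n ∷ p∣s₀ ∷ p∣s₁ ∷ p∣t₀ ∷ p∣t₁ ∷ []) =
          let x , y , x∈ , y∈ , eq = divided (+ p ∣? h₂) in order p p-prime p∣n x y x∈ y∈ eq
          where
          divided : Dec (+ p ∣ h₂) → ∃₂ λ x y → Rank₂ τ₂ x × Rank₂ τ₂ y × ι n * z ≈ ι (+ p) * (x + τ₁ * y)
          divided (yes p∣h₂) = divisible-case p-prime p∣h₂ p∣s₀ p∣s₁ p∣t₀ p∣t₁
          divided (no p∤h₂)  = coprime-case p-prime p∤h₂ p∣s₀ p∣s₁ p∣t₀ p∣t₁

      module Functional (g : ℤ⁴) where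

        g′ : ℤ⁴
        g′ = transposed T g

        open ℤ⁴ g public using () renaming (x₀ to g₀; x₁ to g₁; x₂ to g₂; x₃ to g₃)
        open ℤ⁴ g′ public using () renaming (x₀ to g₀′; x₁ to g₁′; x₂ to g₂′; x₃ to g₃′)

        φ₀ φ₁ φ₂ φ₃ : Carrier
        φ₀ = ι g₀′ + ω * ι g₀
        φ₁ = ι g₁′ + ω * ι g₁
        φ₂ = ι g₂′ + ω * ι g₂
        φ₃ = ι g₃′ + ω * ι g₃

        Φ : ℤ⁴ → Carrier
        Φ ⟨ a , b , c , d ⟩ = ι a * φ₀ + ι b * φ₁ + ι c * φ₂ + ι d * φ₃

        Φ-value : ∀ u → Φ u ≈ ι (g ∙ W u) + ι T * ι (g ∙ u) + ω * ι (g ∙ u)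
        Φ-value u@(⟨ a , b , c , d ⟩) = begin
          Φ u
            ≈⟨ Φ-identity ω (ι g₀) (ι g₁) (ι g₂) (ι g₃) (ι g₀′) (ι g₁′) (ι g₂′) (ι g₃′) (ι a) (ι b) (ι c) (ι d) ⟩
          _ ≈⟨ +-cong (ι-∙ g₀′ g₁′ g₂′ g₃′ a b c d) (*-congˡ (ι-∙ g₀ g₁ g₂ g₃ a b c d)) ⟨
          ι (g′ ∙ u) + ω * ι (g ∙ u)
            ≈⟨ +-congʳ (≈-trans (ι-cong (transposed-∙ T g u)) (ι-+* (g ∙ W u) T (g ∙ u))) ⟩
          ι (g ∙ W u) + ι T * ι (g ∙ u) + ω * ι (g ∙ u) ∎

        -- Writing ψ for the functional g: ψ(W²u) + Tψ(Wu) = -Nψ(u) and ω(T + ω) = -N, so both sides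
        -- equal ωψ(Wu) - Nψ(u).
        Φ-W : ∀ u → Φ (W u) ≈ ω * Φ u
        Φ-W u = ≈-trans (Φ-value (W u)) (≈-trans
          (modulo₂ _ _ quadratic ω-quadratic (Φ-W-identity ω (ι T) (ι N) (ι (g ∙ W (W u))) (ι (g ∙ W u)) (ι (g ∙ u))))
          (*-congˡ (≈-sym (Φ-value u))))
          where
          quadratic : ι (g ∙ W (W u)) + ι T * ι (g ∙ W u) + ι N * ι (g ∙ u) ≈ 0#
          quadratic = begin
            ι (g ∙ W (W u)) + ι T * ι (g ∙ W u) + ι N * ι (g ∙ u)  ≈⟨ ι-combine T N (g ∙ W (W u)) (g ∙ W u) (g ∙ u) ⟨
            ι (g ∙ W (W u) ℤ.+ T ℤ.* (g ∙ W u) ℤ.+ N ℤ.* (g ∙ u))  ≈⟨ ι-cong (∙-combine T N g (W (W u)) (W u) u) ⟨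
            ι (g ∙ combine T N (W (W u)) (W u) u)                  ≈⟨ ι-cong (≡.cong (g ∙_) (W-quadratic u)) ⟩
            ι (g ∙ ⟨ 0ℤ , 0ℤ , 0ℤ , 0ℤ ⟩)                          ≈⟨ ι-cong (∙-zeroʳ g) ⟩
            ι 0ℤ                                                   ≈⟨ 0#-homo ⟩
            0#                                                     ∎

        Φ-W-expanded : ∀ a b c d →
          (ι n * ((ι r - ι h₁ * ι B₂) * ι a + ι h₁ * ι A₂ * ι b) + (ι c * ι s₀ + ι d * ι t₀)) * φ₀
            + (ι n * (ι r * ι b - ι h₁ * ι C₂ * ι a) + (ι c * ι s₁ + ι d * ι t₁)) * φ₁
            + ι n * ι h₂ * (ι A₁ * ι d - ι B₁ * ι c) * φ₂ + - (ι n * ι h₂ * ι C₁ * ι c) * φ₃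
            - ω * (ι a * φ₀ + ι b * φ₁ + ι c * φ₂ + ι d * φ₃) ≈ 0#
        Φ-W-expanded a b c d = x≈y⇒x-y≈0 (≈-trans
          (≈-sym (+-cong (+-cong (+-cong (*-congʳ (ι-W₀ n r h₁ B₂ a A₂ b c s₀ d t₀)) (*-congʳ (ι-W₁ n r b h₁ C₂ a c s₁ d t₁)))
            (*-congʳ (ι-W₂ n h₂ A₁ d B₁ c))) (*-congʳ (ι-W₃ n h₂ C₁ c))))
          (Φ-W ⟨ a , b , c , d ⟩))

        cancel : ∀ a b c {x y} → a ≢ 0ℤ → b ≢ 0ℤ → c ≢ 0ℤ → ι a * ι b * ι c * (x - y) ≈ ι 0ℤ → x ≈ y
        cancel a b c a≢0 b≢0 c≢0 eq = x-y≈0⇒x≈y _ _ (torsionFree (a ℤ.* b ℤ.* c) (*-≢0 (*-≢0 a≢0 b≢0) c≢0)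
          (≈-trans (*-congʳ (ι-product a b c)) (≈-trans eq 0#-homo)))
          where
          ι-product : ∀ a b c → ι (a ℤ.* b ℤ.* c) ≈ ι a * ι b * ι c
          ι-product = ι-poly 3 (λ a b c → a :* b :* c)

        -- ω-linearity at the column (1 , 0): there ω acts as n(h₁A₂τ₂ + r), which gives n h₁ A₂
        -- (φ₁τ₂ - φ₀) = 0, and the integer factor is cancelled.
        φ₀-value : φ₁ * τ₂ ≈ φ₀
        φ₀-value = cancel n h₁ A₂ n≢0 h₁≢0 A₂≢0
          (modulo₂ _ _ η-rel (Φ-W-expanded 0ℤ 1ℤ 0ℤ 0ℤ)
            (φ₀-identity (ι n) (ι h₁) (ι A₂) (ι B₂) (ι C₂) (ι r) (ι s₀) (ι s₁) (ι t₀) (ι t₁) (ι h₂) (ι A₁) (ι B₁) (ι C₁) τ₁ τ₂ φ₀ φ₁ φ₂ φ₃))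

        -- ω-linearity at the column (0 , 1), whose image is t plus n h₂ A₁ times the column (z ,
        -- τ₁). The value of φ at t is -φ₁ h₂ A₁ n z, and n h₂ A₁ is cancelled.
        φ₂-value : φ₁ * z + φ₃ * τ₁ ≈ φ₂
        φ₂-value = cancel n h₂ A₁ n≢0 h₂≢0 A₁≢0
          (modulo₃ _ _ _ (x≈y⇒x-y≈0 (≈-sym φ₀-value)) (x≈y⇒x-y≈0 t-value) (Φ-W-expanded 0ℤ 0ℤ 0ℤ 1ℤ)
            (φ₂-identity (ι n) (ι h₁) (ι A₂) (ι B₂) (ι C₂) (ι r) (ι s₀) (ι s₁) (ι t₀) (ι t₁) (ι h₂) (ι A₁) (ι B₁) (ι C₁) τ₁ τ₂ z φ₀ φ₁ φ₂ φ₃))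

        Φ-vec : ∀ u → Φ u ≈ φ₁ * vec₀ u + φ₃ * vec₁ u
        Φ-vec ⟨ a , b , c , d ⟩ = ≈-trans
          (+-congʳ (+-cong (+-congʳ (*-congˡ (≈-sym φ₀-value))) (*-congˡ (≈-sym φ₂-value))))
          (Φ-vec-identity φ₁ φ₃ τ₁ τ₂ z (ι a) (ι b) (ι c) (ι d))

        Φ≈1 : ∀ v → g ∙ v ≡ 0ℤ → g ∙ W v ≡ 1ℤ → φ₁ * vec₀ v + φ₃ * vec₁ v ≈ 1#
        Φ≈1 v g∙v≡0 g∙Wv≡1 = begin
          φ₁ * vec₀ v + φ₃ * vec₁ v                             ≈⟨ Φ-vec v ⟨
          Φ v                                                   ≈⟨ Φ-value v ⟩
          ι (g ∙ W v) + ι T * ι (g ∙ v) + ω * ι (g ∙ v)         ≈⟨ +-cong (+-cong (ι-cong g∙Wv≡1) (*-congˡ (ι-cong g∙v≡0))) (*-congˡ (ι-cong g∙v≡0)) ⟩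
          ι 1ℤ + ι T * ι 0ℤ + ω * ι 0ℤ                          ≈⟨ identity (ι T) ω ⟩
          ι 1ℤ                                                  ≈⟨ 1#-homo ⟩
          1#                                                    ∎
          where
          identity : ∀ t w → ι 1ℤ + t * ι 0ℤ + w * ι 0ℤ ≈ ι 1ℤ
          identity = solve 2 (λ t w → con 1ℤ :+ t :* con 0ℤ :+ w :* con 0ℤ := con 1ℤ) ≈-refl

    Periods : Carrier → Carrier → Set
    Periods x y = ∃ λ u → x ≈ vec₀ u × y ≈ vec₁ u

    periods-combine : ∀ {x y x′ y′ x″ y″} T N → Periods x y → Periods x′ y′ → Periods x″ y″ →
      Periods (x + ι T * x′ + ι N * x″) (y + ι T * y′ + ι N * y″)
    periods-combine T N (u , x≈ , y≈) (u′ , x′≈ , y′≈) (u″ , x″≈ , y″≈) = combine T N u u′ u″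
      , ≈-trans (+-cong (+-cong x≈ (*-congˡ x′≈)) (*-congˡ x″≈)) (≈-sym (vec₀-combine T N u u′ u″))
      , ≈-trans (+-cong (+-cong y≈ (*-congˡ y′≈)) (*-congˡ y″≈)) (≈-sym (vec₁-combine T N u u′ u″))

    periods-resp : ∀ {x y x′ y′} → x ≈ x′ → y ≈ y′ → Periods x y → Periods x′ y′
    periods-resp x≈x′ y≈y′ (u , x≈ , y≈) = u , ≈-trans (≈-sym x≈x′) x≈ , ≈-trans (≈-sym y≈y′) y≈

    -- An accumulating form: a ℤ[ω]-multiple is added to a running total, so that sums of several
    -- multiples are obtained by nesting.
    periods-+-scale : ∀ {α x y x′ y′} → Rank₂ ω α → Periods x y → Periods x′ y′ → Periods (x + α * x′) (y + α * y′)
    periods-+-scale {α} {x} {y} {x′} {y′} (s , t , α≈) xy∈ (u , x′≈ , y′≈) = periods-resp (value x vec₀ (vec₀-W u) x′≈) (value y vec₁ (vec₁-W u) y′≈)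
      (periods-combine s t xy∈ (W u , ≈-refl , ≈-refl) (u , ≈-refl , ≈-refl))
      where
      identity : ∀ x s t ω x′ → x + s * (ω * x′) + t * x′ ≈ x + (s * ω + t) * x′
      identity = solve 5 (λ x s t ω x′ → x :+ s :* (ω :* x′) :+ t :* x′ := x :+ (s :* ω :+ t) :* x′) ≈-refl
      value : ∀ x {x′} (vec : ℤ⁴ → Carrier) → vec (W u) ≈ ω * vec u → x′ ≈ vec u →
        x + ι s * vec (W u) + ι t * vec u ≈ x + α * x′
      value x {x′} vec W≈ x′≈ = ≈-trans (+-congʳ (+-congˡ (*-congˡ W≈)))
        (≈-trans (identity x (ι s) (ι t) ω (vec u)) (+-congˡ (*-cong (≈-sym α≈) (≈-sym x′≈))))

    -- The lattice L₁L₂ + ℤz, spanned by the determinants of pairs of columns of the period matrix.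
    Determinants : Carrier → Set
    Determinants δ = ∃₂ λ a b → ∃₂ λ c d → ∃ λ k → δ ≈ ι a * τ₂ + ι b + τ₁ * (ι c * τ₂ + ι d) + ι k * z

    determinants-product : ∀ {x X Y} → Rank₂ τ₂ X → Rank₂ τ₂ Y → x ≈ X + τ₁ * Y → Determinants x
    determinants-product (a , b , X≈) (c , d , Y≈) x≈ = a , b , c , d , 0ℤ
      , ≈-trans x≈ (≈-trans (+-cong X≈ (*-congˡ Y≈)) (determinant-product (ι a) (ι b) (ι c) (ι d) τ₁ τ₂ z))

    determinants-zero : Determinants (ι 0ℤ)
    determinants-zero = 0ℤ , 0ℤ , 0ℤ , 0ℤ , 0ℤ , determinant-zero τ₁ τ₂ z

    determinants-z : Determinants z
    determinants-z = 0ℤ , 0ℤ , 0ℤ , 0ℤ , 1ℤ , determinant-z τ₁ τ₂ z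

    determinants-+ : ∀ {x y} → Determinants x → Determinants y → Determinants (x + y)
    determinants-+ (a , b , c , d , k , x≈) (a′ , b′ , c′ , d′ , k′ , y≈) =
      a ℤ.+ a′ , b ℤ.+ b′ , c ℤ.+ c′ , d ℤ.+ d′ , k ℤ.+ k′ , ≈-trans (+-cong x≈ y≈)
        (≈-trans (determinant-+ (ι a) (ι b) (ι c) (ι d) (ι k) (ι a′) (ι b′) (ι c′) (ι d′) (ι k′) τ₁ τ₂ z) (≈-sym
          (+-cong (+-cong (+-cong (*-congʳ (+-homo a a′)) (+-homo b b′))
            (*-congˡ (+-cong (*-congʳ (+-homo c c′)) (+-homo d d′)))) (*-congʳ (+-homo k k′)))))

    determinants-neg : ∀ {x} → Determinants x → Determinants (- x)
    determinants-neg (a , b , c , d , k , x≈) =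
      ℤ.- a , ℤ.- b , ℤ.- c , ℤ.- d , ℤ.- k , ≈-trans (-‿cong x≈)
        (≈-trans (determinant-neg (ι a) (ι b) (ι c) (ι d) (ι k) τ₁ τ₂ z) (≈-sym
          (+-cong (+-cong (+-cong (*-congʳ (-‿homo a)) (-‿homo b))
            (*-congˡ (+-cong (*-congʳ (-‿homo c)) (-‿homo d)))) (*-congʳ (-‿homo k)))))

    determinants-resp : ∀ {x y} → x ≈ y → Determinants x → Determinants y
    determinants-resp x≈y (a , b , c , d , k , x≈) = a , b , c , d , k , ≈-trans (≈-sym x≈y) x≈

    -- The linear form φ(x , y) = px + qy takes the value 1 at v; the last four fields are its
    -- integrality at the columns (1 , 0), (0 , 1), (τ₂ , 0) and (z , τ₁).
    record Splitting : Set where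
      field
        v     : ℤ⁴
        p q   : Carrier
        unit  : p * vec₀ v + q * vec₁ v ≈ 1#
        p∈    : Rank₂ ω p
        q∈    : Rank₂ ω q
        pτ₂∈  : Rank₂ ω (p * τ₂)
        pz+qτ₁∈ : Rank₂ ω (p * z + q * τ₁)

      φ-integral : ∀ u → Rank₂ ω (p * vec₀ u + q * vec₁ u)
      φ-integral ⟨ a , b , c , d ⟩ =
        let s , t , eq = rank₂-+ (rank₂-+ (rank₂-+ (rank₂-scale a pτ₂∈) (rank₂-scale b p∈)) (rank₂-scale c pz+qτ₁∈)) (rank₂-scale d q∈)
        in s , t , ≈-trans (≈-sym (Φ-vec-identity p q τ₁ τ₂ z (ι a) (ι b) (ι c) (ι d))) eq

      det-integral : ∀ u → Determinants (vec₀ v * vec₁ u - vec₁ v * vec₀ u)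
      det-integral ⟨ a , b , c , d ⟩ = det v
        where
        minor = ι-poly 4 (λ x y z t → x :* y :- z :* t)
        identity = solve 11 (λ a b c d a′ b′ c′ d′ τ₁ τ₂ z →
          (a′ :* τ₂ :+ b′ :+ c′ :* z) :* (c :* τ₁ :+ d) :- (c′ :* τ₁ :+ d′) :* (a :* τ₂ :+ b :+ c :* z)
          := (a′ :* d :- d′ :* a) :* τ₂ :+ (b′ :* d :- d′ :* b) :+ τ₁ :* ((a′ :* c :- c′ :* a) :* τ₂ :+ (b′ :* c :- c′ :* b)) :+ (c′ :* d :- d′ :* c) :* z) ≈-refl
        det : ∀ v → Determinants (vec₀ v * vec₁ ⟨ a , b , c , d ⟩ - vec₁ v * vec₀ ⟨ a , b , c , d ⟩)
        det ⟨ a′ , b′ , c′ , d′ ⟩ = a′ ℤ.* d ℤ.- d′ ℤ.* a , b′ ℤ.* d ℤ.- d′ ℤ.* b , a′ ℤ.* c ℤ.- c′ ℤ.* a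
          , b′ ℤ.* c ℤ.- c′ ℤ.* b , c′ ℤ.* d ℤ.- d′ ℤ.* c
          , ≈-trans (identity (ι a) (ι b) (ι c) (ι d) (ι a′) (ι b′) (ι c′) (ι d′) τ₁ τ₂ z) (≈-sym
              (+-cong (+-cong (+-cong (*-congʳ (minor a′ d d′ a)) (minor b′ d d′ b))
                (*-congˡ (+-cong (*-congʳ (minor a′ c c′ a)) (minor b′ c c′ b)))) (*-congʳ (minor c′ d d′ c))))

      -- For δ = det(x , y) one has (-qδ , pδ) = φ(x)y - φ(y)x, a ℤ[ω]-combination of periods when x
      -- and y are columns; a general δ is an integer combination of such determinants.
      inverse-integral : ∀ {α δ} → Rank₂ ω α → Determinants δ → Periods (vec₀ v * α - q * δ) (vec₁ v * α + p * δ)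
      inverse-integral {α} {δ} α∈ (a , b , c , d , k , δ≈) = periods-resp value₀ value₁
        -- The terms φ(x)y - φ(y)x for the five pairs of columns with determinants τ₂, 1, τ₁τ₂, τ₁
        -- and z, collected by the value of φ in front.
        (periods-+-scale pτ₂∈ (periods-+-scale p∈ (periods-+-scale pz+qτ₁∈ (periods-+-scale q∈ (periods-+-scale α∈ zero∈ (v , ≈-refl , ≈-refl))
          (⟨ ℤ.- a , ℤ.- b , ℤ.- k , 0ℤ ⟩ , ≈-refl , ≈-refl)) (⟨ ℤ.- c , ℤ.- d , 0ℤ , k ⟩ , ≈-refl , ≈-refl))
          (⟨ 0ℤ , 0ℤ , d , b ⟩ , ≈-refl , ≈-refl)) (⟨ 0ℤ , 0ℤ , c , a ⟩ , ≈-refl , ≈-refl))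
        where
        zero∈ : Periods (vec₀ ⟨ 0ℤ , 0ℤ , 0ℤ , 0ℤ ⟩) (vec₁ ⟨ 0ℤ , 0ℤ , 0ℤ , 0ℤ ⟩)
        zero∈ = ⟨ 0ℤ , 0ℤ , 0ℤ , 0ℤ ⟩ , ≈-refl , ≈-refl
        identity₀ = solve 12 (λ a b c d k p q v₀ α τ₁ τ₂ z →
          (con 0ℤ :* τ₂ :+ con 0ℤ :+ con 0ℤ :* z) :+ α :* v₀ :+ q :* (:- a :* τ₂ :+ :- b :+ :- k :* z) :+ (p :* z :+ q :* τ₁) :* (:- c :* τ₂ :+ :- d :+ con 0ℤ :* z)
            :+ p :* (con 0ℤ :* τ₂ :+ con 0ℤ :+ d :* z) :+ p :* τ₂ :* (con 0ℤ :* τ₂ :+ con 0ℤ :+ c :* z)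
          := v₀ :* α :- q :* (a :* τ₂ :+ b :+ τ₁ :* (c :* τ₂ :+ d) :+ k :* z)) ≈-refl
        identity₁ = solve 12 (λ a b c d k p q v₁ α τ₁ τ₂ z →
          (con 0ℤ :* τ₁ :+ con 0ℤ) :+ α :* v₁ :+ q :* (:- k :* τ₁ :+ con 0ℤ) :+ (p :* z :+ q :* τ₁) :* (con 0ℤ :* τ₁ :+ k)
            :+ p :* (d :* τ₁ :+ b) :+ p :* τ₂ :* (c :* τ₁ :+ a)
          := v₁ :* α :+ p :* (a :* τ₂ :+ b :+ τ₁ :* (c :* τ₂ :+ d) :+ k :* z)) ≈-refl
        value₀ : vec₀ ⟨ 0ℤ , 0ℤ , 0ℤ , 0ℤ ⟩ + α * vec₀ v + q * vec₀ ⟨ ℤ.- a , ℤ.- b , ℤ.- k , 0ℤ ⟩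
          + (p * z + q * τ₁) * vec₀ ⟨ ℤ.- c , ℤ.- d , 0ℤ , k ⟩ + p * vec₀ ⟨ 0ℤ , 0ℤ , d , b ⟩ + p * τ₂ * vec₀ ⟨ 0ℤ , 0ℤ , c , a ⟩
          ≈ vec₀ v * α - q * δ
        value₀ = ≈-trans
          (+-congʳ (+-congʳ (+-cong (+-congˡ (*-congˡ (+-cong (+-cong (*-congʳ (-‿homo a)) (-‿homo b)) (*-congʳ (-‿homo k)))))
            (*-congˡ (+-congʳ (+-cong (*-congʳ (-‿homo c)) (-‿homo d)))))))
          (≈-trans (identity₀ (ι a) (ι b) (ι c) (ι d) (ι k) p q (vec₀ v) α τ₁ τ₂ z) (+-congˡ (-‿cong (*-congˡ (≈-sym δ≈)))))
        value₁ : vec₁ ⟨ 0ℤ , 0ℤ , 0ℤ , 0ℤ ⟩ + α * vec₁ v + q * vec₁ ⟨ ℤ.- a , ℤ.- b , ℤ.- k , 0ℤ ⟩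
          + (p * z + q * τ₁) * vec₁ ⟨ ℤ.- c , ℤ.- d , 0ℤ , k ⟩ + p * vec₁ ⟨ 0ℤ , 0ℤ , d , b ⟩ + p * τ₂ * vec₁ ⟨ 0ℤ , 0ℤ , c , a ⟩
          ≈ vec₁ v * α + p * δ
        value₁ = ≈-trans
          (+-congʳ (+-congʳ (+-congʳ (+-congˡ (*-congˡ (+-congʳ (*-congʳ (-‿homo k))))))))
          (≈-trans (identity₁ (ι a) (ι b) (ι c) (ι d) (ι k) p q (vec₁ v) α τ₁ τ₂ z) (+-congˡ (*-congˡ (≈-sym δ≈))))

    splitting :
      (∀ p → Prime p → + p ∣ n → ∀ x y → Rank₂ τ₂ x → Rank₂ τ₂ y → ¬ ι n * z ≈ ι (+ p) * (x + τ₁ * y)) →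
      NoCommonPrime (h₁ ∷ h₂ ∷ []) → NoCommonPrime (A₁ ∷ B₁ ∷ C₁ ∷ []) → NoCommonPrime (A₂ ∷ B₂ ∷ C₂ ∷ []) →
      Splitting
    splitting order coprime primitive₁ primitive₂ =
      let ℓ , ℓ-prime , ℓ∤n = prime-not-dividing n n≢0
      in split (CyclicVector.cyclicVector n h₁ h₂ A₁ B₁ C₁ A₂ B₂ C₂ r s₀ s₁ t₀ t₁ n≢0 h₁≢0 h₂≢0
           coprime primitive₁ primitive₂ (nonsplit order coprime primitive₁ primitive₂) ℓ ℓ-prime ℓ∤n)
      where
      split : (∃₂ λ v g → g ∙ v ≡ 0ℤ × g ∙ W v ≡ 1ℤ) → Splitting
      split (v , g , g∙v≡0 , g∙Wv≡1) = record
        { v       = v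
        ; p       = φ₁
        ; q       = φ₃
        ; unit    = Φ≈1 v g∙v≡0 g∙Wv≡1
        ; p∈      = φ∈ g₁ g₁′
        ; q∈      = φ∈ g₃ g₃′
        ; pτ₂∈    = rank₂-resp (≈-sym φ₀-value) (φ∈ g₀ g₀′)
        ; pz+qτ₁∈ = rank₂-resp (≈-sym φ₂-value) (φ∈ g₂ g₂′)
        }
        where
        open Functional g
        φ∈ : ∀ a b → Rank₂ ω (ι b + ω * ι a)
        φ∈ a b = a , b , identity (ι a) (ι b) ω
          where
          identity : ∀ a b ω → b + ω * a ≈ a * ω + b
          identity = solve 3 (λ a b ω → b :+ ω :* a := a :* ω :+ b) ≈-refl

  ≈-by-difference : ∀ {x y} → x - y ≈ 0# → x ≈ y
  ≈-by-difference = x-y≈0⇒x≈y _ _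

  rank₂-integer : ∀ {τ} b → Rank₂ τ (ι b)
  rank₂-integer {τ} b = 0ℤ , b , identity (ι b) τ
    where
    identity : ∀ b τ → b ≈ ι 0ℤ * τ + b
    identity = solve 2 (λ b τ → b := con 0ℤ :* τ :+ b) ≈-refl

  torsionFree-cancel : TorsionFree → ∀ k {x y} → k ≢ 0ℤ → ι k * (x - y) ≈ 0# → x ≈ y
  torsionFree-cancel torsionFree k k≢0 eq = ≈-by-difference (torsionFree k k≢0 eq)

  -- Primitive quadratic equations and multiplier rings.

  module Quadratic (torsionFree : TorsionFree) (τ : Carrier) (independent : Independent τ) where

    module _
      (b₁ b₂ : Carrier) (d₁ m₁ m₁′ d₂ m₂ m₂′ d₃ m₃ m₃′ : ℤ)
      (d₁≢0 : d₁ ≢ 0ℤ) (d₂≢0 : d₂ ≢ 0ℤ) (d₃≢0 : d₃ ≢ 0ℤ)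
      (span₁ : ι d₁ * 1# ≈ ι m₁ * b₁ + ι m₁′ * b₂)
      (span₂ : ι d₂ * τ ≈ ι m₂ * b₁ + ι m₂′ * b₂)
      (span₃ : ι d₃ * (τ * τ) ≈ ι m₃ * b₁ + ι m₃′ * b₂)
      where

      private
        Δ A₀ B₀ C₀ : ℤ
        Δ  = m₁ ℤ.* m₂′ ℤ.- m₂ ℤ.* m₁′
        A₀ = Δ ℤ.* d₃
        B₀ = ℤ.- ((m₁ ℤ.* m₃′ ℤ.- m₃ ℤ.* m₁′) ℤ.* d₂)
        C₀ = (m₂ ℤ.* m₃′ ℤ.- m₃ ℤ.* m₂′) ℤ.* d₁

        ι-A₀ = ι-poly 5 (λ m₁ m₂′ m₂ m₁′ d₃ → (m₁ :* m₂′ :- m₂ :* m₁′) :* d₃)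
        ι-B₀ = ι-poly 5 (λ m₁ m₂′ m₂ m₁′ d₃ → :- ((m₁ :* m₂′ :- m₂ :* m₁′) :* d₃))
        ι-Δ = ι-poly 4 (λ m₁ m₂′ m₂ m₁′ → m₁ :* m₂′ :- m₂ :* m₁′)
        ι-dependence : ∀ m d → ι (ℤ.- (m ℤ.* d)) ≈ - (ι m * ι d)
        ι-dependence = ι-poly 2 (λ m d → :- (m :* d))

        cofactor-identity = solve 13 (λ d₁ m₁ m₁′ d₂ m₂ m₂′ d₃ m₃ m₃′ b₁ b₂ τ u →
          ((m₁ :* m₂′ :- m₂ :* m₁′) :* d₃ :* (τ :* τ) :+ :- ((m₁ :* m₃′ :- m₃ :* m₁′) :* d₂) :* τ :+ (m₂ :* m₃′ :- m₃ :* m₂′) :* d₁ :* u) :- con 0ℤ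
          := (m₁ :* m₂′ :- m₂ :* m₁′) :* (d₃ :* (τ :* τ) :- (m₃ :* b₁ :+ m₃′ :* b₂))
            :+ :- (m₁ :* m₃′ :- m₃ :* m₁′) :* (d₂ :* τ :- (m₂ :* b₁ :+ m₂′ :* b₂))
            :+ (m₂ :* m₃′ :- m₃ :* m₂′) :* (d₁ :* u :- (m₁ :* b₁ :+ m₁′ :* b₂))) ≈-refl

        -- Three vectors 1, τ, τ² in a plane satisfy the relation whose coefficients are the 2×2
        -- minors of their coordinates, here multiplied by the denominators d₃, d₂, d₁.
        relation₀ : ι A₀ * (τ * τ) + ι B₀ * τ + ι C₀ ≈ 0#
        relation₀ = begin
          ι A₀ * (τ * τ) + ι B₀ * τ + ι C₀
            ≈⟨ +-cong (+-cong (*-congʳ (ι-A₀ m₁ m₂′ m₂ m₁′ d₃)) (*-congʳ (ι-B₀ m₁ m₃′ m₃ m₁′ d₂)))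
                 (≈-trans (ι-A₀ m₂ m₃′ m₃ m₂′ d₁) (≈-sym (*-identityʳ _))) ⟩
          _ ≈⟨ modulo₃ _ _ _ (x≈y⇒x-y≈0 span₃) (x≈y⇒x-y≈0 span₂) (x≈y⇒x-y≈0 span₁)
                 (cofactor-identity (ι d₁) (ι m₁) (ι m₁′) (ι d₂) (ι m₂) (ι m₂′) (ι d₃) (ι m₃) (ι m₃′) b₁ b₂ τ 1#) ⟩
          ι 0ℤ ≈⟨ 0#-homo ⟩
          0# ∎

        eliminate-identity = solve 10 (λ d₁ m₁ m₁′ d₂ m₂ m₂′ b₁ b₂ τ u →
          (:- (m₁ :* d₂) :* τ :+ m₂ :* d₁ :* u) :- con 0ℤ
          := :- m₁ :* (d₂ :* τ :- (m₂ :* b₁ :+ m₂′ :* b₂)) :+ m₂ :* (d₁ :* u :- (m₁ :* b₁ :+ m₁′ :* b₂)) :+ :- b₂ :* (m₁ :* m₂′ :- m₂ :* m₁′)) ≈-refl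

        eliminate : ∀ b₁ b₂ m₁ m₁′ m₂ m₂′ →
          ι d₁ * 1# ≈ ι m₁ * b₁ + ι m₁′ * b₂ → ι d₂ * τ ≈ ι m₂ * b₁ + ι m₂′ * b₂ → m₁ ℤ.* m₂′ ℤ.- m₂ ℤ.* m₁′ ≡ 0ℤ → m₁ ≡ 0ℤ
        eliminate b₁ b₂ m₁ m₁′ m₂ m₂′ eq₁ eq₂ Δ≡0 =
          [ (λ m₁≡0 → m₁≡0) , (λ d₂≡0 → contradiction d₂≡0 d₂≢0) ]′ (ℤ.i*j≡0⇒i≡0∨j≡0 m₁
            (ℤ.neg-injective {m₁ ℤ.* d₂} {0ℤ} (proj₁ (independent (ℤ.- (m₁ ℤ.* d₂)) (m₂ ℤ.* d₁) (begin
              ι (ℤ.- (m₁ ℤ.* d₂)) * τ + ι (m₂ ℤ.* d₁)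
                ≈⟨ +-cong (*-congʳ (ι-dependence m₁ d₂)) (≈-trans (*-homo m₂ d₁) (≈-sym (*-identityʳ _))) ⟩
              _ ≈⟨ modulo₃ _ _ _ (x≈y⇒x-y≈0 eq₂) (x≈y⇒x-y≈0 eq₁)
                     (≈-trans (≈-sym (ι-Δ m₁ m₂′ m₂ m₁′)) (≈-trans (ι-cong Δ≡0) 0#-homo))
                     (eliminate-identity (ι d₁) (ι m₁) (ι m₁′) (ι d₂) (ι m₂) (ι m₂′) b₁ b₂ τ 1#) ⟩
              ι 0ℤ ≈⟨ 0#-homo ⟩
              0# ∎)))))

        -- If Δ were 0, eliminating b₁ or b₂ between 1 and τ would give a relation of τ and 1 with
        -- leading coefficient -m₁d₂ or -m₁′d₂. Both vanish by independence, and then d₁ = 0.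
        Δ≢0 : Δ ≢ 0ℤ
        Δ≢0 Δ≡0 = d₁≢0 (proj₂ (independent 0ℤ d₁ (begin
          ι 0ℤ * τ + ι d₁                  ≈⟨ +-congˡ (≈-trans (≈-sym (*-identityʳ _)) span₁) ⟩
          ι 0ℤ * τ + (ι m₁ * b₁ + ι m₁′ * b₂) ≈⟨ +-congˡ (+-cong (*-congʳ (ι-cong m₁≡0)) (*-congʳ (ι-cong m₁′≡0))) ⟩
          ι 0ℤ * τ + (ι 0ℤ * b₁ + ι 0ℤ * b₂)  ≈⟨ identity τ b₁ b₂ ⟩
          ι 0ℤ                             ≈⟨ 0#-homo ⟩
          0#                               ∎)))
          where
          identity : ∀ x y z → ι 0ℤ * x + (ι 0ℤ * y + ι 0ℤ * z) ≈ ι 0ℤ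
          identity = solve 3 (λ x y z → con 0ℤ :* x :+ (con 0ℤ :* y :+ con 0ℤ :* z) := con 0ℤ) ≈-refl
          m₁≡0 : m₁ ≡ 0ℤ
          m₁≡0 = eliminate b₁ b₂ m₁ m₁′ m₂ m₂′ span₁ span₂ Δ≡0
          m₁′≡0 : m₁′ ≡ 0ℤ
          m₁′≡0 = eliminate b₂ b₁ m₁′ m₁ m₂′ m₂ (≈-trans span₁ (+-comm _ _)) (≈-trans span₂ (+-comm _ _))
            (≡.trans (minor-swap m₁ m₂′ m₂ m₁′) (≡.cong ℤ.-_ Δ≡0))

      primitive-relation : ∃ λ A → ∃₂ λ B C → A ≢ 0ℤ × NoCommonPrime (A ∷ B ∷ C ∷ []) ×
        ι A * (τ * τ) + ι B * τ + ι C ≈ 0#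
      primitive-relation = divide-out (bézout (A₀ ∷ B₀ ∷ C₀ ∷ []))
        where
        identity : ∀ A B C g τ → g * (A * (τ * τ) + B * τ + C) ≈ (A * g) * (τ * τ) + (B * g) * τ + C * g
        identity = solve 5 (λ A B C g τ →
          g :* (A :* (τ :* τ) :+ B :* τ :+ C)
          := (A :* g) :* (τ :* τ) :+ (B :* g) :* τ :+ C :* g) ≈-refl
        divide-out : (∃ λ g → All (g ∣_) (A₀ ∷ B₀ ∷ C₀ ∷ []) × ∃ λ us → dot us (A₀ ∷ B₀ ∷ C₀ ∷ []) ≡ g) →
          ∃ λ A → ∃₂ λ B C → A ≢ 0ℤ × NoCommonPrime (A ∷ B ∷ C ∷ []) × ι A * (τ * τ) + ι B * τ + ι C ≈ 0#
        divide-out (g , divides A A₀≡Ag ∷ divides B B₀≡Bg ∷ divides C C₀≡Cg ∷ [] , us , us∙≡g) =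
          A , B , C , A≢0 , unit-content g A B C us g≢0 (≡.trans (≡.cong₂ (λ x y → dot us (x ∷ y)) (≡.sym A₀≡Ag)
            (≡.cong₂ (λ x y → x ∷ y ∷ []) (≡.sym B₀≡Bg) (≡.sym C₀≡Cg))) us∙≡g)
          , torsionFree g g≢0 (begin
              ι g * (ι A * (τ * τ) + ι B * τ + ι C)              ≈⟨ identity (ι A) (ι B) (ι C) (ι g) τ ⟩
              (ι A * ι g) * (τ * τ) + (ι B * ι g) * τ + ι C * ι g ≈⟨ +-cong (+-cong (*-congʳ (back A A₀≡Ag)) (*-congʳ (back B B₀≡Bg))) (back C C₀≡Cg) ⟩
              ι A₀ * (τ * τ) + ι B₀ * τ + ι C₀                   ≈⟨ relation₀ ⟩
              0#                                                 ∎)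
          where
          A₀≢0 : A₀ ≢ 0ℤ
          A₀≢0 = *-≢0 Δ≢0 d₃≢0
          g≢0 : g ≢ 0ℤ
          g≢0 g≡0 = A₀≢0 (≡.trans A₀≡Ag (≡.trans (≡.cong (A ℤ.*_) g≡0) (ℤ.*-zeroʳ A)))
          A≢0 : A ≢ 0ℤ
          A≢0 A≡0 = A₀≢0 (≡.trans A₀≡Ag (≡.cong (ℤ._* g) A≡0))
          back : ∀ X {Y} → Y ≡ X ℤ.* g → ι X * ι g ≈ ι Y
          back X eq = ≈-trans (≈-sym (*-homo X g)) (ι-cong (≡.sym eq))

    module _ (A B C : ℤ) (content : NoCommonPrime (A ∷ B ∷ C ∷ []))
      (root : ι A * (τ * τ) + ι B * τ + ι C ≈ 0#) where

      -- For α = aτ + b and ατ = cτ + d, computing Aατ with the quadratic equation gives aB = A(b -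
      -- c) and aC = -Ad, so A divides a because the equation is primitive.
      multiplier⇒ : ∀ {α} → Rank₂ τ α → Rank₂ τ (α * τ) → Rank₂ (ι A * τ) α
      multiplier⇒ {α} (a , b , α≈) (c , d , ατ≈) = divided (noCommonPrime⇒unimodular (A ∷ B ∷ C ∷ []) content)
        where
        ι-x = ι-poly 5 (λ A b c a B → A :* (b :- c) :- a :* B)
        ι-y = ι-poly 4 (λ A d a C → :- (A :* d) :- a :* C)
        identity = solve 9 (λ A B C a b c d τ α →
          ((A :* (b :- c) :- a :* B) :* τ :+ (:- (A :* d) :- a :* C)) :- con 0ℤ
          := A :* (α :* τ :- (c :* τ :+ d)) :+ :- (A :* τ) :* (α :- (a :* τ :+ b)) :+ :- a :* (A :* (τ :* τ) :+ B :* τ :+ C)) ≈-refl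
        equations : A ℤ.* (b ℤ.- c) ℤ.- a ℤ.* B ≡ 0ℤ × ℤ.- (A ℤ.* d) ℤ.- a ℤ.* C ≡ 0ℤ
        equations = independent (A ℤ.* (b ℤ.- c) ℤ.- a ℤ.* B) (ℤ.- (A ℤ.* d) ℤ.- a ℤ.* C)
          (≈-trans (+-cong (*-congʳ (ι-x A b c a B)) (ι-y A d a C)) (≈-trans
            (modulo₃ _ _ _ (x≈y⇒x-y≈0 ατ≈) (x≈y⇒x-y≈0 α≈) root
              (identity (ι A) (ι B) (ι C) (ι a) (ι b) (ι c) (ι d) τ α)) 0#-homo))
        divided : (∃ λ us → dot us (A ∷ B ∷ C ∷ []) ≡ 1ℤ) → Rank₂ (ι A * τ) α
        divided (u ∷ v ∷ w ∷ [] , eq) =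
          let e = a ℤ.* u ℤ.+ v ℤ.* (b ℤ.- c) ℤ.- w ℤ.* d
          in e , b , ≈-trans α≈ (+-congʳ (≈-trans (*-congʳ (≈-trans
            (ι-cong (multiplier-identity a A B C b c d u v w eq (proj₁ equations) (proj₂ equations))) (*-homo e A))) (*-assoc _ _ _)))

      multiplier⇐ : ∀ {x} → Rank₂ τ x → Rank₂ τ (ι A * τ * x)
      multiplier⇐ {x} (a , b , x≈) = b ℤ.* A ℤ.- a ℤ.* B , ℤ.- (a ℤ.* C) ,
        ≈-trans (modulo₂ _ _ (x≈y⇒x-y≈0 x≈) root (identity (ι A) (ι B) (ι C) (ι a) (ι b) τ x))
          (≈-sym (+-cong (*-congʳ (ι-x b A a B)) (ι-y a C)))
        where
        ι-x = ι-poly 4 (λ b A a B → b :* A :- a :* B)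
        ι-y : ∀ a C → ι (ℤ.- (a ℤ.* C)) ≈ - (ι a * ι C)
        ι-y = ι-poly 2 (λ a C → :- (a :* C))
        identity = solve 7 (λ A B C a b τ x →
          A :* τ :* x :- ((b :* A :- a :* B) :* τ :+ :- (a :* C))
          := A :* τ :* (x :- (a :* τ :+ b)) :+ a :* (A :* (τ :* τ) :+ B :* τ :+ C)) ≈-refl

  -- Comparison of the multiplier rings of τ₁ and τ₂.

  module Comparison
    (torsionFree : TorsionFree) (τ₁ τ₂ β₁ β₂ : Carrier) (independent₁ : Independent τ₁)
    (A₁ A₂ g h₁ h₂ a₁ a₂ s t s′ t′ : ℤ) (A₁≢0 : A₁ ≢ 0ℤ) (g≢0 : g ≢ 0ℤ) (h₂≢0 : h₂ ≢ 0ℤ)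
    (generator₁ : ι A₁ * τ₁ ≈ ι a₁ + ι h₁ * ι g * β₁)
    (generator₂ : ι A₂ * τ₂ ≈ ι a₂ + ι h₂ * ι g * β₂)
    (coordinates₁ : ι h₂ * ι g * β₁ ≈ ι t′ * (ι A₂ * τ₂) + ι s′)
    (coordinates₂ : ι h₁ * ι g * β₂ ≈ ι t * (ι A₁ * τ₁) + ι s)
    where

    -- Modulo ℤ the data read h₂gβ₁ ≡ t′h₂gβ₂ and h₁gβ₂ ≡ t h₁gβ₁. Composing them gives a relation
    -- between τ₁ and 1 whose leading coefficient is a nonzero multiple of 1 - t′t.
    sign : t′ ℤ.* t ≡ 1ℤ
    sign = [ (λ eq → ≡.sym (ℤ.i-j≡0⇒i≡j 1ℤ (t′ ℤ.* t) eq)) , (λ eq → contradiction eq (*-≢0 (*-≢0 h₂≢0 g≢0) A₁≢0)) ]′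
      (ℤ.i*j≡0⇒i≡0∨j≡0 (1ℤ ℤ.- t′ ℤ.* t) (proj₁ (independent₁ ((1ℤ ℤ.- t′ ℤ.* t) ℤ.* (h₂ ℤ.* g ℤ.* A₁)) δ dependence)))
      where
      δ : ℤ
      δ = ℤ.- (h₂ ℤ.* g ℤ.* a₁ ℤ.+ h₁ ℤ.* g ℤ.* s′ ℤ.+ t′ ℤ.* (h₁ ℤ.* g) ℤ.* a₂ ℤ.+ t′ ℤ.* (h₂ ℤ.* g) ℤ.* s)
      ι-κ = ι-poly 5 (λ t′ t h₂ g A₁ → (con 1ℤ :- t′ :* t) :* (h₂ :* g :* A₁))
      ι-δ = ι-poly 8 (λ h₂ g a₁ h₁ s′ t′ a₂ s →
        :- (h₂ :* g :* a₁ :+ h₁ :* g :* s′ :+ t′ :* (h₁ :* g) :* a₂ :+ t′ :* (h₂ :* g) :* s))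
      identity = solve 15 (λ g h₁ h₂ A₁ A₂ a₁ a₂ s t s′ t′ τ₁ τ₂ β₁ β₂ →
        ((con 1ℤ :- t′ :* t) :* (h₂ :* g :* A₁) :* τ₁ :+ :- (h₂ :* g :* a₁ :+ h₁ :* g :* s′ :+ t′ :* (h₁ :* g) :* a₂ :+ t′ :* (h₂ :* g) :* s)) :- con 0ℤ
        := h₂ :* g :* (A₁ :* τ₁ :- (a₁ :+ h₁ :* g :* β₁)) :+ h₁ :* g :* (h₂ :* g :* β₁ :- (t′ :* (A₂ :* τ₂) :+ s′))
          :+ t′ :* (h₁ :* g) :* (A₂ :* τ₂ :- (a₂ :+ h₂ :* g :* β₂)) :+ t′ :* (h₂ :* g) :* (h₁ :* g :* β₂ :- (t :* (A₁ :* τ₁) :+ s))) ≈-refl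
      dependence : ι ((1ℤ ℤ.- t′ ℤ.* t) ℤ.* (h₂ ℤ.* g ℤ.* A₁)) * τ₁ + ι δ ≈ 0#
      dependence = ≈-trans (+-cong (*-congʳ (ι-κ t′ t h₂ g A₁)) (ι-δ h₂ g a₁ h₁ s′ t′ a₂ s)) (≈-trans
        (modulo₄ _ _ _ _ (x≈y⇒x-y≈0 generator₁) (x≈y⇒x-y≈0 coordinates₁) (x≈y⇒x-y≈0 generator₂) (x≈y⇒x-y≈0 coordinates₂)
          (identity (ι g) (ι h₁) (ι h₂) (ι A₁) (ι A₂) (ι a₁) (ι a₂) (ι s) (ι t) (ι s′) (ι t′) τ₁ τ₂ β₁ β₂)) 0#-homo)

    -- Multiply A₁τ₁ = a₁ + h₁gβ₁ by h₂ and expand h₂gβ₁ in the multiplier ring of L₂. This is the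
    -- origin of the integer r and of the sign t′.
    comparison : ι h₂ * ι A₁ * τ₁ ≈ ι h₁ * ι (t′ ℤ.* A₂) * τ₂ + ι (h₂ ℤ.* a₁ ℤ.+ h₁ ℤ.* s′)
    comparison = ≈-trans
      (torsionFree-cancel torsionFree g g≢0 (≈-trans
        (modulo₂ _ _ (x≈y⇒x-y≈0 generator₁) (x≈y⇒x-y≈0 coordinates₁)
          (identity (ι g) (ι h₁) (ι h₂) (ι A₁) (ι A₂) (ι a₁) (ι s′) (ι t′) τ₁ τ₂ β₁)) 0#-homo))
      (≈-sym (+-cong (*-congʳ (*-congˡ (*-homo t′ A₂))) (ι-r h₂ a₁ h₁ s′)))
      where
      ι-r = ι-poly 4 (λ h₂ a₁ h₁ s′ → h₂ :* a₁ :+ h₁ :* s′)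
      identity = solve 11 (λ g h₁ h₂ A₁ A₂ a₁ s′ t′ τ₁ τ₂ β₁ →
        g :* (h₂ :* A₁ :* τ₁ :- (h₁ :* (t′ :* A₂) :* τ₂ :+ (h₂ :* a₁ :+ h₁ :* s′))) :- con 0ℤ
        := h₂ :* g :* (A₁ :* τ₁ :- (a₁ :+ h₁ :* g :* β₁)) :+ h₁ :* g :* (h₂ :* g :* β₁ :- (t′ :* (A₂ :* τ₂) :+ s′))) ≈-refl

  -- Change of lattice basis.

  module Basis
    (ω₁ ω₂ τ : Carrier) (independent : ∀ a b → ι a * ω₁ + ι b * ω₂ ≈ 0# → a ≡ 0ℤ × b ≡ 0ℤ)
    (a b c d α β γ δ : ℤ)
    (ω₁≈ : ω₁ ≈ ι a * 1# + ι b * τ) (ω₂≈ : ω₂ ≈ ι c * 1# + ι d * τ)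
    (1≈ : 1# ≈ ι α * ω₁ + ι β * ω₂) (τ≈ : τ ≈ ι γ * ω₁ + ι δ * ω₂)
    where

    private
      ι-x = ι-poly 4 (λ a α b γ → a :* α :+ b :* γ)
      ι-y = ι-poly 4 (λ a α b γ → a :* α :+ b :* γ :- con 1ℤ)
      identity₁ = solve 10 (λ a b α β γ δ u τ ω₁ ω₂ →
        ((a :* α :+ b :* γ :- con 1ℤ) :* ω₁ :+ (a :* β :+ b :* δ) :* ω₂) :- con 0ℤ
        := :- con 1ℤ :* (ω₁ :- (a :* u :+ b :* τ)) :+ :- a :* (u :- (α :* ω₁ :+ β :* ω₂)) :+ :- b :* (τ :- (γ :* ω₁ :+ δ :* ω₂))) ≈-refl
      identity₂ = solve 10 (λ c d α β γ δ u τ ω₁ ω₂ →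
        ((c :* α :+ d :* γ) :* ω₁ :+ (c :* β :+ d :* δ :- con 1ℤ) :* ω₂) :- con 0ℤ
        := :- con 1ℤ :* (ω₂ :- (c :* u :+ d :* τ)) :+ :- c :* (u :- (α :* ω₁ :+ β :* ω₂)) :+ :- d :* (τ :- (γ :* ω₁ :+ δ :* ω₂))) ≈-refl
      identity₃ = solve 10 (λ s t α β γ δ u τ ω₁ ω₂ →
        ((s :* γ :+ t :* α) :* ω₁ :+ (s :* δ :+ t :* β) :* ω₂) :- con 0ℤ
        := (s :* τ :+ t :* u) :+ :- t :* (u :- (α :* ω₁ :+ β :* ω₂)) :+ :- s :* (τ :- (γ :* ω₁ :+ δ :* ω₂))) ≈-refl

      1-rel = x≈y⇒x-y≈0 1≈
      τ-rel = x≈y⇒x-y≈0 τ≈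

      first : a ℤ.* α ℤ.+ b ℤ.* γ ℤ.- 1ℤ ≡ 0ℤ × a ℤ.* β ℤ.+ b ℤ.* δ ≡ 0ℤ
      first = independent (a ℤ.* α ℤ.+ b ℤ.* γ ℤ.- 1ℤ) (a ℤ.* β ℤ.+ b ℤ.* δ)
        (≈-trans (+-cong (*-congʳ (ι-y a α b γ)) (*-congʳ (ι-x a β b δ)))
          (≈-trans (modulo₃ _ _ _ (x≈y⇒x-y≈0 ω₁≈) 1-rel τ-rel
            (identity₁ (ι a) (ι b) (ι α) (ι β) (ι γ) (ι δ) 1# τ ω₁ ω₂)) 0#-homo))

      second : c ℤ.* α ℤ.+ d ℤ.* γ ≡ 0ℤ × c ℤ.* β ℤ.+ d ℤ.* δ ℤ.- 1ℤ ≡ 0ℤ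
      second = independent (c ℤ.* α ℤ.+ d ℤ.* γ) (c ℤ.* β ℤ.+ d ℤ.* δ ℤ.- 1ℤ)
        (≈-trans (+-cong (*-congʳ (ι-x c α d γ)) (*-congʳ (ι-y c β d δ)))
          (≈-trans (modulo₃ _ _ _ (x≈y⇒x-y≈0 ω₂≈) 1-rel τ-rel
            (identity₂ (ι c) (ι d) (ι α) (ι β) (ι γ) (ι δ) 1# τ ω₁ ω₂)) 0#-homo))

    -- `IsLattice` gives independence of some basis (ω₁ , ω₂) only. Rewriting each basis in the
    -- other makes the transition matrices inverse to each other, and this carries independence over
    -- to (τ , 1).
    basis-independent : Independent τ
    basis-independent s t sτ+t≈0 =
      invertible-kernel a b c d α β γ δ s t (proj₁ first) (proj₂ first) (proj₂ second) (proj₁ third) (proj₂ third)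
      where
      third : s ℤ.* γ ℤ.+ t ℤ.* α ≡ 0ℤ × s ℤ.* δ ℤ.+ t ℤ.* β ≡ 0ℤ
      third = independent (s ℤ.* γ ℤ.+ t ℤ.* α) (s ℤ.* δ ℤ.+ t ℤ.* β)
        (≈-trans (+-cong (*-congʳ (ι-x s γ t α)) (*-congʳ (ι-x s δ t β)))
          (≈-trans (modulo₃ 1# _ _ (≈-trans (+-congˡ (*-identityʳ _)) sτ+t≈0) 1-rel τ-rel
            (≈-trans (identity₃ (ι s) (ι t) (ι α) (ι β) (ι γ) (ι δ) 1# τ ω₁ ω₂)
              (+-congʳ (+-congʳ (≈-sym (*-identityˡ _)))))) 0#-homo))

  module LatticeIdentities where

    swap-terms : ∀ a b u τ → a * u + b * τ ≈ b * τ + a * u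
    swap-terms = solve 4 (λ a b u τ → a :* u :+ b :* τ := b :* τ :+ a :* u) ≈-refl

    monic-step : ∀ c k l x e → c * (k * l) + k * x * (l * e) ≈ k * l * (c + x * e)
    monic-step = solve 5 (λ c k l x e → c :* (k :* l) :+ k :* x :* (l :* e) := k :* l :* (c :+ x :* e)) ≈-refl

    suc-scale : ∀ k x → (ι 1ℤ + k) * x ≈ x + k * x
    suc-scale = solve 2 (λ k x → (con 1ℤ :+ k) :* x := x :+ k :* x) ≈-refl

    neg-scale : ∀ k x → - k * x ≈ - (k * x)
    neg-scale = solve 2 (λ k x → :- k :* x := :- (k :* x)) ≈-refl

    clear-identity : ∀ d e p q b₁ b₂ → d * e * (p * b₁ + q * b₂) ≈ d * p * e * b₁ + e * q * d * b₂
    clear-identity = solve 6 (λ d e p q b₁ b₂ →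
      d :* e :* (p :* b₁ :+ q :* b₂)
      := d :* p :* e :* b₁ :+ e :* q :* d :* b₂) ≈-refl

    product-identity : ∀ a b u τ w → (a * u + b * τ) * w ≈ a * (u * w) + τ * (b * w)
    product-identity = solve 5 (λ a b u τ w → (a :* u :+ b :* τ) :* w := a :* (u :* w) :+ τ :* (b :* w)) ≈-refl

    product-+ : ∀ X Y X′ Y′ τ → (X + τ * Y) + (X′ + τ * Y′) ≈ (X + X′) + τ * (Y + Y′)
    product-+ = solve 5 (λ X Y X′ Y′ τ → (X :+ τ :* Y) :+ (X′ :+ τ :* Y′) := (X :+ X′) :+ τ :* (Y :+ Y′)) ≈-refl

    product-neg : ∀ X Y τ → - (X + τ * Y) ≈ ι (ℤ.- 1ℤ) * X + τ * (ι (ℤ.- 1ℤ) * Y)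
    product-neg = solve 3 (λ X Y τ → :- (X :+ τ :* Y) := con (ℤ.- 1ℤ) :* X :+ τ :* (con (ℤ.- 1ℤ) :* Y)) ≈-refl

    order-to : ∀ a n h f β → a + n * (h * f) * β ≈ a + n * h * (f * β)
    order-to = solve 5 (λ a n h f β → a :+ n :* (h :* f) :* β := a :+ n :* h :* (f :* β)) ≈-refl

    order-to′ : ∀ a n h t s A τ → a + n * h * (t * (A * τ) + s) ≈ t * (n * (h * A * τ)) + (a + n * h * s)
    order-to′ = solve 7 (λ a n h t s A τ →
      a :+ n :* h :* (t :* (A :* τ) :+ s)
      := t :* (n :* (h :* A :* τ)) :+ (a :+ n :* h :* s)) ≈-refl

    order-from : ∀ t s n h A τ → t * (n * (h * A * τ)) + s ≈ t * n * h * (A * τ) + s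
    order-from = solve 6 (λ t s n h A τ → t :* (n :* (h :* A :* τ)) :+ s := t :* n :* h :* (A :* τ) :+ s) ≈-refl

    order-from′ = solve 7 (λ t s n h a f β →
      t :* n :* h :* (a :+ f :* β) :+ s
      := (s :+ t :* n :* h :* a) :+ n :* (h :* f) :* (t :* β)) ≈-refl

    difference-neg : ∀ x y → x + - (x - y) ≈ y
    difference-neg = solve 2 (λ x y → x :+ :- (x :- y) := y) ≈-refl

    determinant-difference : ∀ kz w → - w ≈ kz - (w + kz)
    determinant-difference = solve 2 (λ kz w → :- w := kz :- (w :+ kz)) ≈-refl

    column₀ : ∀ a b c d τ₂ z → a * τ₂ + b * ι 1ℤ + c * z + d * ι 0ℤ ≈ a * τ₂ + b + c * z
    column₀ = solve 6 (λ a b c d τ₂ z →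
      a :* τ₂ :+ b :* con 1ℤ :+ c :* z :+ d :* con 0ℤ
      := a :* τ₂ :+ b :+ c :* z) ≈-refl

    column₁ : ∀ a b c d τ₁ → a * ι 0ℤ + b * ι 0ℤ + c * τ₁ + d * ι 1ℤ ≈ c * τ₁ + d
    column₁ = solve 5 (λ a b c d τ₁ → a :* con 0ℤ :+ b :* con 0ℤ :+ c :* τ₁ :+ d :* con 1ℤ := c :* τ₁ :+ d) ≈-refl

    root-scale : ∀ t A B C τ → t * A * (τ * τ) + t * B * τ + t * C ≈ t * (A * (τ * τ) + B * τ + C)
    root-scale = solve 5 (λ t A B C τ →
      t :* A :* (τ :* τ) :+ t :* B :* τ :+ t :* C
      := t :* (A :* (τ :* τ) :+ B :* τ :+ C)) ≈-refl

    unit₀ : ∀ x z → x ≈ ι 1ℤ * x + ι 0ℤ + ι 0ℤ * z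
    unit₀ = solve 2 (λ x z → x := con 1ℤ :* x :+ con 0ℤ :+ con 0ℤ :* z) ≈-refl

    unit₁ : ∀ x → ι 0ℤ ≈ ι 0ℤ * x + ι 0ℤ
    unit₁ = solve 1 (λ x → con 0ℤ := con 0ℤ :* x :+ con 0ℤ) ≈-refl

    unit₂ : ∀ x z → ι 1ℤ ≈ ι 0ℤ * x + ι 1ℤ + ι 0ℤ * z
    unit₂ = solve 2 (λ x z → con 1ℤ := con 0ℤ :* x :+ con 1ℤ :+ con 0ℤ :* z) ≈-refl

    unit₃ : ∀ x z → z ≈ ι 0ℤ * x + ι 0ℤ + ι 1ℤ * z
    unit₃ = solve 2 (λ x z → z := con 0ℤ :* x :+ con 0ℤ :+ con 1ℤ :* z) ≈-refl

    unit₄ : ∀ x z → ι 0ℤ ≈ ι 0ℤ * x + ι 0ℤ + ι 0ℤ * z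
    unit₄ = solve 2 (λ x z → con 0ℤ := con 0ℤ :* x :+ con 0ℤ :+ con 0ℤ :* z) ≈-refl

    unit₅ : ∀ x → x ≈ ι 1ℤ * x + ι 0ℤ
    unit₅ = solve 1 (λ x → x := con 1ℤ :* x :+ con 0ℤ) ≈-refl

    unit₆ : ∀ x → ι 1ℤ ≈ ι 0ℤ * x + ι 1ℤ
    unit₆ = solve 1 (λ x → con 1ℤ := con 0ℤ :* x :+ con 1ℤ) ≈-refl

    add-identity : ∀ x y → x + ι 1ℤ * y + ι 0ℤ * x ≈ x + y
    add-identity = solve 2 (λ x y → x :+ con 1ℤ :* y :+ con 0ℤ :* x := x :+ y) ≈-refl

    neg-identity : ∀ x → x + ι (ℤ.- 1ℤ) * x + ι (ℤ.- 1ℤ) * x ≈ - x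
    neg-identity = solve 1 (λ x → x :+ con (ℤ.- 1ℤ) :* x :+ con (ℤ.- 1ℤ) :* x := :- x) ≈-refl

    minus-zero : ∀ x → x - ι 0ℤ ≈ x
    minus-zero = solve 1 (λ x → x :- con 0ℤ := x) ≈-refl

    cancel-identity : ∀ p m z w → p * (m * z - w) ≈ m * p * z - p * w
    cancel-identity = solve 4 (λ p m z w → p :* (m :* z :- w) := m :* p :* z :- p :* w) ≈-refl

  open LatticeIdentities

  lattice⇒rank₂ : ∀ {τ x} → (∃₂ λ a b → x ≈ ι a * 1# + ι b * τ) → Rank₂ τ x
  lattice⇒rank₂ {τ} (a , b , x≈) = b , a , ≈-trans x≈ (≈-trans (swap-terms (ι a) (ι b) 1# τ) (+-congˡ (*-identityʳ _)))

  rank₂⇒lattice : ∀ {τ x} → Rank₂ τ x → ∃₂ λ a b → x ≈ ι a * 1# + ι b * τ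
  rank₂⇒lattice {τ} (a , b , x≈) = b , a , ≈-trans x≈ (≈-trans (+-congˡ (≈-sym (*-identityʳ _))) (≈-sym (swap-terms (ι b) (ι a) 1# τ)))

  first-generator : ∀ x y → ∃₂ λ a b → x ≈ ι a * x + ι b * y
  first-generator x y = 1ℤ , 0ℤ , identity x y
    where
    identity : ∀ x y → x ≈ ι 1ℤ * x + ι 0ℤ * y
    identity = solve 2 (λ x y → x := con 1ℤ :* x :+ con 0ℤ :* y) ≈-refl

  second-generator : ∀ x y → ∃₂ λ a b → y ≈ ι a * x + ι b * y
  second-generator x y = 0ℤ , 1ℤ , identity x y
    where
    identity : ∀ x y → y ≈ ι 0ℤ * x + ι 1ℤ * y
    identity = solve 2 (λ x y → y := con 0ℤ :* x :+ con 1ℤ :* y) ≈-refl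

  ProductLattice : Carrier → Carrier → Carrier → Set
  ProductLattice τ₁ τ₂ x = ∃₂ λ X Y → Rank₂ τ₂ X × Rank₂ τ₂ Y × x ≈ X + τ₁ * Y

  module _ {τ₁ τ₂ : Carrier} where

    product-lattice-* : ∀ {u w x} → (∃₂ λ a b → u ≈ ι a * 1# + ι b * τ₁) → Rank₂ τ₂ w → x ≈ u * w → ProductLattice τ₁ τ₂ x
    product-lattice-* {w = w} (a , b , u≈) w∈ x≈ = ι a * w , ι b * w , rank₂-scale a w∈ , rank₂-scale b w∈
      , ≈-trans x≈ (≈-trans (*-congʳ u≈) (≈-trans (product-identity (ι a) (ι b) 1# τ₁ w) (+-congʳ (*-congˡ (*-identityˡ w)))))

    product-lattice-0 : ProductLattice τ₁ τ₂ 0#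
    product-lattice-0 = ι 0ℤ , ι 0ℤ , rank₂-integer 0ℤ , rank₂-integer 0ℤ , ≈-trans (≈-sym 0#-homo) (identity τ₁)
      where
      identity : ∀ τ → ι 0ℤ ≈ ι 0ℤ + τ * ι 0ℤ
      identity = solve 1 (λ τ → con 0ℤ := con 0ℤ :+ τ :* con 0ℤ) ≈-refl

    product-lattice-+ : ∀ {x y} → ProductLattice τ₁ τ₂ x → ProductLattice τ₁ τ₂ y → ProductLattice τ₁ τ₂ (x + y)
    product-lattice-+ (X , Y , X∈ , Y∈ , x≈) (X′ , Y′ , X′∈ , Y′∈ , y≈) =
      X + X′ , Y + Y′ , rank₂-+ X∈ X′∈ , rank₂-+ Y∈ Y′∈ , ≈-trans (+-cong x≈ y≈) (product-+ X Y X′ Y′ τ₁)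

    product-lattice-neg : ∀ {x} → ProductLattice τ₁ τ₂ x → ProductLattice τ₁ τ₂ (- x)
    product-lattice-neg (X , Y , X∈ , Y∈ , x≈) =
      ι (ℤ.- 1ℤ) * X , ι (ℤ.- 1ℤ) * Y , rank₂-scale (ℤ.- 1ℤ) X∈ , rank₂-scale (ℤ.- 1ℤ) Y∈
        , ≈-trans (-‿cong x≈) (product-neg X Y τ₁)

    product-lattice-resp : ∀ {x y} → x ≈ y → ProductLattice τ₁ τ₂ x → ProductLattice τ₁ τ₂ y
    product-lattice-resp x≈y (X , Y , X∈ , Y∈ , x≈) = X , Y , X∈ , Y∈ , ≈-trans (≈-sym x≈y) x≈

  module _ (n h A f : ℤ) {τ M : Carrier} (M≈ : M ≈ ι n * (ι h * ι f)) where

    -- In b + nh(fγ) the element fγ lies in ℤAτ + ℤ, and nhAτ is ω. With its converse below this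
    -- identifies 𝒪_{nf} with ℤ[ω].
    order-coordinates : ∀ b γ {x} → x ≈ ι b + M * γ → Rank₂ (ι A * τ) (ι f * γ) → Rank₂ (ι n * (ι h * ι A * τ)) x
    order-coordinates b γ x≈ (u , w , fγ≈) = u , b ℤ.+ n ℤ.* h ℤ.* w
      , ≈-trans x≈ (≈-trans (+-congˡ (*-congʳ M≈)) (≈-trans (order-to (ι b) (ι n) (ι h) (ι f) γ)
          (≈-trans (+-congˡ (*-congˡ fγ≈)) (≈-trans (order-to′ (ι b) (ι n) (ι h) (ι u) (ι w) (ι A) τ)
            (+-congˡ (≈-sym (ι-x b n h w)))))))
      where
      ι-x : ∀ b n h w → ι (b ℤ.+ n ℤ.* h ℤ.* w) ≈ ι b + ι n * ι h * ι w
      ι-x = ι-poly 4 (λ b n h w → b :+ n :* h :* w)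

    order-element : ∀ a {β} → ι A * τ ≈ ι a + ι f * β → ∀ u w {x} → x ≈ ι u * (ι n * (ι h * ι A * τ)) + ι w →
      x ≈ ι (w ℤ.+ u ℤ.* n ℤ.* h ℤ.* a) + M * (ι u * β)
    order-element a {β} generator u w x≈ = ≈-trans x≈ (≈-trans (order-from (ι u) (ι w) (ι n) (ι h) (ι A) τ)
      (≈-trans (+-congʳ (*-congˡ generator)) (≈-trans (order-from′ (ι u) (ι w) (ι n) (ι h) (ι a) (ι f) β)
        (≈-sym (+-cong (ι-x w u n h a) (*-congʳ M≈))))))
      where
      ι-x = ι-poly 5 (λ w u n h a → w :+ u :* n :* h :* a)

  root-rescale : ∀ t A B C {τ} → ι A * (τ * τ) + ι B * τ + ι C ≈ 0# →
    ι (t ℤ.* A) * (τ * τ) + ι (t ℤ.* B) * τ + ι (t ℤ.* C) ≈ 0#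
  root-rescale t A B C {τ} root = ≈-trans (+-cong (+-cong (*-congʳ (*-homo t A)) (*-congʳ (*-homo t B))) (*-homo t C))
    (≈-trans (root-scale (ι t) (ι A) (ι B) (ι C) τ) (multiple≈0 (ι t) root))

  quotient-cancel : TorsionFree → ∀ p m n {z w} → p ≢ 0ℤ → n ≡ m ℤ.* p → ι n * z ≈ ι p * w → ι m * z ≈ w
  quotient-cancel torsionFree p m n {z} {w} p≢0 n≡mp nz≈pw = torsionFree-cancel torsionFree p p≢0
    (≈-trans (cancel-identity (ι p) (ι m) z w)
      (x≈y⇒x-y≈0 (≈-trans (*-congʳ (≈-trans (≈-sym (*-homo m p)) (ι-cong (≡.sym n≡mp)))) nz≈pw)))

-- ℝ and ℂ as commutative rings, and ℤ and ℚ inside them.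

module _ {A : Set} {_≈_ : Rel A 0ℓ} {_+_ _*_ : Op₂ A} { -_ : Op₁ A} {0# 1# : A} where
  open Definitions _≈_

  mkIsCommutativeRing : IsEquivalence _≈_ →
    Congruent₂ _+_ → Associative _+_ → Commutative _+_ → LeftIdentity 0# _+_ → LeftInverse 0# -_ _+_ → Congruent₁ -_ →
    Congruent₂ _*_ → Associative _*_ → Commutative _*_ → LeftIdentity 1# _*_ → _DistributesOverˡ_ _*_ _+_ →
    IsCommutativeRing _≈_ _+_ _*_ -_ 0# 1#
  mkIsCommutativeRing equiv +-cong +-assoc +-comm +-idˡ +-invˡ neg-cong *-cong *-assoc *-comm *-idˡ distribˡ = record
    { isRing = record
      { +-isAbelianGroup = record
        { isGroup = record
          { isMonoid = record
            { isSemigroup = record { isMagma = record { isEquivalence = equiv ; ∙-cong = +-cong } ; assoc = +-assoc }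
            ; identity    = comm∧idˡ⇒id +-comm +-idˡ
            }
          ; inverse = comm∧invˡ⇒inv +-comm +-invˡ
          ; ⁻¹-cong = neg-cong
          }
        ; comm = +-comm
        }
      ; *-cong     = *-cong
      ; *-assoc    = *-assoc
      ; *-identity = comm∧idˡ⇒id *-comm *-idˡ
      ; distrib    = comm∧distrˡ⇒distr +-cong *-comm distribˡ
      }
    ; *-comm = *-comm
    }
    where
    setoid : Setoid 0ℓ 0ℓ
    setoid = record { isEquivalence = equiv }
    open Consequences setoid

Null : (ℕ → ℚ) → Set
Null s = ∀ ε → 0ℚ ℚ.< ε → ∃ λ N → ∀ n → N ℕ.≤ n → ℚ.∣ s n ∣ ℚ.< ε

null-ext : ∀ {s t} → (∀ n → s n ≡ t n) → Null s → Null t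
null-ext s≡t s-null ε ε>0 = let N , small = s-null ε ε>0 in
  N , λ n N≤n → ≡.subst (λ q → ℚ.∣ q ∣ ℚ.< ε) (s≡t n) (small n N≤n)

null-zero : Null (λ _ → 0ℚ)
null-zero ε ε>0 = 0 , λ _ _ → ε>0

null-neg : ∀ {s} → Null s → Null (λ n → ℚ.- s n)
null-neg {s} s-null ε ε>0 = let N , small = s-null ε ε>0 in
  N , λ n N≤n → ≡.subst (ℚ._< ε) (≡.sym (ℚ.∣-p∣≡∣p∣ (s n))) (small n N≤n)

private
  half-positive : ∀ {ε} → 0ℚ ℚ.< ε → 0ℚ ℚ.< ε ℚ.* ½
  half-positive {ε} ε>0 = ℚ.positive⁻¹ _ {{ℚ.pos*pos⇒pos ε {{ℚ.positive ε>0}} ½}}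

  halves : ∀ ε → ε ℚ.* ½ ℚ.+ ε ℚ.* ½ ≡ ε
  halves ε = ≡.trans (≡.sym (ℚ.*-distribˡ-+ ε ½ ½)) (ℚ.*-identityʳ ε)

null-+ : ∀ {s t} → Null s → Null t → Null (λ n → s n ℚ.+ t n)
null-+ {s} {t} s-null t-null ε ε>0 =
  let M , s-small = s-null (ε ℚ.* ½) (half-positive ε>0)
      N , t-small = t-null (ε ℚ.* ½) (half-positive ε>0)
  in M ⊔ N , λ n n≥ → ≡.subst (ℚ.∣ s n ℚ.+ t n ∣ ℚ.<_) (halves ε) (ℚ.≤-<-trans (ℚ.∣p+q∣≤∣p∣+∣q∣ (s n) (t n))
    (ℚ.+-mono-< (s-small n (ℕ.m⊔n≤o⇒m≤o M N n≥)) (t-small n (ℕ.m⊔n≤o⇒n≤o M N n≥))))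

eventually-bounded : ∀ x → ∃₂ λ B N → 0ℚ ℚ.< B × (∀ n → N ℕ.≤ n → ℚ.∣ seq x n ∣ ℚ.< B)
eventually-bounded x =
  let N , x-close = cauchy x 1ℚ (ℚ.positive⁻¹ 1ℚ)
      B = 1ℚ ℚ.+ ℚ.∣ seq x N ∣
      bound : ∀ n → N ℕ.≤ n → ℚ.∣ seq x n ∣ ℚ.< B
      bound n N≤n = ≡.subst (λ q → ℚ.∣ q ∣ ℚ.< B) (identity (seq x n) (seq x N))
        (ℚ.≤-<-trans (ℚ.∣p+q∣≤∣p∣+∣q∣ (seq x n ℚ.- seq x N) (seq x N)) (ℚ.+-monoˡ-< ℚ.∣ seq x N ∣ (x-close n N N≤n ℕ.≤-refl)))
  in B , N , ℚ.≤-<-trans (ℚ.0≤∣p∣ (seq x N)) (bound N ℕ.≤-refl) , bound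
  where
  open ℚ-Solver
  identity : ∀ a b → (a ℚ.- b) ℚ.+ b ≡ a
  identity = solve 2 (λ a b → (a :- b) :+ b := a) refl

null-* : ∀ x {s} → Null s → Null (λ n → seq x n ℚ.* s n)
null-* x {s} s-null ε ε>0 =
  let B , M , B>0 , bound = eventually-bounded x
      instance
        B-positive : ℚ.Positive B
        B-positive = ℚ.positive B>0
        B-nonZero : ℚ.NonZero B
        B-nonZero = ℚ.pos⇒nonZero B
      δ = ℚ.1/ B ℚ.* ε
      N , small = s-null δ (ℚ.positive⁻¹ δ {{ℚ.pos*pos⇒pos (ℚ.1/ B) {{ℚ.1/pos⇒pos B}} ε {{ℚ.positive ε>0}}}})
      Bδ≡ε : B ℚ.* δ ≡ ε
      Bδ≡ε = ≡.trans (≡.sym (ℚ.*-assoc B (ℚ.1/ B) ε)) (≡.trans (≡.cong (ℚ._* ε) (ℚ.*-inverseʳ B)) (ℚ.*-identityˡ ε))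
  in M ⊔ N , λ n n≥ → ≡.subst₂ ℚ._<_ (≡.sym (ℚ.∣p*q∣≡∣p∣*∣q∣ (seq x n) (s n))) Bδ≡ε
    (ℚ.≤-<-trans
      (ℚ.*-monoʳ-≤-nonNeg ℚ.∣ s n ∣ {{ℚ.nonNegative (ℚ.0≤∣p∣ (s n))}} (ℚ.<⇒≤ (bound n (ℕ.m⊔n≤o⇒m≤o M N n≥))))
      (ℚ.*-monoʳ-<-pos B (small n (ℕ.m⊔n≤o⇒n≤o M N n≥))))

module _ where
  open ℚ-Solver

  pointwise : ∀ {x y} → (∀ n → seq x n ≡ seq y n) → x ≈ℝ y
  pointwise {x} {y} x≡y = mk≈ℝ (null-ext (λ n → ≡.sym (≡.trans (≡.cong (ℚ._- seq y n) (x≡y n)) (ℚ.+-inverseʳ (seq y n)))) null-zero)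

  ≈ℝ-isEquivalence : IsEquivalence _≈ℝ_
  ≈ℝ-isEquivalence = record
    { refl  = pointwise (λ _ → refl)
    ; sym   = λ {x} {y} x≈y → mk≈ℝ (null-ext (λ n → neg-difference (seq x n) (seq y n)) (null-neg (close x≈y)))
    ; trans = λ {x} {y} {z} x≈y y≈z → mk≈ℝ
        (null-ext (λ n → telescope (seq x n) (seq y n) (seq z n)) (null-+ (close x≈y) (close y≈z)))
    }
    where
    neg-difference : ∀ a b → ℚ.- (a ℚ.- b) ≡ b ℚ.- a
    neg-difference = solve 2 (λ a b → :- (a :- b) := b :- a) refl
    telescope : ∀ a b c → (a ℚ.- b) ℚ.+ (b ℚ.- c) ≡ a ℚ.- c
    telescope = solve 3 (λ a b c → (a :- b) :+ (b :- c) := a :- c) refl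

  +ℝ-cong : ∀ {x x′ y y′} → x ≈ℝ x′ → y ≈ℝ y′ → x +ℝ y ≈ℝ x′ +ℝ y′
  +ℝ-cong {x} {x′} {y} {y′} x≈x′ y≈y′ = mk≈ℝ
    (null-ext (λ n → identity (seq x n) (seq x′ n) (seq y n) (seq y′ n)) (null-+ (close x≈x′) (close y≈y′)))
    where
    identity : ∀ a a′ b b′ → (a ℚ.- a′) ℚ.+ (b ℚ.- b′) ≡ (a ℚ.+ b) ℚ.- (a′ ℚ.+ b′)
    identity = solve 4 (λ a a′ b b′ → (a :- a′) :+ (b :- b′) := (a :+ b) :- (a′ :+ b′)) refl

  -ℝ-cong : ∀ {x x′} → x ≈ℝ x′ → -ℝ x ≈ℝ -ℝ x′
  -ℝ-cong {x} {x′} x≈x′ = mk≈ℝ (null-ext (λ n → identity (seq x n) (seq x′ n)) (null-neg (close x≈x′)))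
    where
    identity : ∀ a a′ → ℚ.- (a ℚ.- a′) ≡ ℚ.- a ℚ.- ℚ.- a′
    identity = solve 2 (λ a a′ → :- (a :- a′) := :- a :- :- a′) refl

  *ℝ-cong : ∀ {x x′ y y′} → x ≈ℝ x′ → y ≈ℝ y′ → x *ℝ y ≈ℝ x′ *ℝ y′
  *ℝ-cong {x} {x′} {y} {y′} x≈x′ y≈y′ = mk≈ℝ
    (null-ext (λ n → identity (seq x n) (seq x′ n) (seq y n) (seq y′ n)) (null-+ (null-* x (close y≈y′)) (null-* y′ (close x≈x′))))
    where
    identity = solve 4 (λ a a′ b b′ → a :* (b :- b′) :+ b′ :* (a :- a′) := a :* b :- a′ :* b′) refl

ℝ-ring : CommutativeRing 0ℓ 0ℓ
ℝ-ring = record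
  { _≈_ = _≈ℝ_ ; _+_ = _+ℝ_ ; _*_ = _*ℝ_ ; -_ = -ℝ_ ; 0# = 0ℝ ; 1# = 1ℝ
  ; isCommutativeRing = mkIsCommutativeRing ≈ℝ-isEquivalence
      +ℝ-cong
      (λ x y z → pointwise (λ n → ℚ.+-assoc (seq x n) (seq y n) (seq z n)))
      (λ x y → pointwise (λ n → ℚ.+-comm (seq x n) (seq y n)))
      (λ x → pointwise (λ n → ℚ.+-identityˡ (seq x n)))
      (λ x → pointwise (λ n → ℚ.+-inverseˡ (seq x n)))
      -ℝ-cong
      *ℝ-cong
      (λ x y z → pointwise (λ n → ℚ.*-assoc (seq x n) (seq y n) (seq z n)))
      (λ x y → pointwise (λ n → ℚ.*-comm (seq x n) (seq y n)))
      (λ x → pointwise (λ n → ℚ.*-identityˡ (seq x n)))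
      (λ x y z → pointwise (λ n → ℚ.*-distribˡ-+ (seq x n) (seq y n) (seq z n)))
  }

toℚᵘ-integer : ∀ a → ℚ.toℚᵘ (a ℚ./ 1) ℚᵘ.≃ mkℚᵘ a 0
toℚᵘ-integer a = ℚ.toℚᵘ-fromℚᵘ (mkℚᵘ a 0)

integer-+ : ∀ a b → (a ℤ.+ b) ℚ./ 1 ≡ a ℚ./ 1 ℚ.+ b ℚ./ 1
integer-+ a b = ℚ.toℚᵘ-injective (begin
  ℚ.toℚᵘ ((a ℤ.+ b) ℚ./ 1)                  ≈⟨ toℚᵘ-integer (a ℤ.+ b) ⟩
  mkℚᵘ (a ℤ.+ b) 0                          ≈⟨ *≡* (≡.cong (ℤ._* 1ℤ) (≡.sym (≡.cong₂ ℤ._+_ (ℤ.*-identityʳ a) (ℤ.*-identityʳ b)))) ⟩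
  mkℚᵘ a 0 ℚᵘ.+ mkℚᵘ b 0                    ≈⟨ ℚᵘ.+-cong (toℚᵘ-integer a) (toℚᵘ-integer b) ⟨
  ℚ.toℚᵘ (a ℚ./ 1) ℚᵘ.+ ℚ.toℚᵘ (b ℚ./ 1)    ≈⟨ ℚ.toℚᵘ-homo-+ (a ℚ./ 1) (b ℚ./ 1) ⟨
  ℚ.toℚᵘ (a ℚ./ 1 ℚ.+ b ℚ./ 1)              ∎)
  where open import Relation.Binary.Reasoning.Setoid ℚᵘ.≃-setoid

integer-* : ∀ a b → (a ℤ.* b) ℚ./ 1 ≡ a ℚ./ 1 ℚ.* (b ℚ./ 1)
integer-* a b = ℚ.toℚᵘ-injective (begin
  ℚ.toℚᵘ ((a ℤ.* b) ℚ./ 1)                  ≈⟨ toℚᵘ-integer (a ℤ.* b) ⟩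
  mkℚᵘ (a ℤ.* b) 0                          ≈⟨ *≡* refl ⟩
  mkℚᵘ a 0 ℚᵘ.* mkℚᵘ b 0                    ≈⟨ ℚᵘ.*-cong (toℚᵘ-integer a) (toℚᵘ-integer b) ⟨
  ℚ.toℚᵘ (a ℚ./ 1) ℚᵘ.* ℚ.toℚᵘ (b ℚ./ 1)    ≈⟨ ℚ.toℚᵘ-homo-* (a ℚ./ 1) (b ℚ./ 1) ⟨
  ℚ.toℚᵘ (a ℚ./ 1 ℚ.* (b ℚ./ 1))            ∎)
  where open import Relation.Binary.Reasoning.Setoid ℚᵘ.≃-setoid

integer-neg : ∀ a → (ℤ.- a) ℚ./ 1 ≡ ℚ.- (a ℚ./ 1)
integer-neg a = ℚ.toℚᵘ-injective (begin
  ℚ.toℚᵘ ((ℤ.- a) ℚ./ 1)    ≈⟨ toℚᵘ-integer (ℤ.- a) ⟩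
  ℚᵘ.- mkℚᵘ a 0             ≈⟨ ℚᵘ.-‿cong (toℚᵘ-integer a) ⟨
  ℚᵘ.- ℚ.toℚᵘ (a ℚ./ 1)     ≈⟨ ℚ.toℚᵘ-homo‿- (a ℚ./ 1) ⟨
  ℚ.toℚᵘ (ℚ.- (a ℚ./ 1))    ∎)
  where open import Relation.Binary.Reasoning.Setoid ℚᵘ.≃-setoid

integer-injective : ∀ a → a ℚ./ 1 ≡ 0ℚ → a ≡ 0ℤ
integer-injective a a/1≡0 = numerator (ℚᵘ.≃-trans (ℚᵘ.≃-sym (toℚᵘ-integer a)) (ℚᵘ.≃-reflexive (≡.cong ℚ.toℚᵘ a/1≡0)))
  where
  numerator : mkℚᵘ a 0 ℚᵘ.≃ mkℚᵘ 0ℤ 0 → a ≡ 0ℤ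
  numerator (*≡* eq) = ≡.trans (≡.sym (ℤ.*-identityʳ a)) eq

clear-denominator : ∀ q → (+ suc (ℚ.denominator-1 q)) ℚ./ 1 ℚ.* q ≡ ℚ.numerator q ℚ./ 1
clear-denominator q@(mkℚ n d-1 _) = ℚ.toℚᵘ-injective (begin
  ℚ.toℚᵘ ((+ suc d-1) ℚ./ 1 ℚ.* q)           ≈⟨ ℚ.toℚᵘ-homo-* ((+ suc d-1) ℚ./ 1) q ⟩
  ℚ.toℚᵘ ((+ suc d-1) ℚ./ 1) ℚᵘ.* mkℚᵘ n d-1 ≈⟨ ℚᵘ.*-congʳ (toℚᵘ-integer (+ suc d-1)) ⟩
  mkℚᵘ (+ suc d-1) 0 ℚᵘ.* mkℚᵘ n d-1         ≈⟨ *≡* cross ⟩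
  mkℚᵘ n 0                                   ≈⟨ toℚᵘ-integer n ⟨
  ℚ.toℚᵘ (n ℚ./ 1)                           ∎)
  where
  open import Relation.Binary.Reasoning.Setoid ℚᵘ.≃-setoid
  cross : (+ suc d-1 ℤ.* n) ℤ.* 1ℤ ≡ n ℤ.* + suc (d-1 ℕ.+ 0)
  cross = ≡.trans (ℤ.*-identityʳ _) (≡.trans (ℤ.*-comm (+ suc d-1) n) (≡.cong (λ k → n ℤ.* + suc k) (≡.sym (ℕ.+-identityʳ d-1))))

ℚ→ℝ-injective : ∀ {p q} → ℚ→ℝ p ≈ℝ ℚ→ℝ q → p ≡ q
ℚ→ℝ-injective {p} {q} p≈q with p ℚ.≟ q
... | yes p≡q = p≡q
-- Closeness of the constant sequences at ε = |p - q| would read |p - q| < |p - q|.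
... | no  p≢q = contradiction (proj₂ (close p≈q ℚ.∣ p ℚ.- q ∣ ∣p-q∣>0) _ ℕ.≤-refl) (ℚ.<-irrefl refl)
  where
  open ℚ-Solver
  identity : ∀ a b → (a ℚ.- b) ℚ.+ b ≡ a
  identity = solve 2 (λ a b → (a :- b) :+ b := a) refl
  ∣p-q∣>0 : 0ℚ ℚ.< ℚ.∣ p ℚ.- q ∣
  ∣p-q∣>0 = ℚ.≰⇒> λ ∣p-q∣≤0 → p≢q (≡.trans (≡.sym (identity p q)) (≡.trans
    (≡.cong (ℚ._+ q) (ℚ.∣p∣≡0⇒p≡0 (p ℚ.- q) (ℚ.≤-antisym ∣p-q∣≤0 (ℚ.0≤∣p∣ (p ℚ.- q))))) (ℚ.+-identityˡ q)))

module _ (R : CommutativeRing 0ℓ 0ℓ) where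
  open CommutativeRing R

  mkIsRingHomomorphism : (ι : ℤ → Carrier) → (∀ {a b} → a ≡ b → ι a ≈ ι b) →
    (∀ a b → ι (a ℤ.+ b) ≈ ι a + ι b) → (∀ a b → ι (a ℤ.* b) ≈ ι a * ι b) → (∀ a → ι (ℤ.- a) ≈ - ι a) →
    ι 0ℤ ≈ 0# → ι 1ℤ ≈ 1# → RingMorphisms.IsRingHomomorphism ℤ-rawRing rawRing ι
  mkIsRingHomomorphism ι ι-cong +-homo *-homo neg-homo 0-homo 1-homo = record
    { isSemiringHomomorphism = record
      { isNearSemiringHomomorphism = record
        { +-isMonoidHomomorphism = record
          { isMagmaHomomorphism = record { isRelHomomorphism = record { cong = ι-cong } ; homo = +-homo }
          ; ε-homo              = 0-homo
          }
        ; *-homo = *-homo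
        }
      ; 1#-homo = 1-homo
      }
    ; -‿homo = neg-homo
    }

ℤ→ℝ : ℤ → ℝ
ℤ→ℝ a = ℚ→ℝ (a ℚ./ 1)

ℤ→ℝ-isRingHomomorphism : RingMorphisms.IsRingHomomorphism ℤ-rawRing (CommutativeRing.rawRing ℝ-ring) ℤ→ℝ
ℤ→ℝ-isRingHomomorphism = mkIsRingHomomorphism ℝ-ring ℤ→ℝ
  (λ { refl → CommutativeRing.refl ℝ-ring })
  (λ a b → pointwise (λ _ → integer-+ a b)) (λ a b → pointwise (λ _ → integer-* a b)) (λ a → pointwise (λ _ → integer-neg a))
  (pointwise (λ _ → refl)) (pointwise (λ _ → refl))

open Over.GaussianIdentities ℝ-ring ℤ→ℝ ℤ→ℝ-isRingHomomorphism

private module ℝ-Ring = CommutativeRing ℝ-ring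

≈ℂ-isEquivalence : IsEquivalence _≈ℂ_
≈ℂ-isEquivalence = record
  { refl  = ℝ-Ring.refl , ℝ-Ring.refl
  ; sym   = λ (r , i) → ℝ-Ring.sym r , ℝ-Ring.sym i
  ; trans = λ (r , i) (r′ , i′) → ℝ-Ring.trans r r′ , ℝ-Ring.trans i i′
  }

ℂ-ring : CommutativeRing 0ℓ 0ℓ
ℂ-ring = record
  { _≈_ = _≈ℂ_ ; _+_ = _+ℂ_ ; _*_ = _*ℂ_ ; -_ = -ℂ_ ; 0# = 0ℂ ; 1# = 1ℂ
  ; isCommutativeRing = mkIsCommutativeRing ≈ℂ-isEquivalence
      (λ (r , i) (r′ , i′) → +ℝ-cong r r′ , +ℝ-cong i i′)
      (λ x y z → ℝ-Ring.+-assoc _ _ _ , ℝ-Ring.+-assoc _ _ _)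
      (λ x y → ℝ-Ring.+-comm _ _ , ℝ-Ring.+-comm _ _)
      (λ x → ℝ-Ring.+-identityˡ _ , ℝ-Ring.+-identityˡ _)
      (λ x → ℝ-Ring.-‿inverseˡ _ , ℝ-Ring.-‿inverseˡ _)
      (λ (r , i) → -ℝ-cong r , -ℝ-cong i)
      (λ (r , i) (r′ , i′) → +ℝ-cong (*ℝ-cong r r′) (-ℝ-cong (*ℝ-cong i i′)) , +ℝ-cong (*ℝ-cong r i′) (*ℝ-cong i r′))
      (λ x y z → assoc-re (re x) (im x) (re y) (im y) (re z) (im z) , assoc-im (re x) (im x) (re y) (im y) (re z) (im z))
      (λ x y → comm-re (re x) (im x) (re y) (im y) , comm-im (re x) (im x) (re y) (im y))
      (λ x → identity-re (re x) (im x) , identity-im (re x) (im x))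
      (λ x y z → distrib-re (re x) (im x) (re y) (im y) (re z) (im z) , distrib-im (re x) (im x) (re y) (im y) (re z) (im z))
  }

ℚ→ℂ-+ : ∀ p q → ℚ→ℂ (p ℚ.+ q) ≈ℂ ℚ→ℂ p +ℂ ℚ→ℂ q
ℚ→ℂ-+ p q = pointwise (λ _ → refl) , pointwise (λ _ → refl)

ℚ→ℂ-* : ∀ p q → ℚ→ℂ (p ℚ.* q) ≈ℂ ℚ→ℂ p *ℂ ℚ→ℂ q
ℚ→ℂ-* p q = pointwise (λ _ → real p q) , pointwise (λ _ → imaginary p q)
  where
  open ℚ-Solver
  real : ∀ p q → p ℚ.* q ≡ p ℚ.* q ℚ.+ ℚ.- (0ℚ ℚ.* 0ℚ)
  real = solve 2 (λ p q → p :* q := p :* q :+ :- (con 0ℚ :* con 0ℚ)) refl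
  imaginary : ∀ p q → 0ℚ ≡ p ℚ.* 0ℚ ℚ.+ 0ℚ ℚ.* q
  imaginary = solve 2 (λ p q → con 0ℚ := p :* con 0ℚ :+ con 0ℚ :* q) refl

ℚ→ℂ-cong : ∀ {p q} → p ≡ q → ℚ→ℂ p ≈ℂ ℚ→ℂ q
ℚ→ℂ-cong refl = CommutativeRing.refl ℂ-ring

ℤ→ℂ-isRingHomomorphism : RingMorphisms.IsRingHomomorphism ℤ-rawRing (CommutativeRing.rawRing ℂ-ring) ℤ→ℂ
ℤ→ℂ-isRingHomomorphism = mkIsRingHomomorphism ℂ-ring ℤ→ℂ
  (λ { refl → CommutativeRing.refl ℂ-ring })
  (λ a b → ≈ℂ-trans (ℚ→ℂ-cong (integer-+ a b)) (ℚ→ℂ-+ (a ℚ./ 1) (b ℚ./ 1)))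
  (λ a b → ≈ℂ-trans (ℚ→ℂ-cong (integer-* a b)) (ℚ→ℂ-* (a ℚ./ 1) (b ℚ./ 1)))
  (λ a → pointwise (λ _ → integer-neg a) , pointwise (λ _ → refl))
  (pointwise (λ _ → refl) , pointwise (λ _ → refl)) (pointwise (λ _ → refl) , pointwise (λ _ → refl))
  where open CommutativeRing ℂ-ring using () renaming (trans to ≈ℂ-trans)

torsionFree-ℂ : ∀ k {x} → k ≢ 0ℤ → ℤ→ℂ k *ℂ x ≈ℂ 0ℂ → x ≈ℂ 0ℂ
torsionFree-ℂ k {x} k≢0 kx≈0 = begin
  x                                ≈⟨ *-identityˡ x ⟨
  1ℂ *ℂ x                          ≈⟨ *-congʳ (ℚ→ℂ-cong (ℚ.*-inverseˡ (k ℚ./ 1))) ⟨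
  ℚ→ℂ (k⁻¹ ℚ.* (k ℚ./ 1)) *ℂ x     ≈⟨ *-congʳ (ℚ→ℂ-* k⁻¹ (k ℚ./ 1)) ⟩
  ℚ→ℂ k⁻¹ *ℂ ℤ→ℂ k *ℂ x            ≈⟨ *-assoc _ _ _ ⟩
  ℚ→ℂ k⁻¹ *ℂ (ℤ→ℂ k *ℂ x)          ≈⟨ *-congˡ kx≈0 ⟩
  ℚ→ℂ k⁻¹ *ℂ 0ℂ                    ≈⟨ zeroʳ _ ⟩
  0ℂ                               ∎
  where
  open CommutativeRing ℂ-ring hiding (zero)
  open import Relation.Binary.Reasoning.Setoid setoid
  instance
    k-nonZero : ℚ.NonZero (k ℚ./ 1)
    k-nonZero = ℚ.≢-nonZero (λ eq → k≢0 (integer-injective k eq))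
  k⁻¹ : ℚ
  k⁻¹ = ℚ.1/ (k ℚ./ 1)

module C where
  open CommutativeRing ℂ-ring public renaming (refl to ≈-refl; sym to ≈-sym; trans to ≈-trans) hiding (zero)
  open RingProperties ring public using (-‿distribʳ-*; -‿+-comm; -0#≈0#)
  open AbelianGroupProperties +-abelianGroup public using () renaming (x≈y⇒x∙y⁻¹≈ε to x≈y⇒x-y≈0)
  open CommutativeSemigroupProperties +-commutativeSemigroup public using (interchange)
open C using (≈-refl; ≈-sym; ≈-trans)

-- Linear maps as isomorphisms of complex tori.

infix 4 _≋_
_≋_ : ∀ {g} → ℂ^ g → ℂ^ g → Set
v ≋ w = ∀ i → v i ≈ℂ w i

weightedSum : ∀ {g} → ℂ^ g → ℂ^ g → ℂ
weightedSum d v = Vector.foldr _+ℂ_ 0ℂ (Vector.zipWith _*ℂ_ d v)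

weightedSum-cong : ∀ {g} (d : ℂ^ g) {v w} → v ≋ w → weightedSum d v ≈ℂ weightedSum d w
weightedSum-cong {zero}  d v≋w = ≈-refl
weightedSum-cong {suc g} d v≋w = C.+-cong (C.*-congˡ (v≋w zero)) (weightedSum-cong (λ i → d (suc i)) (λ i → v≋w (suc i)))

weightedSum-+ : ∀ {g} (d v w : ℂ^ g) → weightedSum d (λ i → v i +ℂ w i) ≈ℂ weightedSum d v +ℂ weightedSum d w
weightedSum-+ {zero}  d v w = ≈-sym (C.+-identityʳ 0ℂ)
weightedSum-+ {suc g} d v w = ≈-trans
  (C.+-cong (C.distribˡ _ _ _) (weightedSum-+ (λ i → d (suc i)) (λ i → v (suc i)) (λ i → w (suc i))))
  (C.interchange _ _ _ _)

weightedSum-neg : ∀ {g} (d v : ℂ^ g) → weightedSum d (λ i → -ℂ v i) ≈ℂ -ℂ weightedSum d v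
weightedSum-neg {zero}  d v = ≈-sym C.-0#≈0#
weightedSum-neg {suc g} d v = ≈-trans
  (C.+-cong (≈-sym (C.-‿distribʳ-* _ _)) (weightedSum-neg (λ i → d (suc i)) (λ i → v (suc i))))
  (C.-‿+-comm _ _)

weightedSum-zero : ∀ {g} (d : ℂ^ g) → weightedSum d (λ _ → 0ℂ) ≈ℂ 0ℂ
weightedSum-zero {zero}  d = ≈-refl
weightedSum-zero {suc g} d = ≈-trans (C.+-cong (C.zeroʳ _) (weightedSum-zero (λ i → d (suc i)))) (C.+-identityʳ 0ℂ)

matrix₂ : ℂ → ℂ → ℂ → ℂ → Linear 2 2
matrix₂ a b c d zero       zero       = a
matrix₂ a b c d zero       (suc zero) = b
matrix₂ a b c d (suc zero) zero       = c
matrix₂ a b c d (suc zero) (suc zero) = d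

module _ {g h} (M : Linear g h) where

  apply-- : ∀ v w → apply M (v -ᵛ w) ≋ (apply M v -ᵛ apply M w)
  apply-- v w i = ≈-trans (weightedSum-+ (M i) v (λ j → -ℂ w j)) (C.+-congˡ (weightedSum-neg (M i) w))

∣∣²-zero : ∀ {x} → x ≈ℂ 0ℂ → ∣ x ∣² ≈ℝ 0ℝ
∣∣²-zero (re≈0 , im≈0) = ℝ-Ring.trans
  (ℝ-Ring.+-cong (ℝ-Ring.trans (ℝ-Ring.*-cong re≈0 re≈0) (ℝ-Ring.zeroˡ 0ℝ)) (ℝ-Ring.trans (ℝ-Ring.*-cong im≈0 im≈0) (ℝ-Ring.zeroˡ 0ℝ)))
  (ℝ-Ring.+-identityʳ 0ℝ)

‖‖²-zero : ∀ {g} {v : ℂ^ g} → v ≋ (λ _ → 0ℂ) → ‖ v ‖² ≈ℝ 0ℝ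
‖‖²-zero {zero}  v≋0 = ℝ-Ring.refl
‖‖²-zero {suc g} v≋0 = ℝ-Ring.trans (ℝ-Ring.+-cong (∣∣²-zero (v≋0 zero)) (‖‖²-zero (λ i → v≋0 (suc i)))) (ℝ-Ring.+-identityʳ 0ℝ)

square-nonNegative : ∀ q → 0ℚ ℚ.≤ q ℚ.* q
square-nonNegative q = ≡.subst (0ℚ ℚ.≤_) square (ℚ.nonNegative⁻¹ _
  {{ℚ.nonNeg*nonNeg⇒nonNeg ℚ.∣ q ∣ {{∣q∣-nonNeg}} ℚ.∣ q ∣ {{∣q∣-nonNeg}}}})
  where
  ∣q∣-nonNeg : ℚ.NonNegative ℚ.∣ q ∣
  ∣q∣-nonNeg = ℚ.nonNegative (ℚ.0≤∣p∣ q)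
  square : ℚ.∣ q ∣ ℚ.* ℚ.∣ q ∣ ≡ q ℚ.* q
  square with ℚ.∣p∣≡p∨∣p∣≡-p q
  ... | inj₁ eq = ≡.cong₂ ℚ._*_ eq eq
  ... | inj₂ eq = ≡.trans (≡.cong₂ ℚ._*_ eq eq) (solve 1 (λ q → :- q :* :- q := q :* q) refl q)
    where open ℚ-Solver

‖‖²-nonNegative : ∀ {g} (v : ℂ^ g) k → 0ℚ ℚ.≤ seq ‖ v ‖² k
‖‖²-nonNegative {zero}  v k = ℚ.≤-refl
‖‖²-nonNegative {suc g} v k = ℚ.+-mono-≤
  (ℚ.+-mono-≤ (square-nonNegative (seq (re (v zero)) k)) (square-nonNegative (seq (im (v zero)) k)))
  (‖‖²-nonNegative (λ i → v (suc i)) k)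

zero≤nonNegative : ∀ x y → x ≈ℝ 0ℝ → (∀ k → 0ℚ ℚ.≤ seq y k) → x ≤ℝ y
zero≤nonNegative x y x≈0 y≥0 ε ε>0 = let N , small = close x≈0 ε ε>0 in N , λ k N≤k →
  ℚ.≤-trans (p≤∣p∣ (seq x k)) (ℚ.≤-trans (ℚ.<⇒≤ (≡.subst (λ q → ℚ.∣ q ∣ ℚ.< ε) (ℚ.+-identityʳ (seq x k)) (small k N≤k)))
    (≡.subst (ℚ._≤ seq y k ℚ.+ ε) (ℚ.+-identityˡ ε) (ℚ.+-monoˡ-≤ ε (y≥0 k))))
  where
  p≤∣p∣ : ∀ p → p ℚ.≤ ℚ.∣ p ∣
  p≤∣p∣ p with ℚ.≤-total 0ℚ p
  ... | inj₁ 0≤p = ℚ.≤-reflexive (≡.sym (ℚ.0≤p⇒∣p∣≡p 0≤p))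
  ... | inj₂ p≤0 = ℚ.≤-trans p≤0 (ℚ.0≤∣p∣ p)

-- Not automatic, because a Torus carries no proof that its Λ is a lattice.
record Respectful {g} (T : Torus g) : Set where
  field
    zero∈ : (λ _ → 0ℂ) ∈ Λ T
    resp∈ : ∀ {v w} → v ≋ w → v ∈ Λ T → w ∈ Λ T

  equal⇒congruent : ∀ {v w} → v ≋ w → (v -ᵛ w) ∈ Λ T
  equal⇒congruent v≋w = resp∈ (λ i → ≈-sym (C.x≈y⇒x-y≈0 (v≋w i))) zero∈

open Respectful

-- A linear map is its own lift and its own derivative, so the error term is 0 and every radius
-- works; 1 is taken.
apply-holomorphic : ∀ {g h} (T : Torus g) (T′ : Torus h) → Respectful T′ → (M : Linear g h) → Holomorphic T T′ (apply M)
apply-holomorphic T T′ T′-resp M p = 1ℚ , ℚ.positive⁻¹ 1ℚ , apply M , λ q _ →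
  equal⇒congruent T′-resp (λ _ → ≈-refl) , M , λ ε ε>0 → 1ℚ , ℚ.positive⁻¹ 1ℚ , λ q′ _ →
    zero≤nonNegative ‖ (apply M q′ -ᵛ apply M q) -ᵛ apply M (q′ -ᵛ q) ‖² (ℚ→ℝ (ε ℚ.* ε) *ℝ ‖ q′ -ᵛ q ‖²)
      (‖‖²-zero λ i → C.x≈y⇒x-y≈0 (≈-sym (apply-- M q′ q i)))
      (λ k → ℚ.nonNegative⁻¹ _ {{ℚ.nonNeg*nonNeg⇒nonNeg (ε ℚ.* ε) {{ℚ.nonNegative (square-nonNegative ε)}}
        (seq ‖ q′ -ᵛ q ‖² k) {{ℚ.nonNegative (‖‖²-nonNegative (q′ -ᵛ q) k)}}}})

linearIsomorphism : ∀ {g h} {T : Torus g} {T′ : Torus h} → Respectful T → Respectful T′ →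
  (M : Linear g h) (N : Linear h g) →
  (∀ {v} → v ∈ Λ T → apply M v ∈ Λ T′) → (∀ {v} → v ∈ Λ T′ → apply N v ∈ Λ T) →
  (∀ v → apply M (apply N v) ≋ v) → (∀ v → apply N (apply M v) ≋ v) → T ≅ T′
linearIsomorphism {T = T} {T′} T-resp T′-resp M N M-integral N-integral MN≋id NM≋id = record
  { to              = apply M
  ; from            = apply N
  ; from-cong       = λ {v} {w} → N-cong v w
  ; to-homomorphism = record
    { isMonoidHomomorphism = record
      { isMagmaHomomorphism = record
        { isRelHomomorphism = record { cong = λ {v} {w} → M-cong v w }
        ; homo = λ v w → equal⇒congruent T′-resp (λ i → weightedSum-+ (M i) v w)
        }
      ; ε-homo = equal⇒congruent T′-resp (λ i → weightedSum-zero (M i))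
      }
    ; ⁻¹-homo = λ v → equal⇒congruent T′-resp (λ i → weightedSum-neg (M i) v)
    }
  ; inverse =
      (λ {x} {y} y≈Nx → resp∈ T′-resp (λ i → C.+-congˡ (C.-‿cong (MN≋id x i))) (M-cong y (apply N x) y≈Nx))
    , (λ {x} {y} y≈Mx → resp∈ T-resp (λ i → C.+-congˡ (C.-‿cong (NM≋id x i))) (N-cong y (apply M x) y≈Mx))
  ; to-holomorphic   = apply-holomorphic T T′ T′-resp M
  ; from-holomorphic = apply-holomorphic T′ T T-resp N
  }
  where
  M-cong : ∀ v w → (v -ᵛ w) ∈ Λ T → (apply M v -ᵛ apply M w) ∈ Λ T′
  M-cong v w v-w∈ = resp∈ T′-resp (apply-- M v w) (M-integral v-w∈)
  N-cong : ∀ v w → (v -ᵛ w) ∈ Λ T′ → (apply N v -ᵛ apply N w) ∈ Λ T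
  N-cong v w v-w∈ = resp∈ T-resp (apply-- N v w) (N-integral v-w∈)

open Over ℂ-ring ℤ→ℂ ℤ→ℂ-isRingHomomorphism
open RingMorphisms.IsRingHomomorphism ℤ→ℂ-isRingHomomorphism
  using (+-homo; *-homo; -‿homo; 0#-homo; 1#-homo) renaming (⟦⟧-cong to ι-cong)
private
  ι : ℤ → ℂ
  ι = ℤ→ℂ

open LatticeIdentities

-- Integral elements, the field K and conductors.

-- The coefficient of Xⁱ in a monic polynomial of degree n is multiplied by kⁿ⁻ⁱ, which turns a root
-- x into the root kx.
scaleRoot : ℤ → List ℤ → List ℤ
scaleRoot k []       = []
scaleRoot k (c ∷ cs) = c ℤ.* (k ℤ.* k ℤ.^ length cs) ∷ scaleRoot k cs

evalMonic-scaleRoot : ∀ k cs x → evalMonic (scaleRoot k cs) (ι k *ℂ x) ≈ℂ ι (k ℤ.^ length cs) *ℂ evalMonic cs x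
evalMonic-scaleRoot k []       x = ≈-sym (C.*-identityˡ 1ℂ)
evalMonic-scaleRoot k (c ∷ cs) x = ≈-trans
  (C.+-cong (≈-trans (*-homo c _) (C.*-congˡ (*-homo k _))) (C.*-congˡ (evalMonic-scaleRoot k cs x)))
  (≈-trans (monic-step (ι c) (ι k) (ι (k ℤ.^ length cs)) x (evalMonic cs x)) (C.*-congʳ (≈-sym (*-homo k _))))

integral-scale : ∀ k {x} → x ∈ IntegralOverℤ → (ι k *ℂ x) ∈ IntegralOverℤ
integral-scale k {x} (cs , eq) = scaleRoot k cs , ≈-trans (evalMonic-scaleRoot k cs x) (≈-trans (C.*-congˡ eq) (C.zeroʳ _))

lattice-independent : ∀ {τ} → IsLattice (ℤ 1ℂ +ℤ τ) → Independent τ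
lattice-independent {τ} (ω₁ , ω₂ , ℝ-independent , L⊆ , L⊇) =
  let α , β , 1≈ = L⊆ (first-generator 1ℂ τ)
      γ , δ , τ≈ = L⊆ (second-generator 1ℂ τ)
      a , b , ω₁≈ = L⊇ (first-generator ω₁ ω₂)
      c , d , ω₂≈ = L⊇ (second-generator ω₁ ω₂)
  in Basis.basis-independent ω₁ ω₂ τ ℤ-independent a b c d α β γ δ ω₁≈ ω₂≈ 1≈ τ≈
  where
  ℤ-independent : ∀ a b → ι a *ℂ ω₁ +ℂ ι b *ℂ ω₂ ≈ℂ 0ℂ → a ≡ 0ℤ × b ≡ 0ℤ
  ℤ-independent a b eq = let a≈0 , b≈0 = ℝ-independent (ℤ→ℝ a) (ℤ→ℝ b) eq in
    integer-injective a (ℚ→ℝ-injective a≈0) , integer-injective b (ℚ→ℝ-injective b≈0)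

module _ (K : ImaginaryQuadraticField) where
  private module K = ImaginaryQuadraticField K

  natural∈K : ∀ k → ι (+ k) ∈ elements K
  -- Membership of 0 is obtained as that of 1 - 1.
  natural∈K zero    = K.resp-≈ (C.-‿inverseʳ 1ℂ) (K.+-closed K.1-closed (K.neg-closed K.1-closed))
  natural∈K (suc k) = K.resp-≈ (≈-sym (+-homo 1ℤ (+ k))) (K.+-closed K.1-closed (natural∈K k))

  integer∈K : ∀ k → ι k ∈ elements K
  integer∈K (+ k)    = natural∈K k
  integer∈K -[1+ k ] = K.resp-≈ (≈-sym (-‿homo (+ suc k))) (K.neg-closed (natural∈K (suc k)))

  K-span : ∀ {x} → x ∈ elements K → ∃ λ d → ∃₂ λ m m′ → d ≢ 0ℤ × ι d *ℂ x ≈ℂ ι m *ℂ K.b₁ +ℂ ι m′ *ℂ K.b₂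
  K-span {x} x∈ =
    let p , q , x≈ = K.spanning x∈
        d = + suc (ℚ.denominator-1 p)
        e = + suc (ℚ.denominator-1 q)
    in d ℤ.* e , ℚ.numerator p ℤ.* e , ℚ.numerator q ℤ.* d , (λ ())
     , ≈-trans (C.*-cong (*-homo d e) x≈) (≈-trans (clear-identity (ι d) (ι e) (ℚ→ℂ p) (ℚ→ℂ q) K.b₁ K.b₂)
         (C.+-cong (C.*-congʳ (cleared p e)) (C.*-congʳ (cleared q d))))
    where
    cleared : ∀ q k → ι (+ suc (ℚ.denominator-1 q)) *ℂ ℚ→ℂ q *ℂ ι k ≈ℂ ι (ℚ.numerator q ℤ.* k)
    cleared q k = ≈-trans (C.*-congʳ (≈-trans (≈-sym (ℚ→ℂ-* _ q)) (ℚ→ℂ-cong (clear-denominator q)))) (≈-sym (*-homo (ℚ.numerator q) k))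

  -- The two inclusions of the conductor hypothesis in coordinates: `generator` says that the
  -- multiplier Aτ lies in 𝒪_f, and `coordinates` that the elements fγ of 𝒪_f are multipliers.
  record QuadraticData (τ : ℂ) (f : ℕ) : Set where
    field
      A B C       : ℤ
      A≢0         : A ≢ 0ℤ
      content     : NoCommonPrime (A ∷ B ∷ C ∷ [])
      root        : ι A *ℂ (τ *ℂ τ) +ℂ ι B *ℂ τ +ℂ ι C ≈ℂ 0ℂ
      a           : ℤ
      β           : ℂ
      β∈          : β ∈ 𝒪 K
      generator   : ι A *ℂ τ ≈ℂ ι a +ℂ ι (+ f) *ℂ β
      coordinates : ∀ {γ} → γ ∈ 𝒪 K → Rank₂ (ι A *ℂ τ) (ι (+ f) *ℂ γ)

  quadraticData : ∀ {τ f} → τ ∈ elements K → Independent τ → HasConductor K (ℤ 1ℂ +ℤ τ) f → QuadraticData τ f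
  quadraticData {τ} {f} τ∈ independent (_ , Mult⊆ , Mult⊇) =
    let d₁ , m₁ , m₁′ , d₁≢0 , span₁ = K-span K.1-closed
        d₂ , m₂ , m₂′ , d₂≢0 , span₂ = K-span τ∈
        d₃ , m₃ , m₃′ , d₃≢0 , span₃ = K-span (K.*-closed τ∈ τ∈)
    in withRelation (primitive-relation K.b₁ K.b₂ d₁ m₁ m₁′ d₂ m₂ m₂′ d₃ m₃ m₃′ d₁≢0 d₂≢0 d₃≢0 span₁ span₂ span₃)
    where
    open Quadratic torsionFree-ℂ τ independent
    withRelation : (∃ λ A → ∃₂ λ B C → A ≢ 0ℤ × NoCommonPrime (A ∷ B ∷ C ∷ []) ×
      ι A *ℂ (τ *ℂ τ) +ℂ ι B *ℂ τ +ℂ ι C ≈ℂ 0ℂ) → QuadraticData τ f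
    withRelation (A , B , C , A≢0 , content , root) =
      let a , β , β∈ , generator = Mult⊆ {ι A *ℂ τ}
            (K.*-closed (integer∈K A) τ∈ , λ x∈ → rank₂⇒lattice (multiplier⇐ A B C content root (lattice⇒rank₂ x∈)))
      in record
      { A = A ; B = B ; C = C ; A≢0 = A≢0 ; content = content ; root = root
      ; a = a ; β = β ; β∈ = β∈ ; generator = generator
      ; coordinates = λ {γ} γ∈ →
          let _ , preserves = Mult⊇ {ι (+ f) *ℂ γ} (0ℤ , γ , γ∈ , ≈-sym (≈-trans (C.+-congʳ 0#-homo) (C.+-identityˡ _)))
          in multiplier⇒ A B C content root
               (rank₂-resp (C.*-identityʳ _) (lattice⇒rank₂ (preserves (first-generator 1ℂ τ))))
               (lattice⇒rank₂ (preserves (second-generator 1ℂ τ)))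
      }

-- The gcd and lcm of the two conductors.

record GcdLcm (f₁ f₂ : ℕ) : Set where
  field
    g h₁ h₂ : ℕ
    f₁≡     : f₁ ≡ h₁ ℕ.* g
    f₂≡     : f₂ ≡ h₂ ℕ.* g
    g≢0     : + g ≢ 0ℤ
    h₁≢0    : + h₁ ≢ 0ℤ
    h₂≢0    : + h₂ ≢ 0ℤ
    coprime : NoCommonPrime (+ h₁ ∷ + h₂ ∷ [])
    lcm≡    : lcm f₁ f₂ ≡ h₂ ℕ.* f₁

gcdLcm : ∀ f₁ f₂ → 1 ℕ.≤ f₁ → 1 ℕ.≤ f₂ → GcdLcm f₁ f₂
gcdLcm f₁ f₂ f₁≥1 f₂≥1 = factor (gcd[m,n]∣m f₁ f₂) (gcd[m,n]∣n f₁ f₂)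
  where
  g = gcd f₁ f₂
  factor : g ℕ.∣ f₁ → g ℕ.∣ f₂ → GcdLcm f₁ f₂
  factor (ℕ.divides h₁ f₁≡) (ℕ.divides h₂ f₂≡) = record
    { g = g ; h₁ = h₁ ; h₂ = h₂ ; f₁≡ = f₁≡ ; f₂≡ = f₂≡
    ; g≢0  = λ +g≡0 → f₁≢0 (≡.trans f₁≡ (≡.trans (≡.cong (h₁ ℕ.*_) (ℤ.+-injective +g≡0)) (ℕ.*-zeroʳ h₁)))
    ; h₁≢0 = λ +h≡0 → f₁≢0 (≡.trans f₁≡ (≡.cong (ℕ._* g) (ℤ.+-injective +h≡0)))
    ; h₂≢0 = λ +h≡0 → f₂≢0 (≡.trans f₂≡ (≡.cong (ℕ._* g) (ℤ.+-injective +h≡0)))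
    ; coprime = λ p p-prime → λ where
        (p∣h₁ ∷ p∣h₂ ∷ []) → prime-∤-1 p-prime (∣ᵤ⇒∣ (ℕ.*-cancelʳ-∣ g (ℕ.∣-trans
          (gcd-greatest (≡.subst (p ℕ.* g ℕ.∣_) (≡.sym f₁≡) (ℕ.*-monoˡ-∣ g (∣⇒∣ᵤ p∣h₁)))
                        (≡.subst (p ℕ.* g ℕ.∣_) (≡.sym f₂≡) (ℕ.*-monoˡ-∣ g (∣⇒∣ᵤ p∣h₂))))
          (ℕ.∣-reflexive (≡.sym (ℕ.*-identityˡ g))))))
    ; lcm≡ = ℕ.*-cancelˡ-≡ (lcm f₁ f₂) (h₂ ℕ.* f₁) g (≡.trans (gcd*lcm f₁ f₂)
        (≡.trans (≡.cong (f₁ ℕ.*_) f₂≡) (≡.trans (ℕ.*-comm f₁ (h₂ ℕ.* g)) (≡.trans (≡.cong (ℕ._* f₁) (ℕ.*-comm h₂ g)) (ℕ.*-assoc g h₂ f₁)))))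
    }
    where
    f₁≢0 : f₁ ≢ 0
    f₁≢0 refl = contradiction f₁≥1 λ ()
    f₂≢0 : f₂ ≢ 0
    f₂≢0 refl = contradiction f₂≥1 λ ()
    instance
      g-nonZero : ℕ.NonZero g
      g-nonZero = ℕ.≢-nonZero (λ g≡0 → f₁≢0 (≡.trans f₁≡ (≡.trans (≡.cong (h₁ ℕ.*_) g≡0) (ℕ.*-zeroʳ h₁))))

module _ {τ₁ τ₂ : ℂ} where

  product⇒ : ∀ {x} → x ∈ (ℤ 1ℂ +ℤ τ₁) ·ᴸ (ℤ 1ℂ +ℤ τ₂) → ProductLattice τ₁ τ₂ x
  product⇒ (gen (u , w , u∈ , w∈ , x≈)) = product-lattice-* u∈ (lattice⇒rank₂ w∈) x≈
  product⇒ zero         = product-lattice-0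
  product⇒ (add x∈ y∈)  = product-lattice-+ (product⇒ x∈) (product⇒ y∈)
  product⇒ (neg x∈)     = product-lattice-neg (product⇒ x∈)
  product⇒ (resp x≈ x∈) = product-lattice-resp x≈ (product⇒ x∈)

  product⇐ : ∀ {x} → ProductLattice τ₁ τ₂ x → x ∈ (ℤ 1ℂ +ℤ τ₁) ·ᴸ (ℤ 1ℂ +ℤ τ₂)
  product⇐ (X , Y , X∈ , Y∈ , x≈) = resp (≈-sym x≈) (add
    (gen (1ℂ , X , first-generator 1ℂ τ₁ , rank₂⇒lattice X∈ , ≈-sym (C.*-identityˡ X)))
    (gen (τ₁ , Y , second-generator 1ℂ τ₁ , rank₂⇒lattice Y∈ , ≈-refl)))

module _ {g} (T : Torus g) where
  open RawMonoidDefinitions (RawGroup.rawMonoid (torusGroup T)) using () renaming (_×_ to _·_)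

  multiple-value : ∀ m v i → (m · v) i ≈ℂ ι (+ m) *ℂ v i
  multiple-value zero    v i = ≈-sym (C.zeroˡ (v i))
  multiple-value (suc m) v i = ≈-sym (≈-trans (C.*-congʳ (+-homo 1ℤ (+ m)))
    (≈-trans (suc-scale (ι (+ m)) (v i)) (C.+-congˡ (≈-sym (multiple-value m v i)))))

-- Spans in ℂᵍ and in its quotient tori differ only in the equality they respect.
module _ {g} (_~_ : ℂ^ g → ℂ^ g → Set) (≋⇒~ : ∀ {v w} → v ≋ w → v ~ w) {gens : Pred (ℂ^ g) 0ℓ} where
  private
    G : RawGroup 0ℓ 0ℓ
    G = record (ℂ^-rawGroup g) { _≈_ = _~_ }

  span-multiple : ∀ k {v} → v ∈ Span G gens → (λ i → ι (+ k) *ℂ v i) ∈ Span G gens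
  span-multiple zero    {v} v∈ = resp (≋⇒~ (λ i → ≈-sym (C.zeroˡ (v i)))) zero
  span-multiple (suc k) {v} v∈ = resp (≋⇒~ (λ i → ≈-sym (≈-trans (C.*-congʳ (+-homo 1ℤ (+ k))) (suc-scale (ι (+ k)) (v i)))))
    (add v∈ (span-multiple k v∈))

  span-scale : ∀ k {v} → v ∈ Span G gens → (λ i → ι k *ℂ v i) ∈ Span G gens
  span-scale (+ k)    v∈ = span-multiple k v∈
  span-scale -[1+ k ] {v} v∈ = resp (≋⇒~ (λ i → ≈-sym (≈-trans (C.*-congʳ (-‿homo (+ suc k))) (neg-scale (ι (+ suc k)) (v i)))))
    (neg (span-multiple (suc k) v∈))

-- From integer coordinates to the tori of the theorem.

module Assembly
  (K : ImaginaryQuadraticField) (τ₁ τ₂ z : ℂ) (independent₁ : Independent τ₁) (independent₂ : Independent τ₂)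
  (n h₁ h₂ A₁ B₁ C₁ A₂ B₂ C₂ r k₀ k₁ k₂ k₃ : ℤ)
  (n≢0 : n ≢ 0ℤ) (h₁≢0 : h₁ ≢ 0ℤ) (h₂≢0 : h₂ ≢ 0ℤ) (A₁≢0 : A₁ ≢ 0ℤ) (A₂≢0 : A₂ ≢ 0ℤ)
  (root₁ : ℤ→ℂ A₁ *ℂ (τ₁ *ℂ τ₁) +ℂ ℤ→ℂ B₁ *ℂ τ₁ +ℂ ℤ→ℂ C₁ ≈ℂ 0ℂ)
  (root₂ : ℤ→ℂ A₂ *ℂ (τ₂ *ℂ τ₂) +ℂ ℤ→ℂ B₂ *ℂ τ₂ +ℂ ℤ→ℂ C₂ ≈ℂ 0ℂ)
  (η-eq  : ℤ→ℂ h₂ *ℂ ℤ→ℂ A₁ *ℂ τ₁ ≈ℂ ℤ→ℂ h₁ *ℂ ℤ→ℂ A₂ *ℂ τ₂ +ℂ ℤ→ℂ r)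
  (nz-eq : ℤ→ℂ n *ℂ z ≈ℂ ℤ→ℂ k₀ *ℂ τ₂ +ℂ ℤ→ℂ k₁ +ℂ τ₁ *ℂ (ℤ→ℂ k₂ *ℂ τ₂ +ℂ ℤ→ℂ k₃))
  (a f : ℤ) (β : ℂ) (β∈ : β ∈ 𝒪 K)
  (generator   : ℤ→ℂ A₁ *ℂ τ₁ ≈ℂ ℤ→ℂ a +ℂ ℤ→ℂ f *ℂ β)
  (coordinates : ∀ {γ} → γ ∈ 𝒪 K → Rank₂ (ℤ→ℂ A₁ *ℂ τ₁) (ℤ→ℂ f *ℂ γ))
  (m : ℕ) (m-eq : ℤ→ℂ (+ m) ≈ℂ ℤ→ℂ n *ℂ (ℤ→ℂ h₂ *ℂ ℤ→ℂ f))
  where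

  open Extension torsionFree-ℂ τ₁ τ₂ z independent₁ independent₂ n h₁ h₂ A₁ B₁ C₁ A₂ B₂ C₂ r k₀ k₁ k₂ k₃
    n≢0 h₁≢0 h₂≢0 A₁≢0 A₂≢0 root₁ root₂ η-eq nz-eq

  private
    L̃ : Pred ℂ 0ℓ
    L̃ = (ℤ 1ℂ +ℤ τ₁) ·ᴸ (ℤ 1ℂ +ℤ τ₂)

    Ẽ Ẽ/P : Torus 1
    Ẽ   = ℂ/ L̃
    Ẽ/P = Ẽ /⟨ point z ⟩

  order⇒ : ∀ {x} → x ∈ 𝒪[ m ] K → Rank₂ ω x
  order⇒ (b , γ , γ∈ , x≈) = order-coordinates n h₂ A₁ f m-eq b γ x≈ (coordinates γ∈)

  order⇐ : ∀ {x} → Rank₂ ω x → x ∈ 𝒪[ m ] K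
  order⇐ (u , w , x≈) = w ℤ.+ u ℤ.* n ℤ.* h₂ ℤ.* a , ι u *ℂ β
    , (ImaginaryQuadraticField.*-closed K (integer∈K K u) (proj₁ β∈) , integral-scale u (proj₂ β∈))
    , order-element n h₂ A₁ f m-eq a generator u w x≈

  periods⇒ : ∀ {v} → v ∈ Λ (S τ₁ τ₂ z) → Periods (v zero) (v (suc zero))
  periods⇒ (gen (j , refl)) = column j
    where
    column : ∀ j → Periods (periodMatrix τ₁ τ₂ z zero j) (periodMatrix τ₁ τ₂ z (suc zero) j)
    column zero                   = ⟨ 1ℤ , 0ℤ , 0ℤ , 0ℤ ⟩ , unit₀ τ₂ z , unit₁ τ₁
    column (suc zero)             = ⟨ 0ℤ , 1ℤ , 0ℤ , 0ℤ ⟩ , unit₂ τ₂ z , unit₁ τ₁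
    column (suc (suc zero))       = ⟨ 0ℤ , 0ℤ , 1ℤ , 0ℤ ⟩ , unit₃ τ₂ z , unit₅ τ₁
    column (suc (suc (suc zero))) = ⟨ 0ℤ , 0ℤ , 0ℤ , 1ℤ ⟩ , unit₄ τ₂ z , unit₆ τ₁
  periods⇒ zero = ⟨ 0ℤ , 0ℤ , 0ℤ , 0ℤ ⟩ , unit₄ τ₂ z , unit₁ τ₁
  -- Sums and negatives are read off the ternary `periods-combine` as x + y + 0x and x - x - x.
  periods⇒ (add x∈ y∈) = periods-resp (add-identity _ _) (add-identity _ _)
    (periods-combine 1ℤ 0ℤ (periods⇒ x∈) (periods⇒ y∈) (periods⇒ x∈))
  periods⇒ (neg x∈) = periods-resp (neg-identity _) (neg-identity _)
    (periods-combine (ℤ.- 1ℤ) (ℤ.- 1ℤ) (periods⇒ x∈) (periods⇒ x∈) (periods⇒ x∈))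
  periods⇒ (resp x≈y x∈) = periods-resp (x≈y zero) (x≈y (suc zero)) (periods⇒ x∈)

  periods⇐ : ∀ {v} → Periods (v zero) (v (suc zero)) → v ∈ Λ (S τ₁ τ₂ z)
  periods⇐ {v} (⟨ a , b , c , d ⟩ , v₀≈ , v₁≈) = resp values
    (add (add (add (scaled a zero) (scaled b (suc zero))) (scaled c (suc (suc zero)))) (scaled d (suc (suc (suc zero)))))
    where
    scaled : ∀ k j → (λ i → ι k *ℂ periodMatrix τ₁ τ₂ z i j) ∈ Λ (S τ₁ τ₂ z)
    scaled k j = span-scale _≋_ (λ v≋w → v≋w) k (gen (j , refl))
    values : ∀ i → _ ≈ℂ v i
    values zero       = ≈-trans (column₀ (ι a) (ι b) (ι c) (ι d) τ₂ z) (≈-sym v₀≈)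
    values (suc zero) = ≈-trans (column₁ (ι a) (ι b) (ι c) (ι d) τ₁) (≈-sym v₁≈)

  product⇒determinants : ∀ {x} → x ∈ L̃ → Determinants x
  product⇒determinants x∈ = let X , Y , X∈ , Y∈ , x≈ = product⇒ x∈ in determinants-product X∈ Y∈ x≈

  determinants⇒ : ∀ {v} → v ∈ Λ Ẽ/P → Determinants (v zero)
  determinants⇒ (gen refl)     = determinants-z
  determinants⇒ zero           = determinants-resp 0#-homo determinants-zero
  determinants⇒ (add x∈ y∈)    = determinants-+ (determinants⇒ x∈) (determinants⇒ y∈)
  determinants⇒ (neg x∈)       = determinants-neg (determinants⇒ x∈)
  -- The span is taken in the torus group, so it respects congruence modulo L₁L₂: y = x - (x - y),
  -- with x - y in L₁L₂.
  determinants⇒ (resp {x} {y} x-y∈ x∈) = determinants-resp (difference-neg (x zero) (y zero))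
    (determinants-+ (determinants⇒ x∈) (determinants-neg (product⇒determinants x-y∈)))

  Ẽ-respectful : Respectful Ẽ
  Ẽ-respectful = record { zero∈ = zero ; resp∈ = λ v≋w v∈ → resp (v≋w zero) v∈ }

  determinants⇐ : ∀ {v} → Determinants (v zero) → v ∈ Λ Ẽ/P
  -- In the torus v equals the multiple kz of P, the rest of the determinant lying in L₁L₂.
  determinants⇐ {v} (a , b , c , d , k , v≈) = resp
    (resp (≈-trans (determinant-difference (ι k *ℂ z) w) (C.+-congˡ (C.-‿cong (≈-sym v≈))))
      (neg (product⇐ (ι a *ℂ τ₂ +ℂ ι b , ι c *ℂ τ₂ +ℂ ι d , (a , b , ≈-refl) , (c , d , ≈-refl) , ≈-refl))))
    (span-scale (λ v w → (v -ᵛ w) ∈ Λ Ẽ) (Respectful.equal⇒congruent Ẽ-respectful) k (gen refl))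
    where
    w : ℂ
    w = ι a *ℂ τ₂ +ℂ ι b +ℂ τ₁ *ℂ (ι c *ℂ τ₂ +ℂ ι d)

  source-respectful : Respectful (S τ₁ τ₂ z)
  source-respectful = record { zero∈ = zero ; resp∈ = λ v≋w v∈ → resp v≋w v∈ }

  target-respectful : Respectful ((ℂ/ 𝒪[ m ] K) ⊕ Ẽ/P)
  target-respectful = record
    { zero∈ = order⇐ (rank₂-integer 0ℤ) , zero
    ; resp∈ = λ {v} {w} v≋w (v₀∈ , v₁∈) → order⇐ (rank₂-resp (v≋w zero) (order⇒ v₀∈))
        , resp (Respectful.equal⇒congruent Ẽ-respectful {Vector.drop 1 v} {Vector.drop 1 w} (λ { zero → v≋w (suc zero) })) v₁∈
    }

  open MatrixIdentities

  isomorphism : Splitting → S τ₁ τ₂ z ≅ (ℂ/ 𝒪[ m ] K) ⊕ Ẽ/P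
  isomorphism splitting = linearIsomorphism source-respectful target-respectful forward backward
    (λ {x} x∈ → forward-integral x (periods⇒ x∈))
    (λ {x} (x₀∈ , x₁∈) → periods⇐ (periods-resp (row-N₀ (vec₀ v) q (x zero) (x (suc zero))) (row-N₁ (vec₁ v) p (x zero) (x (suc zero)))
      (inverse-integral (order⇒ x₀∈) (determinants⇒ x₁∈))))
    (λ x → λ where
      zero       → modulo₁ _ unit-rel (MN₀ p q (vec₀ v) (vec₁ v) (x zero) (x (suc zero)))
      (suc zero) → modulo₁ _ unit-rel (MN₁ p q (vec₀ v) (vec₁ v) (x zero) (x (suc zero))))
    (λ x → λ where
      zero       → modulo₁ _ unit-rel (NM₀ p q (vec₀ v) (vec₁ v) (x zero) (x (suc zero)))
      (suc zero) → modulo₁ _ unit-rel (NM₁ p q (vec₀ v) (vec₁ v) (x zero) (x (suc zero))))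
    where
    open Splitting splitting
    forward backward : Linear 2 2
    -- The first row is φ, the second the determinant with v; the matrix has determinant φ(v) = 1,
    -- and `backward` is its adjugate.
    forward  = matrix₂ p q (-ℂ vec₁ v) (vec₀ v)
    backward = matrix₂ (vec₀ v) (-ℂ q) (vec₁ v) p
    unit-rel : p *ℂ vec₀ v +ℂ q *ℂ vec₁ v -ℂ ι 1ℤ ≈ℂ 0ℂ
    unit-rel = C.x≈y⇒x-y≈0 unit
    forward-integral : ∀ x → Periods (x zero) (x (suc zero)) → apply forward x ∈ Λ ((ℂ/ 𝒪[ m ] K) ⊕ Ẽ/P)
    forward-integral x (u , x₀≈ , x₁≈) =
        order⇐ (rank₂-resp (≈-trans (C.+-cong (C.*-congˡ (≈-sym x₀≈)) (C.*-congˡ (≈-sym x₁≈))) (≈-sym (row-M₀ p q (x zero) (x (suc zero)))))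
          (φ-integral u))
      , determinants⇐ (determinants-resp (≈-trans (C.+-cong (C.*-congˡ (≈-sym x₁≈)) (C.-‿cong (C.*-congˡ (≈-sym x₀≈))))
          (≈-sym (row-M₁ (vec₀ v) (vec₁ v) (x zero) (x (suc zero))))) (det-integral u))

  conclusion :
    (∀ p → Prime p → + p ∣ n → ∀ x y → Rank₂ τ₂ x → Rank₂ τ₂ y → ¬ ℤ→ℂ n *ℂ z ≈ℂ ℤ→ℂ (+ p) *ℂ (x +ℂ τ₁ *ℂ y)) →
    NoCommonPrime (h₁ ∷ h₂ ∷ []) → NoCommonPrime (A₁ ∷ B₁ ∷ C₁ ∷ []) → NoCommonPrime (A₂ ∷ B₂ ∷ C₂ ∷ []) →
    S τ₁ τ₂ z ≅ (ℂ/ 𝒪[ m ] K) ⊕ Ẽ/P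
  conclusion order coprime content₁ content₂ = isomorphism (splitting order coprime content₁ content₂)

-- Passage from the conductor data of both lattices to coprime h₁ and h₂.

module _
  (K : ImaginaryQuadraticField) (τ₁ τ₂ z : ℂ) (independent₁ : Independent τ₁) (independent₂ : Independent τ₂)
  (f₁ f₂ n : ℕ) (data₁ : QuadraticData K τ₁ f₁) (data₂ : QuadraticData K τ₂ f₂) (factors : GcdLcm f₁ f₂)
  (n≢0 : + n ≢ 0ℤ)
  (order : ∀ p → Prime p → + p ∣ + n → ∀ x y → Rank₂ τ₂ x → Rank₂ τ₂ y → ¬ ℤ→ℂ (+ n) *ℂ z ≈ℂ ℤ→ℂ (+ p) *ℂ (x +ℂ τ₁ *ℂ y))
  where

  open GcdLcm factors
  open QuadraticData data₁ using () renaming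
    (A to A₁; B to B₁; C to C₁; A≢0 to A₁≢0; content to content₁; root to root₁; a to a₁; β to β₁; β∈ to β₁∈
    ; generator to generator₁; coordinates to coordinates₁)
  open QuadraticData data₂ using () renaming
    (A to A₂; B to B₂; C to C₂; A≢0 to A₂≢0; content to content₂; root to root₂; a to a₂; β to β₂; β∈ to β₂∈
    ; generator to generator₂; coordinates to coordinates₂)

  private
    ι-f₁ : ι (+ f₁) ≈ℂ ι (+ h₁) *ℂ ι (+ g)
    ι-f₁ = ≈-trans (ι-cong (≡.trans (≡.cong +_ f₁≡) (ℤ.pos-* h₁ g))) (*-homo (+ h₁) (+ g))

    ι-f₂ : ι (+ f₂) ≈ℂ ι (+ h₂) *ℂ ι (+ g)
    ι-f₂ = ≈-trans (ι-cong (≡.trans (≡.cong +_ f₂≡) (ℤ.pos-* h₂ g))) (*-homo (+ h₂) (+ g))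

    ι-nf : ι (+ (n ℕ.* lcm f₁ f₂)) ≈ℂ ι (+ n) *ℂ (ι (+ h₂) *ℂ ι (+ f₁))
    ι-nf = ≈-trans (ι-cong (≡.trans (ℤ.pos-* n (lcm f₁ f₂)) (≡.cong (+ n ℤ.*_) (≡.trans (≡.cong +_ lcm≡) (ℤ.pos-* h₂ f₁)))))
      (≈-trans (*-homo (+ n) (+ h₂ ℤ.* + f₁)) (C.*-congˡ (*-homo (+ h₂) (+ f₁))))

  -- Here t′ = ±1 compares the orientations of τ₁ and τ₂; it is absorbed into the equation of τ₂.
  oriented : ∀ t t′ s′ → t′ ℤ.* t ≡ 1ℤ →
    ι (+ h₂) *ℂ ι A₁ *ℂ τ₁ ≈ℂ ι (+ h₁) *ℂ ι (t′ ℤ.* A₂) *ℂ τ₂ +ℂ ι (+ h₂ ℤ.* a₁ ℤ.+ + h₁ ℤ.* s′) →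
    ProductLattice τ₁ τ₂ (ι (+ n) *ℂ z) →
    S τ₁ τ₂ z ≅ (ℂ/ 𝒪[ n ℕ.* lcm f₁ f₂ ] K) ⊕ ((ℂ/ ((ℤ 1ℂ +ℤ τ₁) ·ᴸ (ℤ 1ℂ +ℤ τ₂))) /⟨ point z ⟩)
  oriented t t′ s′ sign comparison (X , Y , (k₀ , k₁ , X≈) , (k₂ , k₃ , Y≈) , nz≈) =
    Assembly.conclusion K τ₁ τ₂ z independent₁ independent₂
      (+ n) (+ h₁) (+ h₂) A₁ B₁ C₁ (t′ ℤ.* A₂) (t′ ℤ.* B₂) (t′ ℤ.* C₂) (+ h₂ ℤ.* a₁ ℤ.+ + h₁ ℤ.* s′) k₀ k₁ k₂ k₃
      n≢0 h₁≢0 h₂≢0 A₁≢0 (*-≢0 t′≢0 A₂≢0) root₁ (root-rescale t′ A₂ B₂ C₂ root₂) comparison (≈-trans nz≈ (C.+-cong X≈ (C.*-congˡ Y≈)))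
      a₁ (+ f₁) β₁ β₁∈ generator₁ coordinates₁ (n ℕ.* lcm f₁ f₂) ι-nf
      order coprime content₁ content₂′
    where
    t′≢0 : t′ ≢ 0ℤ
    t′≢0 t′≡0 = contradiction (≡.trans (≡.sym sign) (≡.cong (ℤ._* t) t′≡0)) λ ()

    unscale : ∀ {p} x → + p ∣ t′ ℤ.* x → + p ∣ x
    unscale {p} x p∣t′x = ≡.subst (+ p ∣_)
      (≡.trans (≡.sym (ℤ.*-assoc t t′ x)) (≡.trans (≡.cong (ℤ._* x) (≡.trans (ℤ.*-comm t t′) sign)) (ℤ.*-identityˡ x)))
      (∣n⇒∣m*n t p∣t′x)

    content₂′ : NoCommonPrime (t′ ℤ.* A₂ ∷ t′ ℤ.* B₂ ∷ t′ ℤ.* C₂ ∷ [])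
    content₂′ p p-prime (p∣A ∷ p∣B ∷ p∣C ∷ []) = content₂ p p-prime (unscale A₂ p∣A ∷ unscale B₂ p∣B ∷ unscale C₂ p∣C ∷ [])

  decomposition : ProductLattice τ₁ τ₂ (ι (+ n) *ℂ z) →
    S τ₁ τ₂ z ≅ (ℂ/ 𝒪[ n ℕ.* lcm f₁ f₂ ] K) ⊕ ((ℂ/ ((ℤ 1ℂ +ℤ τ₁) ·ᴸ (ℤ 1ℂ +ℤ τ₂))) /⟨ point z ⟩)
  decomposition = compare (coordinates₁ β₂∈) (coordinates₂ β₁∈)
    where
    compare : Rank₂ (ι A₁ *ℂ τ₁) (ι (+ f₁) *ℂ β₂) → Rank₂ (ι A₂ *ℂ τ₂) (ι (+ f₂) *ℂ β₁) →
      ProductLattice τ₁ τ₂ (ι (+ n) *ℂ z) →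
      S τ₁ τ₂ z ≅ (ℂ/ 𝒪[ n ℕ.* lcm f₁ f₂ ] K) ⊕ ((ℂ/ ((ℤ 1ℂ +ℤ τ₁) ·ᴸ (ℤ 1ℂ +ℤ τ₂))) /⟨ point z ⟩)
    compare (t , s , f₁β₂≈) (t′ , s′ , f₂β₁≈) = oriented t t′ s′ sign comparison
      where
      open Comparison torsionFree-ℂ τ₁ τ₂ β₁ β₂ independent₁ A₁ A₂ (+ g) (+ h₁) (+ h₂) a₁ a₂ s t s′ t′ A₁≢0 g≢0 h₂≢0
        (≈-trans generator₁ (C.+-congˡ (C.*-congʳ ι-f₁)))
        (≈-trans generator₂ (C.+-congˡ (C.*-congʳ ι-f₂)))
        (≈-trans (C.*-congʳ (≈-sym ι-f₂)) f₂β₁≈)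
        (≈-trans (C.*-congʳ (≈-sym ι-f₁)) f₁β₂≈)

-- The order of the point P.

module _ (τ₁ τ₂ z : ℂ) (n : ℕ) where
  private
    Ẽ : Torus 1
    Ẽ = ℂ/ ((ℤ 1ℂ +ℤ τ₁) ·ᴸ (ℤ 1ℂ +ℤ τ₂))
  open RawMonoidDefinitions (RawGroup.rawMonoid (torusGroup Ẽ)) using () renaming (_×_ to _·_)

  torsion⇒product : (n · point z -ᵛ (λ _ → 0ℂ)) ∈ Λ Ẽ → ProductLattice τ₁ τ₂ (ι (+ n) *ℂ z)
  torsion⇒product nz∈ = let X , Y , X∈ , Y∈ , eq = product⇒ nz∈ in X , Y , X∈ , Y∈ ,
    ≈-trans (≈-sym (multiple-value Ẽ n (point z) zero)) (≈-trans (≈-sym (minus-zero _)) eq)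

  -- If nz were p times an element of L₁L₂, then (n / p)z would lie in L₁L₂, and the smaller
  -- positive integer n / p would kill P.
  minimal⇒primitive : HasOrder (torusGroup Ẽ) (point z) n →
    ∀ p → Prime p → + p ∣ + n → ∀ x y → Rank₂ τ₂ x → Rank₂ τ₂ y → ¬ ι (+ n) *ℂ z ≈ℂ ι (+ p) *ℂ (x +ℂ τ₁ *ℂ y)
  minimal⇒primitive (n≥1 , _ , minimal) p p-prime p∣n x y x∈ y∈ nz≈ = p∤n (∣⇒∣ᵤ p∣n)
    where
    p∤n : ¬ p ℕ.∣ n
    p∤n (ℕ.divides zero    n≡0)  = contradiction (≡.subst (1 ℕ.≤_) n≡0 n≥1) λ ()
    p∤n (ℕ.divides m@(suc _) n≡mp) = ℕ.<⇒≱ m<n (minimal m (s≤s z≤n) (product⇐ (x , y , x∈ , y∈ ,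
      ≈-trans (minus-zero _) (≈-trans (multiple-value Ẽ m (point z) zero) mz≈))))
      where
      m<n : m ℕ.< n
      m<n = ≡.subst (m ℕ.<_) (≡.sym n≡mp) (ℕ.m<m*n m p (ℕ.nonTrivial⇒n>1 p {{prime⇒nonTrivial p-prime}}))
      p≢0 : + p ≢ 0ℤ
      p≢0 refl = contradiction (ℕ.nonTrivial⇒n>1 p {{prime⇒nonTrivial p-prime}}) λ ()
      mz≈ : ι (+ m) *ℂ z ≈ℂ x +ℂ τ₁ *ℂ y
      mz≈ = quotient-cancel torsionFree-ℂ (+ p) (+ m) (+ n) p≢0 (≡.trans (≡.cong +_ n≡mp) (ℤ.pos-* m p)) nz≈

open import Data.Nat.Base using (_*_)

theorem2p5 : (K : ImaginaryQuadraticField) (τ₁ τ₂ : ℂ) →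
  let L₁ = ℤ 1ℂ +ℤ τ₁
      L₂ = ℤ 1ℂ +ℤ τ₂
      Ẽ  = ℂ/ (L₁ ·ᴸ L₂)
  in τ₁ ∈ elements K → τ₂ ∈ elements K →
     IsLattice L₁ → IsLattice L₂ →
     (f₁ f₂ : ℕ) → HasConductor K L₁ f₁ → HasConductor K L₂ f₂ →
     (z : ℂ) (n : ℕ) → HasOrder (torusGroup Ẽ) (point z) n →
     S τ₁ τ₂ z ≅ (ℂ/ 𝒪[ n * lcm f₁ f₂ ] K) ⊕ (Ẽ /⟨ point z ⟩)
theorem2p5 K τ₁ τ₂ τ₁∈ τ₂∈ lattice₁ lattice₂ f₁ f₂ conductor₁ conductor₂ z n order =
  decomposition K τ₁ τ₂ z independent₁ independent₂ f₁ f₂ n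
    (quadraticData K τ₁∈ independent₁ conductor₁) (quadraticData K τ₂∈ independent₂ conductor₂)
    (gcdLcm f₁ f₂ (proj₁ conductor₁) (proj₁ conductor₂))
    n≢0 (minimal⇒primitive τ₁ τ₂ z n order) (torsion⇒product τ₁ τ₂ z n (proj₁ (proj₂ order)))
  where
  independent₁ : Independent τ₁
  independent₁ = lattice-independent lattice₁
  independent₂ : Independent τ₂
  independent₂ = lattice-independent lattice₂
  n≢0 : + n ≢ 0ℤ
  n≢0 refl = contradiction (proj₁ order) λ ()
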